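{- The generating function $\frac14\sum_{n\ge 3}X_{P_{n,v,w}}z^{n+2}$ of the paths twinned at both leaves has the following $e$-positive expansion: $$\frac14\sum_{n\ge 3}X_{P_{n,v,w}}z^{n+2}=\bigl(K(z)+e_1z\,G(z)\bigr)\frac{G_{\ge 3}(z)^2}{D(z)}+e_1z\,G_{\ge 3}(z)^2+\Bigl(G_{\ge 3}(z)\sum_{i\ge 3}i e_iz^i+e_1z\sum_{i\ge 4}(i-1)e_iz^i+e_2z^2\sum_{i\ge 3}(i-2)e_iz^i\Bigr)+\sum_{i\ge 5}i e_iz^i .$$ In terms of the path generating function $\mathcal{X}_P(z)$, the same series has the $e$-positive expression $$\mathcal{X}_P(z)\,G_{\ge 3}(z)^2+K_{\ge 5}(z)+G_{\ge 3}(z)\sum_{i\ge 3}e_iz^i+e_1z\,G_{\ge 4}(z)+e_2z^2\sum_{i\ge 3}(i-2)e_iz^i .$$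
   Context: The chromatic symmetric function of a finite simple graph $H=(V,E)$ is $X_H=\sum_\kappa\prod_{u\in V}x_{\kappa(u)}$, the sum over all proper colorings $\kappa:V\to\mathbb{Z}_{>0}$. $P_n$ is the path on $n$ vertices ($X_{P_0}=1$). The twin of a graph at a vertex $v$ is obtained by adding a new vertex $v'$ joined to $v$ and to all neighbors of $v$. $P_{n,v,w}$ denotes $P_n$ twinned at its two leaves $v$ and $w$ in succession. $e_i$ is the $i$-th elementary symmetric function; a symmetric function is $e$-positive if its expansion in the elementary basis has nonnegative coefficients, and a power series in $z$ over symmetric functions is $e$-positive if each of its coefficients is. Notation: $\mathcal{X}_P(z)=\sum_{n\ge 0}X_{P_n}z^n$, $K(z)=\sum_{i\ge 2} i e_i z^i$, $K_{\ge k}(z)=\sum_{i\ge k}ie_iz^i$, $G(z)=\sum_{i\ge 2}(i-1)e_iz^i$, $G_{\ge k}(z)=\sum_{i\ge k}(i-1)e_iz^i$, $D(z)=1-G(z)$. -}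

module Defs where

open import Algebra.Bundles using (Ring)
open import Algebra.Bundles.Raw using (RawRing)
open import Algebra.Definitions.RawMonoid using () renaming (_×_ to multiple)
open import Data.Bool using (true; false; if_then_else_)
open import Data.Empty using (⊥)
open import Data.Fin as Fin using (Fin; zero; suc; toℕ; fromℕ)
open import Data.Fin.Properties using (all?)
open import Data.Integer using (+_)
open import Data.List using (List; []; _∷_; [_]; _∷ʳ_; _++_; map; foldr; filter; length; upTo; applyUpTo; zipWith; concatMap; cartesianProductWith)
open import Data.List.Properties using (map-++; map-∘; map-cong; map-concatMap; concatMap-cong; upTo-∷ʳ; length-++)
open import Data.List.Relation.Unary.All as All using (All; []; _∷_)
open import Data.List.Relation.Unary.Linked using (Linked)
open import Data.List.Relation.Unary.Unique.Propositional using (Unique)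
open import Data.Nat as ℕ using (ℕ; zero; suc; _∸_; _≤ᵇ_; _≡ᵇ_)
import Data.Nat.Properties as ℕ
open import Data.Product using (Σ; _×_; _,_; proj₁)
open import Data.Rational as ℚ using (ℚ; 0ℚ; 1ℚ; _/_)
import Data.Rational.Properties as ℚ
open import Data.Sum using (_⊎_; inj₁; inj₂)
open import Data.Vec as Vec using (Vec; []; _∷_; lookup)
import Data.Vec.Relation.Unary.Linked as Vec
open import Function using (_∘_)
open import Level using (0ℓ)
open import Relation.Binary.PropositionalEquality using (_≡_; _≢_; refl; sym; trans; cong; cong₂; subst; module ≡-Reasoning)
open import Relation.Nullary using (¬_; Dec; yes; no; does)
open import Relation.Nullary.Decidable using (_→-dec_; _⊎-dec_; ¬?)
open import Relation.Unary using (Pred; Decidable)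

module PowerSeries {c ℓ} (R : RawRing c ℓ) where

  private module R = RawRing R
  open R using (Carrier)

  Series : Set c
  Series = ℕ → Carrier

  ∑ : List Carrier → Carrier
  ∑ = foldr R._+_ R.0#

  infix 9 _z^_
  _z^_ : Carrier → ℕ → Series
  (a z^ k) n = if n ≡ᵇ k then a else R.0#

  -- ∑≥ k a  is  ∑_{i ≥ k} aᵢ zⁱ
  ∑≥ : ℕ → (ℕ → Carrier) → Series
  ∑≥ k a n = if k ≤ᵇ n then a n else R.0#

  rawRing : RawRing c ℓ
  rawRing = record
    { Carrier = Series
    ; _≈_     = λ a b → ∀ n → a n R.≈ b n
    ; _+_     = λ a b n → a n R.+ b n
    ; _*_     = λ a b n → ∑ (applyUpTo (λ i → a i R.* b (n ∸ i)) (suc n))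
    ; -_      = λ a n → R.- a n
    ; 0#      = λ _ → R.0#
    ; 1#      = R.1# z^ 0
    }

  -- The reciprocal 1/a, meaningful only when a has constant term 1; see
  -- *-recip below.  recips a n  lists the coefficients n, n-1, …, 0 of 1/a.
  recip  : Series → Series
  recips : Series → ℕ → List Carrier
  recip a zero    = R.1#
  recip a (suc n) = R.- ∑ (zipWith R._*_ (applyUpTo (a ∘ suc) (suc n)) (recips a n))
  recips a zero    = recip a zero ∷ []
  recips a (suc n) = recip a (suc n) ∷ recips a n

module _ {c ℓ} (R : Ring c ℓ) where

  private module R = Ring R
  open PowerSeries R.rawRing
  open RawRing rawRing using (_≈_; _*_; 1#)
  open import Relation.Binary.Reasoning.Setoid R.setoid

  private
    zipWith-recips : ∀ (a : Series) f n →
      zipWith R._*_ (applyUpTo f (suc n)) (recips a n) ≡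
      applyUpTo (λ i → f i R.* recip a (n ∸ i)) (suc n)
    zipWith-recips a f zero    = refl
    zipWith-recips a f (suc n) = cong (f 0 R.* recip a (suc n) ∷_) (zipWith-recips a (f ∘ suc) n)

  *-recip : ∀ a → a 0 R.≈ R.1# → a * recip a ≈ 1#
  *-recip a a₀≈1 zero = begin
    a 0 R.* R.1# R.+ R.0#  ≈⟨ R.+-identityʳ _ ⟩
    a 0 R.* R.1#           ≈⟨ R.*-identityʳ _ ⟩
    a 0                    ≈⟨ a₀≈1 ⟩
    R.1#                   ∎
  *-recip a a₀≈1 (suc n) = begin
    a 0 R.* recip a (suc n) R.+ s  ≈⟨ R.+-congʳ (R.*-congʳ a₀≈1) ⟩
    R.1# R.* recip a (suc n) R.+ s ≈⟨ R.+-congʳ (R.*-identityˡ _) ⟩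
    recip a (suc n) R.+ s          ≡⟨ cong (λ l → R.- ∑ l R.+ s) (zipWith-recips a (a ∘ suc) n) ⟩
    R.- s R.+ s                    ≈⟨ R.-‿inverseˡ s ⟩
    R.0#                           ∎
    where s = ∑ (applyUpTo (λ i → a (suc i) R.* recip a (n ∸ i)) (suc n))

sumℚ : List ℚ → ℚ
sumℚ = foldr ℚ._+_ 0ℚ

-- Formal power series over ℚ in x₀, x₁, x₂, … .  The list a₀ ∷ … ∷ aₘ ∷ []
-- stands for the monomial x₀^a₀ ⋯ xₘ^aₘ, so trailing zeros are immaterial.
record FPS : Set where
  field
    coeff : List ℕ → ℚ
    pad   : ∀ α → coeff (α ∷ʳ 0) ≡ coeff α
open FPS public

-- All (β , γ) with β + γ = α, the three lists having the same length.
splits : List ℕ → List (List ℕ × List ℕ)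
splits []      = [ [] , [] ]
splits (a ∷ α) = concatMap (λ i → map (λ (β , γ) → i ∷ β , (a ∸ i) ∷ γ) (splits α)) (upTo (suc a))

snoc₀ : List ℕ × List ℕ → List ℕ × List ℕ
snoc₀ (β , γ) = β ∷ʳ 0 , γ ∷ʳ 0

splits-∷ʳ : ∀ α → splits (α ∷ʳ 0) ≡ map snoc₀ (splits α)
splits-∷ʳ []      = refl
splits-∷ʳ (a ∷ α) = begin
  concatMap (λ i → map (c i) (splits (α ∷ʳ 0))) us      ≡⟨ concatMap-cong (λ i → cong (map (c i)) (splits-∷ʳ α)) us ⟩
  concatMap (λ i → map (c i) (map snoc₀ (splits α))) us ≡⟨ concatMap-cong (λ i → trans (sym (map-∘ (splits α))) (map-∘ (splits α))) us ⟩
  concatMap (λ i → map snoc₀ (map (c i) (splits α))) us ≡⟨ map-concatMap snoc₀ _ us ⟨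
  map snoc₀ (splits (a ∷ α))                            ∎
  where
  open ≡-Reasoning
  us = upTo (suc a)
  c : ℕ → List ℕ × List ℕ → List ℕ × List ℕ
  c i (β , γ) = i ∷ β , (a ∸ i) ∷ γ

infixl 7 _⊛_
_⊛_ : (List ℕ → ℚ) → (List ℕ → ℚ) → List ℕ → ℚ
(f ⊛ g) α = sumℚ (map (λ (β , γ) → f β ℚ.* g γ) (splits α))

⊛-∷ʳ : ∀ f g α → (f ⊛ g) (α ∷ʳ 0) ≡ sumℚ (map (λ (β , γ) → f (β ∷ʳ 0) ℚ.* g (γ ∷ʳ 0)) (splits α))
⊛-∷ʳ f g α = cong sumℚ (trans (cong (map _) (splits-∷ʳ α)) (sym (map-∘ (splits α))))

unitCoeff : List ℕ → ℚ
unitCoeff []          = 1ℚ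
unitCoeff (zero ∷ α)  = unitCoeff α
unitCoeff (suc _ ∷ _) = 0ℚ

varCoeff : ℕ → List ℕ → ℚ
varCoeff _       []              = 0ℚ
varCoeff zero    (1 ∷ α)         = unitCoeff α
varCoeff zero    (_ ∷ _)         = 0ℚ
varCoeff (suc i) (zero ∷ α)      = varCoeff i α
varCoeff (suc i) (suc _ ∷ _)     = 0ℚ

unitCoeff-pad : ∀ α → unitCoeff (α ∷ʳ 0) ≡ unitCoeff α
unitCoeff-pad []          = refl
unitCoeff-pad (zero ∷ α)  = unitCoeff-pad α
unitCoeff-pad (suc _ ∷ _) = refl

varCoeff-pad : ∀ i α → varCoeff i (α ∷ʳ 0) ≡ varCoeff i α
varCoeff-pad zero    []                = refl
varCoeff-pad (suc _) []                = refl
varCoeff-pad zero    (zero ∷ α)        = refl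
varCoeff-pad zero    (1 ∷ α)           = unitCoeff-pad α
varCoeff-pad zero    (suc (suc _) ∷ α) = refl
varCoeff-pad (suc i) (zero ∷ α)        = varCoeff-pad i α
varCoeff-pad (suc i) (suc _ ∷ α)       = refl

FPS-rawRing : RawRing 0ℓ 0ℓ
FPS-rawRing = record
  { Carrier = FPS
  ; _≈_     = λ f g → ∀ α → coeff f α ≡ coeff g α
  ; _+_     = λ f g → record
    { coeff = λ α → coeff f α ℚ.+ coeff g α
    ; pad   = λ α → cong₂ ℚ._+_ (pad f α) (pad g α) }
  ; _*_     = λ f g → record
    { coeff = coeff f ⊛ coeff g
    ; pad   = λ α → trans (⊛-∷ʳ (coeff f) (coeff g) α)
        (cong sumℚ (map-cong (λ (β , γ) → cong₂ ℚ._*_ (pad f β) (pad g γ)) (splits α))) }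
  ; -_      = λ f → record { coeff = λ α → ℚ.- coeff f α ; pad = λ α → cong ℚ.-_ (pad f α) }
  ; 0#      = record { coeff = λ _ → 0ℚ ; pad = λ _ → refl }
  ; 1#      = record { coeff = unitCoeff ; pad = unitCoeff-pad }
  }

module FPS-Ring = RawRing FPS-rawRing

x : ℕ → FPS
x i = record { coeff = varCoeff i ; pad = varCoeff-pad i }

infixr 8 _•_ _•ℕ_
_•_ : ℚ → FPS → FPS
c • f = record { coeff = λ α → c ℚ.* coeff f α ; pad = λ α → cong (c ℚ.*_) (pad f α) }

_•ℕ_ : ℕ → FPS → FPS
_•ℕ_ = multiple FPS-Ring.+-rawMonoid

∏x : ∀ {n} → Vec ℕ n → FPS
∏x []      = FPS-Ring.1#
∏x (i ∷ w) = x i FPS-Ring.* ∏x w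

-- All words of length n in the letters 0, …, m-1.
words : ∀ n → ℕ → List (Vec ℕ n)
words zero    m = [ [] ]
words (suc n) m = cartesianProductWith _∷_ (upTo m) (words n m)

module _ {n} {P : Pred (Vec ℕ n) 0ℓ} (P? : Decidable P) where

  wordSumCoeff : List ℕ → ℚ
  wordSumCoeff α = sumℚ (map (λ w → coeff (∏x w) α) (filter P? (words n (length α))))

sumℚ-++ : ∀ l k → sumℚ (l ++ k) ≡ sumℚ l ℚ.+ sumℚ k
sumℚ-++ []      k = sym (ℚ.+-identityˡ _)
sumℚ-++ (q ∷ l) k = trans (cong (q ℚ.+_) (sumℚ-++ l k)) (sym (ℚ.+-assoc q _ _))

sumℚ-0 : ∀ {A : Set} (f : A → ℚ) {l} → All (λ a → f a ≡ 0ℚ) l → sumℚ (map f l) ≡ 0ℚ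
sumℚ-0 f []       = refl
sumℚ-0 f (e ∷ es) = trans (cong₂ ℚ._+_ e (sumℚ-0 f es)) (ℚ.+-identityˡ 0ℚ)

sumℚ-filter : ∀ {A : Set} {P : Pred A 0ℓ} (P? : Decidable P) (f : A → ℚ) l →
  sumℚ (map f (filter P? l)) ≡ sumℚ (map (λ a → if does (P? a) then f a else 0ℚ) l)
sumℚ-filter P? f []      = refl
sumℚ-filter P? f (a ∷ l) with does (P? a)
... | true  = cong (f a ℚ.+_) (sumℚ-filter P? f l)
... | false = trans (sumℚ-filter P? f l) (sym (ℚ.+-identityˡ _))

data _∋_ : ∀ {n} → Vec ℕ n → ℕ → Set where
  ∋-head : ∀ {n m} {w : Vec ℕ n} → (m ∷ w) ∋ m
  ∋-tail : ∀ {n m i} {w : Vec ℕ n} → w ∋ m → (i ∷ w) ∋ m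

sum-words-suc : ∀ n m i (F : Vec ℕ (suc n) → ℚ) k →
  sumℚ (map F (cartesianProductWith _∷_ (i ∷ k) (words n m))) ≡
  sumℚ (map (F ∘ (i ∷_)) (words n m)) ℚ.+ sumℚ (map F (cartesianProductWith _∷_ k (words n m)))
sum-words-suc n m i F k = begin
  sumℚ (map F (map (i ∷_) ws ++ r))                 ≡⟨ cong sumℚ (map-++ F (map (i ∷_) ws) r) ⟩
  sumℚ (map F (map (i ∷_) ws) ++ map F r)           ≡⟨ sumℚ-++ (map F (map (i ∷_) ws)) (map F r) ⟩
  sumℚ (map F (map (i ∷_) ws)) ℚ.+ sumℚ (map F r)   ≡⟨ cong (λ l → sumℚ l ℚ.+ sumℚ (map F r)) (map-∘ ws) ⟨
  sumℚ (map (F ∘ (i ∷_)) ws) ℚ.+ sumℚ (map F r)     ∎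
  where
  open ≡-Reasoning
  ws = words n m
  r  = cartesianProductWith _∷_ k ws

words-restrict : ∀ n m (F : Vec ℕ n → ℚ) → (∀ w → w ∋ m → F w ≡ 0ℚ) →
  sumℚ (map F (words n (suc m))) ≡ sumℚ (map F (words n m))
words-restrict zero    m F F0 = refl
words-restrict (suc n) m F F0 = trans
  (cong (λ l → sumℚ (map F (cartesianProductWith _∷_ l (words n (suc m))))) (sym (upTo-∷ʳ m)))
  (go (upTo m))
  where
  go : ∀ l → sumℚ (map F (cartesianProductWith _∷_ (l ∷ʳ m) (words n (suc m)))) ≡
             sumℚ (map F (cartesianProductWith _∷_ l (words n m)))
  go []      = trans (sum-words-suc n (suc m) m F [])
    (cong (ℚ._+ 0ℚ) (sumℚ-0 _ (All.universal (λ w → F0 (m ∷ w) ∋-head) (words n (suc m)))))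
  go (i ∷ l) = trans (sum-words-suc n (suc m) i F (l ∷ʳ m)) (trans
    (cong₂ ℚ._+_ (words-restrict n m (F ∘ (i ∷_)) (λ w w∋m → F0 (i ∷ w) (∋-tail w∋m))) (go l))
    (sym (sum-words-suc n m i F l)))

splits-length : ∀ α → All (λ (β , γ) → length β ≡ length α × length γ ≡ length α) (splits α)
splits-length []      = (refl , refl) ∷ []
splits-length (a ∷ α) = concat⁺ (map⁺ (All.universal
    (λ i → map⁺ (All.map (λ (p , q) → cong suc p , cong suc q) (splits-length α))) (upTo (suc a))))
  where open import Data.List.Relation.Unary.All.Properties using (concat⁺; map⁺)

varCoeff-0 : ∀ α → varCoeff (length α) α ≡ 0ℚ
varCoeff-0 []          = refl
varCoeff-0 (zero ∷ α)  = varCoeff-0 α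
varCoeff-0 (suc _ ∷ α) = refl

∏x-0 : ∀ {n} (w : Vec ℕ n) α → w ∋ length α → coeff (∏x w) (α ∷ʳ 0) ≡ 0ℚ
∏x-0 (i ∷ w) α w∋m = trans (⊛-∷ʳ (varCoeff i) (coeff (∏x w)) α)
  (sumℚ-0 _ (All.map (λ {(β , γ)} (p , q) → factor β γ w∋m p q) (splits-length α)))
  where
  factor : ∀ β γ → (i ∷ w) ∋ length α → length β ≡ length α → length γ ≡ length α →
           varCoeff i (β ∷ʳ 0) ℚ.* coeff (∏x w) (γ ∷ʳ 0) ≡ 0ℚ
  factor β γ ∋-head p q = trans
    (cong (ℚ._* _) (trans (varCoeff-pad _ β) (trans (cong (λ k → varCoeff k β) (sym p)) (varCoeff-0 β))))
    (ℚ.*-zeroˡ (coeff (∏x w) (γ ∷ʳ 0)))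
  factor β γ (∋-tail w∋m) p q = trans
    (cong (varCoeff i (β ∷ʳ 0) ℚ.*_) (∏x-0 w γ (subst (w ∋_) (sym q) w∋m)))
    (ℚ.*-zeroʳ (varCoeff i (β ∷ʳ 0)))

wordSumCoeff-pad : ∀ {n} {P : Pred (Vec ℕ n) 0ℓ} (P? : Decidable P) α →
  wordSumCoeff P? (α ∷ʳ 0) ≡ wordSumCoeff P? α
wordSumCoeff-pad {n} P? α = begin
  sumℚ (map c₀ (filter P? (words n (length (α ∷ʳ 0)))))  ≡⟨ sumℚ-filter P? c₀ (words n (length (α ∷ʳ 0))) ⟩
  sumℚ (map F₀ (words n (length (α ∷ʳ 0))))              ≡⟨ cong (λ k → sumℚ (map F₀ (words n k))) len ⟩
  sumℚ (map F₀ (words n (suc (length α))))               ≡⟨ words-restrict n (length α) F₀ F₀-0 ⟩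
  sumℚ (map F₀ (words n (length α)))                     ≡⟨ sumℚ-filter P? c₀ (words n (length α)) ⟨
  sumℚ (map c₀ (filter P? (words n (length α))))         ≡⟨ cong sumℚ (map-cong (λ w → pad (∏x w) α) (filter P? (words n (length α)))) ⟩
  wordSumCoeff P? α                                      ∎
  where
  open ≡-Reasoning
  c₀ F₀ : Vec ℕ n → ℚ
  c₀ w = coeff (∏x w) (α ∷ʳ 0)
  F₀ w = if does (P? w) then c₀ w else 0ℚ
  len : length (α ∷ʳ 0) ≡ suc (length α)
  len = trans (length-++ α) (ℕ.+-comm (length α) 1)
  F₀-0 : ∀ w → w ∋ length α → F₀ w ≡ 0ℚ
  F₀-0 w w∋m with does (P? w)
  ... | true  = ∏x-0 w α w∋m
  ... | false = refl

-- The infinite sum of x_{w₁} ⋯ x_{wₙ} over all words w ∈ ℕⁿ satisfying P.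
-- A word with a letter ≥ length α contributes nothing to the coefficient of
-- the monomial α, so that coefficient is a sum over words n (length α).
wordSum : ∀ {n} {P : Pred (Vec ℕ n) 0ℓ} → Decidable P → FPS
wordSum P? = record { coeff = wordSumCoeff P? ; pad = wordSumCoeff-pad P? }

e : ℕ → FPS
e k = wordSum {k} (Vec.linked? ℕ._<?_)

record SimpleGraph (n : ℕ) : Set₁ where
  field
    _~_     : Fin n → Fin n → Set
    _~?_    : ∀ u v → Dec (u ~ v)
    ~-sym   : ∀ {u v} → u ~ v → v ~ u
    ~-irrefl : ∀ {u} → ¬ (u ~ u)

module _ {n} (H : SimpleGraph n) where
  open SimpleGraph H

  Proper : Vec ℕ n → Set
  Proper κ = ∀ u v → u ~ v → lookup κ u ≢ lookup κ v

  proper? : Decidable Proper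
  proper? κ = all? λ u → all? λ v → (u ~? v) →-dec ¬? (lookup κ u ℕ.≟ lookup κ v)

  -- The chromatic symmetric function; colours are indexed from 0.
  X : FPS
  X = wordSum proper?

path : ∀ n → SimpleGraph n
path n = record
  { _~_      = λ u v → suc (toℕ u) ≡ toℕ v ⊎ suc (toℕ v) ≡ toℕ u
  ; _~?_     = λ u v → (suc (toℕ u) ℕ.≟ toℕ v) ⊎-dec (suc (toℕ v) ℕ.≟ toℕ u)
  ; ~-sym    = λ { (inj₁ p) → inj₂ p ; (inj₂ p) → inj₁ p }
  ; ~-irrefl = λ { (inj₁ p) → ℕ.1+n≢n p ; (inj₂ p) → ℕ.1+n≢n p }
  }

module _ {n} (H : SimpleGraph n) (v : Fin n) where
  open SimpleGraph H

  -- The new vertex is zero and the old vertex u becomes suc u.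
  TwinAdj : Fin (suc n) → Fin (suc n) → Set
  TwinAdj zero    zero     = ⊥
  TwinAdj zero    (suc u)  = u ≡ v ⊎ u ~ v
  TwinAdj (suc u) zero     = u ≡ v ⊎ u ~ v
  TwinAdj (suc u) (suc u′) = u ~ u′

  twin : SimpleGraph (suc n)
  twin = record { _~_ = TwinAdj ; _~?_ = dec ; ~-sym = λ {a} {b} → symm a b ; ~-irrefl = λ {a} → irr a }
    where
    dec : ∀ a b → Dec (TwinAdj a b)
    dec zero    zero     = no λ ()
    dec zero    (suc u)  = (u Fin.≟ v) ⊎-dec (u ~? v)
    dec (suc u) zero     = (u Fin.≟ v) ⊎-dec (u ~? v)
    dec (suc u) (suc u′) = u ~? u′
    symm : ∀ a b → TwinAdj a b → TwinAdj b a
    symm zero    (suc u)  p = p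
    symm (suc u) zero     p = p
    symm (suc u) (suc u′) p = ~-sym p
    irr : ∀ a → ¬ TwinAdj a a
    irr (suc u) p = ~-irrefl p

-- leafTwinnedPath m  is  P_{n,v,w}  for n = m + 1, with v the first and w the
-- last vertex of P_n; after the first twinning w is the vertex suc w.
leafTwinnedPath : ∀ m → SimpleGraph (3 ℕ.+ m)
leafTwinnedPath m = twin (twin (path (suc m)) v) (suc w)
  where
  v w : Fin (suc m)
  v = zero
  w = fromℕ m

e[_] : List ℕ → FPS
e[ λs ] = foldr (λ i f → e i FPS-Ring.* f) FPS-Ring.1# λs

IsPartition : List ℕ → Set
IsPartition λs = Linked ℕ._≥_ λs × All (0 ℕ.<_) λs

record ElementaryExpansion (f : FPS) : Set where
  field
    terms      : List (List ℕ × ℚ)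
    partitions : All (IsPartition ∘ proj₁) terms
    distinct   : Unique (map proj₁ terms)
    expansion  : f FPS-Ring.≈ foldr (λ (λs , c) g → c • e[ λs ] FPS-Ring.+ g) FPS-Ring.0# terms

-- Since the e[ λs ] form a basis, a symmetric function has essentially one
-- elementary expansion.
EPositive : FPS → Set
EPositive f = Σ (ElementaryExpansion f) λ E → All (λ (_ , c) → 0ℚ ℚ.≤ c) (ElementaryExpansion.terms E)

open PowerSeries FPS-rawRing public using (Series; _z^_; ∑≥; recip)
open RawRing (PowerSeries.rawRing FPS-rawRing) public using (_≈_; _+_; _*_; -_; 1#)

infixl 6 _-_
_-_ : Series → Series → Series
f - g = f + - g

infixr 8 _•ᶻ_
_•ᶻ_ : ℚ → Series → Series
(c •ᶻ f) n = c • f n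

EPositiveSeries : Series → Set
EPositiveSeries f = ∀ n → EPositive (f n)

K≥ G≥ : ℕ → Series
K≥ k = ∑≥ k λ i → i •ℕ e i
G≥ k = ∑≥ k λ i → (i ∸ 1) •ℕ e i

K G D : Series
K = K≥ 2
G = G≥ 2
D = 1# - G

𝒳P : Series
𝒳P n = X (path n)

-- ∑_{n ≥ 3} X_{P_{n,v,w}} z^{n+2}
leafTwinnedSeries : Series
leafTwinnedSeries (suc (suc (suc (suc (suc k))))) = X (leafTwinnedPath (2 ℕ.+ k))
leafTwinnedSeries _                               = FPS-Ring.0#

¼ : ℚ
¼ = + 1 / 4

-- Fix the number m of variables.  In a proper colouring of the twinned path, the
-- end vertex, its twin and their common neighbour of colour c form a triangle, so
-- summing over the two leaves and their twins contributes 2ê₂(c) at each end, where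
-- ê₂(c) is e₂ in the variables other than x_c.  Hence, up to the factor 4, the series
-- is the sum over nonempty proper words weighted by ê₂(first letter) ê₂(last letter).
--
-- With y_c = x_c z, E = ∏ (1 + y_c) and T_c = y_c E / (1 + y_c), one has ∑ T_c = zE′
-- and E − zE′ = D.  If W_c sums the words starting with c, with weight v at the last
-- letter, then (1 + y_c) W_c = y_c (v_c + W), where W = ∑ W_c.  Multiplying by
-- E / (1 + y_c) and summing gives D W = ∑ T_c v_c, and for a weight u at the first letter
--   D E ∑ u_c W_c = D ∑ u_c v_c T_c + (∑ u_c T_c)(∑ v_c T_c).
-- For u = v = 1 this is D 𝒳P = E.  For u = v = z² ê₂, writing R = ∑_{i≥3} eᵢzⁱ,
--   ∑ u_c T_c  = G≥3 E + D R,
--   ∑ u_c² T_c = (1 + e₁z + e₂z²) ∑ u_c T_c − (3e₃z³ + 2e₁e₃z⁴ + 4e₄z⁴) E,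
-- and dividing by D E yields the formula in terms of 𝒳P; the other one follows from
-- 𝒳P = 1 + e₁z + (K + e₁zG)/D, and is visibly e-positive since 1/D = ∑ Gᵏ.
module Submission where

open import Algebra.Bundles using (CommutativeRing; RawRing)
open import Algebra.Morphism.Structures using (IsRingMonomorphism)
import Algebra.Morphism.RingMonomorphism as RingMonomorphism
open import Algebra.Solver.Ring.AlmostCommutativeRing using (fromCommutativeRing; _-Raw-AlmostCommutative⟶_)
open import Algebra.Structures using (IsCommutativeRing)
open import Data.Bool as Bool using (true; false; if_then_else_)
open import Data.Fin as Fin using (Fin; zero; suc; toℕ; fromℕ)
open import Data.Fin.Properties using (all?)
import Data.Fin.Properties as Fin
open import Data.List using (List; []; _∷_; map; length; _++_; foldr; applyUpTo; concatMap; cartesianProductWith)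
open import Data.List.Properties using (map-++; map-∘; ≡-dec)
import Data.List.Relation.Binary.Permutation.Propositional as Perm
open import Data.List.Relation.Binary.Permutation.Propositional.Properties using (All-resp-↭)
open import Data.List.Relation.Unary.All as All using (All; []; _∷_)
open import Data.List.Relation.Unary.All.Properties using (++⁺; map⁺)
open import Data.List.Relation.Unary.AllPairs using ([]; _∷_)
open import Data.List.Relation.Unary.Unique.Propositional using (Unique)
open import Data.Maybe.Base using (Maybe; just; nothing)
open import Data.Nat as ℕ using (ℕ; zero; suc; _∸_; _≤ᵇ_; _≡ᵇ_)
import Data.Nat.Properties as ℕ
open import Data.Product using (_×_; _,_; proj₁; Σ)
import Data.Product.Properties as Product
open import Data.Rational as ℚ using (ℚ; 0ℚ; 1ℚ)
import Data.Rational.Properties as ℚ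
open import Data.Sum as Sum using (_⊎_; inj₁; inj₂)
open import Data.Unit using (tt)
open import Data.Vec using (Vec; []; _∷_; lookup)
import Data.Vec.Relation.Unary.Linked as Linked
open import Function using (_∘_)
open import Level using (0ℓ)
import Relation.Binary.Construct.Flip.EqAndOrd as Flip
open import Relation.Binary.PropositionalEquality as ≡ using (_≡_; _≢_)
open import Relation.Nullary using (¬_; Dec; yes; no; does)
open import Relation.Nullary.Decidable using (_×-dec_; ¬?; _→-dec_; _⊎-dec_)
open import Relation.Nullary.Negation using (contradiction)
open import Relation.Unary using (Pred; Decidable)
open import Data.List.Sort (Flip.decTotalOrder ℕ.≤-decTotalOrder) using (sort; sort-↭; sort-↗)
import Defs
open Defs using (SimpleGraph; Proper; proper?; path; twin; leafTwinnedPath; IsPartition)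

-- The obstacle is that `X` and `e` are infinite sums over words, and that ∏ (1 + y_c) over all
-- variables is not a finite product. The coefficient at an exponent list of length m, however,
-- involves only words with letters below m. Hence `truncatedRing m` keeps the elements and
-- operations of `FPS` and only coarsens the equality to exponent lists of length m. There `e` is a
-- finite product and every `X` a finite sum, and the results for all m together give equality in
-- `FPS`. Division by D and E rests on their constant term 1, which makes `recip` an inverse. The
-- factor 4 is carried as a sum of four copies, so the transfer identities hold in every commutative
-- ring; it is removed over ℚ at the end. The letters of a word are the colours of the interior
-- vertices. For n = 3 there is a single letter, shared by both triangles; this is why n ≥ 3 matches
-- nonempty words. The constants 2, 3 and 4 in the formula for the sum of u_c² T_c come from the
-- moments: the sum of x_c ê_n(c) over c is (n+1) e_{n+1}.

-- Integer coefficients for the ring solver.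

-- (a , b) denotes the integer a - b.  Normal forms of the solver are compared
-- syntactically, hence the reduction.
reduce : ℕ → ℕ → ℕ × ℕ
reduce (suc a) (suc b) = reduce a b
reduce a       b       = a , b

differences : RawRing 0ℓ 0ℓ
differences = record
  { Carrier = ℕ × ℕ
  ; _≈_     = _≡_
  ; _+_     = λ (a , b) (c , d) → reduce (a ℕ.+ c) (b ℕ.+ d)
  ; _*_     = λ (a , b) (c , d) → reduce (a ℕ.* c ℕ.+ b ℕ.* d) (a ℕ.* d ℕ.+ b ℕ.* c)
  ; -_      = λ (a , b) → b , a
  ; 0#      = 0 , 0
  ; 1#      = 1 , 0
  }

-- The integers map to every commutative ring, and equality of their representatives is decidable.
-- With them as coefficients the solver recognises cancelling terms in rings whose own equality is
-- undecidable.
module IntegerCoefficients {c ℓ} (R : CommutativeRing c ℓ) where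
  open CommutativeRing R hiding (zero)
  open import Algebra.Properties.Semiring.Mult.TCOptimised semiring using (×-homo-+; ×1-homo-*) renaming (_×_ to _·_)
  open import Algebra.Properties.AbelianGroup +-abelianGroup using (⁻¹-∙-comm; ⁻¹-involutive)
  open import Algebra.Properties.Ring ring using (-‿distribˡ-*; -‿distribʳ-*; -0#≈0#)
  open import Algebra.Properties.CommutativeSemigroup +-commutativeSemigroup using (interchange)
  open import Relation.Binary.Reasoning.Setoid setoid

  private
    nat : ℕ → Carrier
    nat n = n · 1#

    -- The split makes ⟦ 1 , 0 ⟧ reduce to 1#.
    ⟦_⟧ : ℕ × ℕ → Carrier
    ⟦ a , zero ⟧  = nat a
    ⟦ a , suc b ⟧ = nat a - nat (suc b)

    ⟦⟧-difference : ∀ a b → ⟦ a , b ⟧ ≈ nat a - nat b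
    ⟦⟧-difference a zero    = sym (trans (+-congˡ -0#≈0#) (+-identityʳ _))
    ⟦⟧-difference a (suc b) = refl

    +-difference : ∀ p q r s → (p + r) - (q + s) ≈ (p - q) + (r - s)
    +-difference p q r s = trans (+-congˡ (sym (⁻¹-∙-comm q s))) (interchange p r (- q) (- s))

    -- This shows that a pair keeps its value when `reduce` strips a common `suc`.
    cross : ∀ {p q r s} → p + s ≈ r + q → p - q ≈ r - s
    cross {p} {q} {r} {s} eq = begin
      p - q             ≈⟨ cancel p q s ⟩
      (p + s) - (q + s) ≈⟨ +-cong eq (-‿cong (+-comm q s)) ⟩
      (r + q) - (s + q) ≈⟨ cancel r s q ⟨
      r - s             ∎
      where
      cancel : ∀ p q s → p - q ≈ (p + s) - (q + s)
      cancel p q s = begin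
        p - q               ≈⟨ +-identityʳ _ ⟨
        p - q + 0#          ≈⟨ +-congˡ (-‿inverseʳ s) ⟨
        (p - q) + (s - s)   ≈⟨ +-difference p q s s ⟨
        (p + s) - (q + s)   ∎

    ⟦⟧-reduce : ∀ a b → ⟦ reduce a b ⟧ ≈ nat a - nat b
    ⟦⟧-reduce zero    b       = ⟦⟧-difference zero b
    ⟦⟧-reduce (suc a) zero    = ⟦⟧-difference (suc a) zero
    ⟦⟧-reduce (suc a) (suc b) = trans (⟦⟧-reduce a b) (cross (begin
      nat a + nat (suc b)      ≈⟨ +-congˡ (×-homo-+ 1# 1 b) ⟩
      nat a + (1# + nat b)     ≈⟨ +-assoc _ _ _ ⟨
      nat a + 1# + nat b       ≈⟨ +-congʳ (+-comm _ _) ⟩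
      1# + nat a + nat b       ≈⟨ +-congʳ (×-homo-+ 1# 1 a) ⟨
      nat (suc a) + nat b      ∎))

    +-homo : ∀ i j → ⟦ RawRing._+_ differences i j ⟧ ≈ ⟦ i ⟧ + ⟦ j ⟧
    +-homo (a , b) (c , d) = begin
      ⟦ reduce (a ℕ.+ c) (b ℕ.+ d) ⟧       ≈⟨ ⟦⟧-reduce (a ℕ.+ c) (b ℕ.+ d) ⟩
      nat (a ℕ.+ c) - nat (b ℕ.+ d)        ≈⟨ +-cong (×-homo-+ 1# a c) (-‿cong (×-homo-+ 1# b d)) ⟩
      (nat a + nat c) - (nat b + nat d)    ≈⟨ +-difference _ _ _ _ ⟩
      (nat a - nat b) + (nat c - nat d)    ≈⟨ +-cong (⟦⟧-difference a b) (⟦⟧-difference c d) ⟨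
      ⟦ a , b ⟧ + ⟦ c , d ⟧                ∎

    -‿homo : ∀ i → ⟦ RawRing.-_ differences i ⟧ ≈ - ⟦ i ⟧
    -‿homo (a , b) = begin
      ⟦ b , a ⟧           ≈⟨ ⟦⟧-difference b a ⟩
      nat b - nat a       ≈⟨ +-comm _ _ ⟩
      - nat a + nat b     ≈⟨ +-congˡ (⁻¹-involutive (nat b)) ⟨
      - nat a - (- nat b) ≈⟨ ⁻¹-∙-comm (nat a) (- nat b) ⟩
      - (nat a - nat b)   ≈⟨ -‿cong (⟦⟧-difference a b) ⟨
      - ⟦ a , b ⟧         ∎

    *-difference : ∀ p q r s → (p * r + q * s) - (p * s + q * r) ≈ (p - q) * (r - s)
    *-difference p q r s = begin
      (p * r + q * s) - (p * s + q * r)          ≈⟨ +-difference _ _ _ _ ⟩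
      (p * r - p * s) + (q * s - q * r)          ≈⟨ +-cong (+-congˡ (-‿distribʳ-* p s)) (+-comm _ _) ⟩
      (p * r + p * - s) + (- (q * r) + q * s)    ≈⟨ +-congˡ (+-cong (sym (-‿distribˡ-* q r)) (⁻¹-involutive _)) ⟨
      (p * r + p * - s) + (- q * r + - - (q * s)) ≈⟨ +-congˡ (+-congˡ (trans (-‿cong (-‿distribʳ-* q s)) (-‿distribˡ-* q (- s)))) ⟩
      (p * r + p * - s) + (- q * r + - q * - s)  ≈⟨ +-cong (distribˡ p r (- s)) (distribˡ (- q) r (- s)) ⟨
      p * (r - s) + - q * (r - s)                ≈⟨ distribʳ (r - s) p (- q) ⟨
      (p - q) * (r - s)                          ∎

    *-homo : ∀ i j → ⟦ RawRing._*_ differences i j ⟧ ≈ ⟦ i ⟧ * ⟦ j ⟧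
    *-homo (a , b) (c , d) = begin
      ⟦ reduce (a ℕ.* c ℕ.+ b ℕ.* d) (a ℕ.* d ℕ.+ b ℕ.* c) ⟧
        ≈⟨ ⟦⟧-reduce (a ℕ.* c ℕ.+ b ℕ.* d) (a ℕ.* d ℕ.+ b ℕ.* c) ⟩
      nat (a ℕ.* c ℕ.+ b ℕ.* d) - nat (a ℕ.* d ℕ.+ b ℕ.* c)
        ≈⟨ +-cong (homo₂ a c b d) (-‿cong (homo₂ a d b c)) ⟩
      (nat a * nat c + nat b * nat d) - (nat a * nat d + nat b * nat c)
        ≈⟨ *-difference _ _ _ _ ⟩
      (nat a - nat b) * (nat c - nat d)
        ≈⟨ *-cong (⟦⟧-difference a b) (⟦⟧-difference c d) ⟨
      ⟦ a , b ⟧ * ⟦ c , d ⟧ ∎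
      where
      homo₂ : ∀ a b c d → nat (a ℕ.* b ℕ.+ c ℕ.* d) ≈ nat a * nat b + nat c * nat d
      homo₂ a b c d = trans (×-homo-+ 1# (a ℕ.* b) (c ℕ.* d)) (+-cong (×1-homo-* a b) (×1-homo-* c d))

    morphism : differences -Raw-AlmostCommutative⟶ fromCommutativeRing R
    morphism = record
      { ⟦_⟧    = ⟦_⟧
      ; +-homo = +-homo
      ; *-homo = *-homo
      ; -‿homo = -‿homo
      ; 0-homo = refl
      ; 1-homo = refl
      }

    equal? : ∀ i j → Maybe (⟦ i ⟧ ≈ ⟦ j ⟧)
    equal? i j with Product.≡-dec ℕ._≟_ ℕ._≟_ i j
    ... | no  _      = nothing
    ... | yes ≡.refl = just refl

  open import Algebra.Solver.Ring differences (fromCommutativeRing R) morphism equal? public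
    using (solve; _:+_; _:*_; :-_; _:-_; _:=_; con)

-- The commutative ring of power series over a commutative ring.

module SeriesRing {c ℓ} (R : CommutativeRing c ℓ) where
  private
    module R = CommutativeRing R
    module R-Solver = IntegerCoefficients R
  open Defs.PowerSeries R.rawRing using (_z^_)
  open RawRing (Defs.PowerSeries.rawRing R.rawRing)
  open import Relation.Binary.Reasoning.Setoid R.setoid
  open R-Solver using (solve; _:+_; _:*_; _:=_; con)

  private
    +-swap : ∀ p q r s → (p R.+ q) R.+ (r R.+ s) R.≈ (p R.+ r) R.+ (q R.+ s)
    +-swap = solve 4 (λ p q r s → (p :+ q) :+ (r :+ s) := (p :+ r) :+ (q :+ s)) R.refl

  *-cong : ∀ {a a′ b b′} → a ≈ a′ → b ≈ b′ → a * b ≈ a′ * b′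
  *-cong p q zero    = R.+-congʳ (R.*-cong (p 0) (q 0))
  *-cong p q (suc n) = R.+-cong (R.*-cong (p 0) (q (suc n))) (*-cong (p ∘ suc) q n)

  -- The convolution unfolds by splitting off the term with `a 0`. Splitting off the opposite end as
  -- well is what exchanges the two factors in `*-comm`.
  *-suc-last : ∀ a b n → (a * b) (suc n) R.≈ (a * (b ∘ suc)) n R.+ a (suc n) R.* b 0
  *-suc-last a b zero    = solve 2 (λ p q → p :+ (q :+ con (0 , 0)) := (p :+ con (0 , 0)) :+ q) R.refl
    (a 0 R.* b 1) (a 1 R.* b 0)
  *-suc-last a b (suc n) = R.trans (R.+-congˡ (*-suc-last (a ∘ suc) b n)) (R.sym (R.+-assoc _ _ _))

  *-comm : ∀ a b → a * b ≈ b * a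
  *-comm a b zero    = R.+-congʳ (R.*-comm (a 0) (b 0))
  *-comm a b (suc n) = begin
    a 0 R.* b (suc n) R.+ ((a ∘ suc) * b) n ≈⟨ R.+-cong (R.*-comm _ _) (*-comm (a ∘ suc) b n) ⟩
    b (suc n) R.* a 0 R.+ (b * (a ∘ suc)) n ≈⟨ R.+-comm _ _ ⟩
    (b * (a ∘ suc)) n R.+ b (suc n) R.* a 0 ≈⟨ *-suc-last b a n ⟨
    (b * a) (suc n)                         ∎

  distribʳ : ∀ a b c → (b + c) * a ≈ b * a + c * a
  distribʳ a b c zero    = solve 3 (λ p q r → (q :+ r) :* p :+ con (0 , 0) := (q :* p :+ con (0 , 0)) :+ (r :* p :+ con (0 , 0)))
    R.refl (a 0) (b 0) (c 0)
  distribʳ a b c (suc n) = R.trans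
    (R.+-cong (R.distribʳ (a (suc n)) (b 0) (c 0)) (distribʳ a (b ∘ suc) (c ∘ suc) n))
    (+-swap _ _ _ _)

  scale-* : ∀ p a b n → ((λ i → p R.* a i) * b) n R.≈ p R.* (a * b) n
  scale-* p a b zero    = solve 3 (λ p q r → p :* q :* r :+ con (0 , 0) := p :* (q :* r :+ con (0 , 0))) R.refl p (a 0) (b 0)
  scale-* p a b (suc n) = begin
    p R.* a 0 R.* b (suc n) R.+ ((λ i → p R.* a (suc i)) * b) n ≈⟨ R.+-cong (R.*-assoc _ _ _) (scale-* p (a ∘ suc) b n) ⟩
    p R.* (a 0 R.* b (suc n)) R.+ p R.* ((a ∘ suc) * b) n       ≈⟨ R.distribˡ _ _ _ ⟨
    p R.* (a * b) (suc n)                                       ∎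

  *-assoc : ∀ a b c → (a * b) * c ≈ a * (b * c)
  *-assoc a b c zero    = solve 3 (λ p q r → (p :* q :+ con (0 , 0)) :* r :+ con (0 , 0) := p :* (q :* r :+ con (0 , 0)) :+ con (0 , 0))
    R.refl (a 0) (b 0) (c 0)
  *-assoc a b c (suc n) = begin
    -- The tail of `a * b` is `a 0` times the tail of `b` plus the tail of `a` times `b`; this
    -- reduces the claim to the tail of `a`.
    (a * b) 0 R.* c (suc n) R.+ (((λ i → a 0 R.* b (suc i)) + (a ∘ suc) * b) * c) n
      ≈⟨ R.+-congˡ (distribʳ c (λ i → a 0 R.* b (suc i)) ((a ∘ suc) * b) n) ⟩
    (a * b) 0 R.* c (suc n) R.+ (((λ i → a 0 R.* b (suc i)) * c) n R.+ (((a ∘ suc) * b) * c) n)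
      ≈⟨ R.+-congˡ (R.+-cong (scale-* (a 0) (b ∘ suc) c n) (*-assoc (a ∘ suc) b c n)) ⟩
    (a 0 R.* b 0 R.+ R.0#) R.* c (suc n) R.+ (a 0 R.* ((b ∘ suc) * c) n R.+ ((a ∘ suc) * (b * c)) n)
      ≈⟨ solve 5 (λ p q r s t → (p :* q :+ con (0 , 0)) :* r :+ (p :* s :+ t) := p :* (q :* r :+ s) :+ t) R.refl
           (a 0) (b 0) (c (suc n)) (((b ∘ suc) * c) n) (((a ∘ suc) * (b * c)) n) ⟩
    a 0 R.* (b * c) (suc n) R.+ ((a ∘ suc) * (b * c)) n ∎

  zeroˡ : ∀ a → 0# * a ≈ 0#
  zeroˡ a zero    = solve 1 (λ p → con (0 , 0) :* p :+ con (0 , 0) := con (0 , 0)) R.refl (a 0)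
  zeroˡ a (suc n) = R.trans (R.+-cong (R.zeroˡ _) (zeroˡ a n)) (R.+-identityˡ _)

  z^0-* : ∀ p a n → ((p z^ 0) * a) n R.≈ p R.* a n
  z^0-* p a zero    = R.+-identityʳ _
  z^0-* p a (suc n) = R.trans (R.+-congˡ (zeroˡ a n)) (R.+-identityʳ _)

  z^suc-*-suc : ∀ p k a n → ((p z^ suc k) * a) (suc n) R.≈ ((p z^ k) * a) n
  z^suc-*-suc p k a n = R.trans (R.+-congʳ (R.zeroˡ _)) (R.+-identityˡ _)

  z^suc-*-zero : ∀ p k a → ((p z^ suc k) * a) 0 R.≈ R.0#
  z^suc-*-zero p k a = R.trans (R.+-identityʳ _) (R.zeroˡ _)

  *-identityˡ : ∀ a → 1# * a ≈ a
  *-identityˡ a n = R.trans (z^0-* R.1# a n) (R.*-identityˡ _)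

  isCommutativeRing : IsCommutativeRing _≈_ _+_ _*_ -_ 0# 1#
  isCommutativeRing = record
    { isRing = record
      { +-isAbelianGroup = record
        { isGroup = record
          { isMonoid = record
            { isSemigroup = record
              { isMagma = record
                { isEquivalence = record
                  { refl  = λ n → R.refl
                  ; sym   = λ p n → R.sym (p n)
                  ; trans = λ p q n → R.trans (p n) (q n)
                  }
                ; ∙-cong = λ p q n → R.+-cong (p n) (q n)
                }
              ; assoc = λ a b c n → R.+-assoc (a n) (b n) (c n)
              }
            ; identity = (λ a n → R.+-identityˡ (a n)) , (λ a n → R.+-identityʳ (a n))
            }
          ; inverse = (λ a n → R.-‿inverseˡ (a n)) , (λ a n → R.-‿inverseʳ (a n))
          ; ⁻¹-cong = λ p n → R.-‿cong (p n)
          }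
        ; comm = λ a b n → R.+-comm (a n) (b n)
        }
      ; *-cong     = *-cong
      ; *-assoc    = *-assoc
      ; *-identity = *-identityˡ , λ a n → R.trans (*-comm a 1# n) (*-identityˡ a n)
      ; distrib    = (λ a b c n → R.trans (*-comm a (b + c) n)
                       (R.trans (distribʳ a b c n) (R.+-cong (*-comm b a n) (*-comm c a n)))) , distribʳ
      }
    ; *-comm = *-comm
    }

  commutativeRing : CommutativeRing c ℓ
  commutativeRing = record { isCommutativeRing = isCommutativeRing }

open Defs using (FPS; FPS-rawRing; coeff; _⊛_; unitCoeff; splits; sumℚ; sumℚ-++; module PowerSeries)

-- Rings of power series in finitely many variables

-- Since `splits` preserves lengths, testing equality only at lists of length m is compatible with
-- `_⊛_`; the result is the ring of power series in m variables.
coefficientRawRing : ℕ → RawRing 0ℓ 0ℓ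
coefficientRawRing m = record
  { Carrier = List ℕ → ℚ
  ; _≈_     = λ f g → ∀ α → length α ≡ m → f α ≡ g α
  ; _+_     = λ f g α → f α ℚ.+ g α
  ; _*_     = _⊛_
  ; -_      = λ f α → ℚ.- f α
  ; 0#      = λ _ → 0ℚ
  ; 1#      = unitCoeff
  }

IsCoefficientRing : ℕ → Set
IsCoefficientRing m = IsCommutativeRing _≈_ _+_ _*_ -_ 0# 1#
  where open RawRing (coefficientRawRing m)

evaluation : IsRingMonomorphism (coefficientRawRing 0) ℚ.+-*-rawRing (λ f → f [])
evaluation = record
  { isRingHomomorphism = record
    { isSemiringHomomorphism = record
      { isNearSemiringHomomorphism = record
        { +-isMonoidHomomorphism = record
          { isMagmaHomomorphism = record
            { isRelHomomorphism = record { cong = λ f≈g → f≈g [] ≡.refl }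
            ; homo = λ _ _ → ≡.refl
            }
          ; ε-homo = ≡.refl
          }
        ; *-homo = λ f g → ℚ.+-identityʳ (f [] ℚ.* g [])
        }
      ; 1#-homo = ≡.refl
      }
    ; -‿homo = λ _ → ≡.refl
    }
  ; injective = λ { eq [] _ → eq }
  }

sumℚ-concatMap : ∀ {A B : Set} m (h : B → ℚ) (k : A → List B) (a : ℕ → A) (F : ℕ → List ℕ → ℚ) α →
  (∀ i → sumℚ (map h (k (a i))) ≡ F i α) → ∀ n →
  sumℚ (map h (concatMap k (applyUpTo a n))) ≡ PowerSeries.∑ (coefficientRawRing m) (applyUpTo F n) α
sumℚ-concatMap m h k a F α eq zero    = ≡.refl
sumℚ-concatMap m h k a F α eq (suc n) = begin
  sumℚ (map h (k (a 0) ++ r))           ≡⟨ ≡.cong sumℚ (map-++ h (k (a 0)) r) ⟩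
  sumℚ (map h (k (a 0)) ++ map h r)     ≡⟨ sumℚ-++ (map h (k (a 0))) (map h r) ⟩
  sumℚ (map h (k (a 0))) ℚ.+ sumℚ (map h r)
    ≡⟨ ≡.cong₂ ℚ._+_ (eq 0) (sumℚ-concatMap m h k (a ∘ suc) (F ∘ suc) α (eq ∘ suc) n) ⟩
  F 0 α ℚ.+ PowerSeries.∑ (coefficientRawRing m) (applyUpTo (F ∘ suc) n) α ∎
  where
  open ≡.≡-Reasoning
  r = concatMap k (applyUpTo (a ∘ suc) n)

-- A series in m + 1 variables is a series in the first one whose coefficients
-- are series in the other m.
currying : ∀ m → IsRingMonomorphism (coefficientRawRing (suc m))
  (PowerSeries.rawRing (coefficientRawRing m)) (λ f i α → f (i ∷ α))
currying m = record
  { isRingHomomorphism = record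
    { isSemiringHomomorphism = record
      { isNearSemiringHomomorphism = record
        { +-isMonoidHomomorphism = record
          { isMagmaHomomorphism = record
            { isRelHomomorphism = record { cong = λ f≈g i α eq → f≈g (i ∷ α) (≡.cong suc eq) }
            ; homo = λ _ _ _ _ _ → ≡.refl
            }
          ; ε-homo = λ _ _ _ → ≡.refl
          }
        ; *-homo = λ f g i α _ → sumℚ-concatMap m (λ (β , γ) → f β ℚ.* g γ)
            (λ j → map (λ (β , γ) → j ∷ β , i ℕ.∸ j ∷ γ) (splits α)) (λ j → j)
            (λ j → (λ β → f (j ∷ β)) ⊛ (λ γ → g (i ℕ.∸ j ∷ γ))) α
            (λ j → ≡.cong sumℚ (≡.sym (map-∘ (splits α)))) (suc i)
        }
      ; 1#-homo = λ { zero _ _ → ≡.refl ; (suc _) _ _ → ≡.refl }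
      }
    ; -‿homo = λ _ _ _ _ → ≡.refl
    }
  ; injective = λ { eq (i ∷ α) l → eq i α (≡.cong ℕ.pred l) }
  }

-- The ring laws pull back along monomorphisms: without variables the ring is ℚ by `evaluation`, and
-- by `currying` each further variable forms power series once more.
isCoefficientRing : ∀ m → IsCoefficientRing m
isCoefficientRing zero    = RingMonomorphism.isCommutativeRing evaluation
  (CommutativeRing.isCommutativeRing ℚ.+-*-commutativeRing)
isCoefficientRing (suc m) = RingMonomorphism.isCommutativeRing (currying m)
  (SeriesRing.isCommutativeRing (record { isCommutativeRing = isCoefficientRing m }))

infix 4 _≈[_]_
_≈[_]_ : FPS → ℕ → FPS → Set
f ≈[ m ] g = ∀ α → length α ≡ m → coeff f α ≡ coeff g α

-- The carrier remains `FPS`, so passing to m variables needs no map: the same terms are compared by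
-- a coarser equality.
truncatedRawRing : ℕ → RawRing 0ℓ 0ℓ
truncatedRawRing m = record { RawRing FPS-rawRing hiding (_≈_) ; _≈_ = _≈[ m ]_ }

coeff-monomorphism : ∀ m → IsRingMonomorphism (truncatedRawRing m) (coefficientRawRing m) coeff
coeff-monomorphism m = record
  { isRingHomomorphism = record
    { isSemiringHomomorphism = record
      { isNearSemiringHomomorphism = record
        { +-isMonoidHomomorphism = record
          { isMagmaHomomorphism = record
            { isRelHomomorphism = record { cong = λ eq → eq }
            ; homo = λ _ _ _ _ → ≡.refl
            }
          ; ε-homo = λ _ _ → ≡.refl
          }
        ; *-homo = λ _ _ _ _ → ≡.refl
        }
      ; 1#-homo = λ _ _ → ≡.refl
      }
    ; -‿homo = λ _ _ _ → ≡.refl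
    }
  ; injective = λ eq → eq
  }

truncatedRing : ℕ → CommutativeRing 0ℓ 0ℓ
truncatedRing m = record
  { RawRing (truncatedRawRing m)
  ; isCommutativeRing = RingMonomorphism.isCommutativeRing (coeff-monomorphism m) (isCoefficientRing m) }

FPS-commutativeRing : CommutativeRing 0ℓ 0ℓ
FPS-commutativeRing = record
  { RawRing FPS-rawRing
  ; isCommutativeRing = record
    { isRing = record
      { +-isAbelianGroup = record
        { isGroup = record
          { isMonoid = record
            { isSemigroup = record
              { isMagma = record
                { isEquivalence = record
                  { refl  = λ _ → ≡.refl
                  ; sym   = λ p α → ≡.sym (p α)
                  ; trans = λ p q α → ≡.trans (p α) (q α)
                  }
                ; ∙-cong = λ p q α → ≡.cong₂ ℚ._+_ (p α) (q α)
                }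
              ; assoc = λ f g h α → ℚ.+-assoc (coeff f α) (coeff g α) (coeff h α)
              }
            ; identity = (λ f α → ℚ.+-identityˡ (coeff f α)) , (λ f α → ℚ.+-identityʳ (coeff f α))
            }
          ; inverse = (λ f α → ℚ.+-inverseˡ (coeff f α)) , (λ f α → ℚ.+-inverseʳ (coeff f α))
          ; ⁻¹-cong = λ p α → ≡.cong ℚ.-_ (p α)
          }
        ; comm = λ f g α → ℚ.+-comm (coeff f α) (coeff g α)
        }
      -- A multiplicative law at the coefficient α is the law of the truncated ring in `length α`
      -- variables, read at α.
      ; *-cong     = λ {f} {f′} {g} {g′} p q α → T.*-cong α {f} {f′} {g} {g′} (λ β _ → p β) (λ β _ → q β) α ≡.refl
      ; *-assoc    = λ f g h α → T.*-assoc α f g h α ≡.refl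
      ; *-identity = (λ f α → T.*-identityˡ α f α ≡.refl) , (λ f α → T.*-identityʳ α f α ≡.refl)
      ; distrib    = (λ f g h α → T.distribˡ α f g h α ≡.refl) , (λ f g h α → T.distribʳ α f g h α ≡.refl)
      }
    ; *-comm = λ f g α → T.*-comm α f g α ≡.refl
    }
  }
  where module T (α : List ℕ) = CommutativeRing (truncatedRing (length α))

-- Monomials, tails and the Euler operator.

module SeriesProperties {c ℓ} (R : CommutativeRing c ℓ) where
  private module R = CommutativeRing R
  open Defs.PowerSeries R.rawRing
  open SeriesRing R using (z^0-*; z^suc-*-suc; z^suc-*-zero)
  open CommutativeRing (SeriesRing.commutativeRing R) hiding (zero)
  open import Algebra.Properties.Semiring.Mult R.semiring using () renaming (_×_ to _·_)
  open import Algebra.Properties.Semiring.Sum semiring using (sum)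
  import Algebra.Properties.Semiring.Sum R.semiring as R-Sum

  z^-cong : ∀ k {p q} → p R.≈ q → p z^ k ≈ q z^ k
  z^-cong k p≈q n with n ≡ᵇ k
  ... | true  = p≈q
  ... | false = R.refl

  z^-+ : ∀ k p q → (p R.+ q) z^ k ≈ p z^ k + q z^ k
  z^-+ k p q n with n ≡ᵇ k
  ... | true  = R.refl
  ... | false = R.sym (R.+-identityˡ _)

  z^-neg : ∀ k p → (R.- p) z^ k ≈ - (p z^ k)
  z^-neg k p n with n ≡ᵇ k
  ... | true  = R.refl
  ... | false = R.sym -0#≈0#
    where open import Algebra.Properties.Ring R.ring using (-0#≈0#)

  z^-* : ∀ i j p q → (p z^ i) * (q z^ j) ≈ (p R.* q) z^ (i ℕ.+ j)
  z^-* zero    j p q n       = R.trans (z^0-* p (q z^ j) n) (scaled n)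
    where
    scaled : ∀ n → p R.* (q z^ j) n R.≈ ((p R.* q) z^ j) n
    scaled n with n ≡ᵇ j
    ... | true  = R.refl
    ... | false = R.zeroʳ p
  z^-* (suc i) j p q zero    = z^suc-*-zero p i (q z^ j)
  z^-* (suc i) j p q (suc n) = R.trans (z^suc-*-suc p i (q z^ j) n) (z^-* i j p q n)

  ∑≥-split : ∀ k a → ∑≥ k a ≈ a k z^ k + ∑≥ (suc k) a
  ∑≥-split zero          a zero    = R.sym (R.+-identityʳ _)
  ∑≥-split zero          a (suc n) = R.sym (R.+-identityˡ _)
  ∑≥-split (suc k)       a zero    = R.sym (R.+-identityˡ _)
  -- The bound 1 is separate because `suc k ≤ᵇ n` unfolds to `k <ᵇ n`, so lowering 1 to 0 computes
  -- differently from lowering a larger bound.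
  ∑≥-split (suc zero)    a (suc n) = ∑≥-split zero (a ∘ suc) n
  ∑≥-split (suc (suc k)) a (suc n) = ∑≥-split (suc k) (a ∘ suc) n

  ∑≥-cong : ∀ k {a b} → (∀ i → k ℕ.≤ i → a i R.≈ b i) → ∑≥ k a ≈ ∑≥ k b
  ∑≥-cong k a≈b n with k ≤ᵇ n in eq
  ... | true  = a≈b n (ℕ.≤ᵇ⇒≤ k n (≡.subst Bool.T (≡.sym eq) tt))
  ... | false = R.refl

  ∑≥-+ : ∀ k a b → ∑≥ k (λ i → a i R.+ b i) ≈ ∑≥ k a + ∑≥ k b
  ∑≥-+ k a b n with k ≤ᵇ n
  ... | true  = R.refl
  ... | false = R.sym (R.+-identityˡ _)

  -- The Euler operator z d/dz.
  θ : Series → Series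
  θ a n = n · a n

  sum-coefficient : ∀ {m} (a : Fin m → Series) n → sum a n ≡ R-Sum.sum (λ i → a i n)
  sum-coefficient {zero}  a n = ≡.refl
  sum-coefficient {suc m} a n = ≡.cong (a zero n R.+_) (sum-coefficient (a ∘ suc) n)

-- The product over finitely many variables and its logarithmic derivative.

module FiniteVariables {c ℓ} (R : CommutativeRing c ℓ) where
  private module R = CommutativeRing R
  open Defs.PowerSeries R.rawRing
  open SeriesRing R using (z^0-*; z^suc-*-suc; z^suc-*-zero)
  open SeriesProperties R
  open CommutativeRing (SeriesRing.commutativeRing R) hiding (zero)
  open import Algebra.Properties.Semiring.Mult R.semiring using (×-congʳ; ×-comm-*) renaming (_×_ to _·_)
  import Algebra.Properties.CommutativeMonoid.Mult R.+-commutativeMonoid as Mult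
  open import Algebra.Properties.Semiring.Sum semiring using (sum; sum-cong-≋; *-distribˡ-sum)
  open import Relation.Binary.Reasoning.Setoid setoid
  open IntegerCoefficients (SeriesRing.commutativeRing R) using (solve; _:+_; _:*_; _:=_; con)
  private module RS = IntegerCoefficients R

  infix 9 _z
  _z : R.Carrier → Series
  p z = p z^ 1

  z-*-suc : ∀ p a n → (p z * a) (suc n) R.≈ p R.* a n
  z-*-suc p a n = R.trans (z^suc-*-suc p 0 a n) (z^0-* p a n)

  1/[1+_z] : R.Carrier → Series
  1/[1+ p z] = recip (1# + p z)

  1+z-inverse : ∀ p → (1# + p z) * 1/[1+ p z] ≈ 1#
  1+z-inverse p = Defs.*-recip R.ring (1# + p z) (R.+-identityʳ R.1#)

  ∏[1+_z] : ∀ {m} → (Fin m → R.Carrier) → Series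
  ∏[1+_z] {zero}  x = 1#
  ∏[1+_z] {suc m} x = (1# + x zero z) * ∏[1+ x ∘ suc z]

  -- The product rule for a linear factor, whose image under `θ` is `p z`. Induction along the
  -- product requires no more.
  θ-leibniz : ∀ p a → θ ((1# + p z) * a) ≈ p z * a + (1# + p z) * θ a
  θ-leibniz p a = begin
    θ ((1# + p z) * a)              ≈⟨ (λ n → ×-congʳ n (expand a n)) ⟩
    θ (a + p z * a)                 ≈⟨ coefficients ⟩
    p z * a + (θ a + p z * θ a)     ≈⟨ +-congˡ (expand (θ a)) ⟨
    p z * a + (1# + p z) * θ a      ∎
    where
    expand : ∀ b → (1# + p z) * b ≈ b + p z * b
    expand b = solve 2 (λ y b → (con (1 , 0) :+ y) :* b := b :+ y :* b) refl (p z) b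
    coefficients : θ (a + p z * a) ≈ p z * a + (θ a + p z * θ a)
    coefficients zero    = R.sym (R.trans (R.+-cong (z^suc-*-zero p 0 a) (R.+-identityˡ _))
      (R.trans (R.+-identityˡ _) (z^suc-*-zero p 0 (θ a))))
    coefficients (suc n) = R.trans (Mult.×-distrib-+ (a (suc n)) ((p z * a) (suc n)) (suc n)) (R.trans
      (R.+-congˡ (R.+-congˡ (R.trans (×-congʳ n (z-*-suc p a n)) (R.trans (R.sym (×-comm-* n p (a n))) (R.sym (z-*-suc p (θ a) n))))))
      (RS.solve 3 (λ u v w → u RS.:+ (v RS.:+ w) RS.:= v RS.:+ (u RS.:+ w)) R.refl _ _ _))

  sum-cong : ∀ {m} {a b : Fin m → Series} → (∀ i → a i ≈ b i) → sum a ≈ sum b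
  sum-cong = sum-cong-≋

  -- Multiplication by `1/[1+ x c z]` deletes the factor of index c from the product. In the
  -- induction the first summand becomes `y₀ * P`, all others acquire the factor `1# + y₀`, and the
  -- product rule joins them.
  sum-logarithmic : ∀ {m} (x : Fin m → R.Carrier) →
    sum (λ c → x c z * (∏[1+ x z] * 1/[1+ x c z])) ≈ θ ∏[1+ x z]
  sum-logarithmic {zero}  x = θ-1
    where
    θ-1 : 0# ≈ θ 1#
    θ-1 zero    = R.refl
    θ-1 (suc n) = R.sym (×-zeroʳ (suc n))
      where
      ×-zeroʳ : ∀ n → n · R.0# R.≈ R.0#
      ×-zeroʳ zero    = R.refl
      ×-zeroʳ (suc n) = R.trans (R.+-identityˡ _) (×-zeroʳ n)
  sum-logarithmic {suc m} x = begin
    y₀ * ((1# + y₀) * P * r₀) + sum (λ c → x (suc c) z * ((1# + y₀) * P * r c))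
      ≈⟨ +-cong (trans (regroup₀ y₀ (1# + y₀) P r₀) (trans (*-congˡ {y₀ * P} (1+z-inverse (x zero))) (*-identityʳ (y₀ * P))))
                (sum-cong (λ c → regroup (x (suc c) z) (1# + y₀) P (r c))) ⟩
    y₀ * P + sum (λ c → (1# + y₀) * (x (suc c) z * (P * r c)))
      ≈⟨ +-congˡ (*-distribˡ-sum (1# + y₀) (λ c → x (suc c) z * (P * r c))) ⟨
    y₀ * P + (1# + y₀) * sum (λ c → x (suc c) z * (P * r c))
      ≈⟨ +-congˡ {y₀ * P} (*-congˡ {1# + y₀} (sum-logarithmic (x ∘ suc))) ⟩
    y₀ * P + (1# + y₀) * θ P
      ≈⟨ θ-leibniz (x zero) P ⟨
    θ ((1# + y₀) * P) ∎
    where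
    y₀ = x zero z
    r₀ = 1/[1+ x zero z]
    P  = ∏[1+ x ∘ suc z]
    r : Fin m → Series
    r c = 1/[1+ x (suc c) z]
    regroup₀ : ∀ y u p r → y * (u * p * r) ≈ y * p * (u * r)
    regroup₀ = solve 4 (λ y u p r → y :* (u :* p :* r) := y :* p :* (u :* r)) refl
    regroup : ∀ y u p r → y * (u * p * r) ≈ u * (y * (p * r))
    regroup = solve 4 (λ y u p r → y :* (u :* p :* r) := u :* (y :* (p :* r))) refl

-- The transfer identities in a commutative ring

module Transfer {c ℓ} (S : CommutativeRing c ℓ) where
  open CommutativeRing S
  open import Algebra.Properties.Semiring.Sum semiring using (sum; sum-cong-≋; *-distribˡ-sum; *-distribʳ-sum; ∑-distrib-+)
  open import Relation.Binary.Reasoning.Setoid setoid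
  open IntegerCoefficients S using (solve; _:+_; _:*_; _:-_; :-_; _:=_; con)

  sum-cong : ∀ {m} {a b : Fin m → Carrier} → (∀ i → a i ≈ b i) → sum a ≈ sum b
  sum-cong = sum-cong-≋

  sum-sub : ∀ {m} (a b : Fin m → Carrier) → sum (λ i → a i - b i) ≈ sum a - sum b
  sum-sub a b = begin
    sum (λ i → a i - b i)            ≈⟨ sum-cong (λ i → minus (a i) (b i)) ⟩
    sum (λ i → a i + - 1# * b i)     ≈⟨ ∑-distrib-+ a (λ i → - 1# * b i) ⟩
    sum a + sum (λ i → - 1# * b i)   ≈⟨ +-congˡ (*-distribˡ-sum (- 1#) b) ⟨
    sum a + - 1# * sum b             ≈⟨ minus (sum a) (sum b) ⟨
    sum a - sum b                    ∎
    where
    minus : ∀ p q → p - q ≈ p + - 1# * q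
    minus = solve 2 (λ p q → p :- q := p :+ :- con (1 , 0) :* q) refl

  -- The ring is not assumed to be a domain; D and E are cancelled because they are units.
  *-cancel-unit : ∀ {u w a b} → u * w ≈ 1# → u * a ≈ u * b → a ≈ b
  *-cancel-unit {u} {w} {a} {b} uw≈1 ua≈ub = begin
    a           ≈⟨ absorb a ⟩
    w * (u * a) ≈⟨ *-congˡ ua≈ub ⟩
    w * (u * b) ≈⟨ absorb b ⟨
    b           ∎
    where
    absorb : ∀ p → p ≈ w * (u * p)
    absorb p = trans (sym (*-identityˡ p)) (trans (*-congʳ (sym uw≈1))
      (solve 3 (λ u w p → u :* w :* p := w :* (u :* p)) refl u w p))

  -- An abstract ring carries no operator `θ`, so zE′ enters as a separate element `θE`, tied to E
  -- by `logarithmic`; `r c` stands for 1/(1 + y_c).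
  module _ {m} (y r : Fin m → Carrier) (E θE : Carrier)
    (inverse : ∀ c → (1# + y c) * r c ≈ 1#)
    (logarithmic : sum (λ c → y c * (E * r c)) ≈ θE) where

    T : Fin m → Carrier
    T c = y c * (E * r c)

    -- A rearrangement of (1 + y_c) T_c = y_c E, used to replace each product of y_c with T_c by a
    -- combination of T_c and E.
    y*T : ∀ c → y c * T c ≈ y c * E - T c
    y*T c = begin
      y c * T c                                 ≈⟨ solve 3 (λ y e r → y :* (y :* (e :* r)) := y :* e :* ((con (1 , 0) :+ y) :* r) :- y :* (e :* r)) refl (y c) E (r c) ⟩
      y c * E * ((1# + y c) * r c) - T c        ≈⟨ +-congʳ (trans (*-congˡ (inverse c)) (*-identityʳ _)) ⟩
      y c * E - T c                             ∎

    module _ (v W : Fin m → Carrier) (W-step : ∀ c → (1# + y c) * W c ≈ y c * (v c + sum W)) where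

      -- E is E `r c` times `1# + y c`, and the second factor is absorbed by the recursion for
      -- `W c`.
      E*W : ∀ c → E * W c ≈ T c * v c + T c * sum W
      E*W c = begin
        E * W c                          ≈⟨ *-congˡ (trans (sym (*-identityˡ _)) (*-congʳ (sym (inverse c)))) ⟩
        E * ((1# + y c) * r c * W c)     ≈⟨ solve 4 (λ e u r w → e :* (u :* r :* w) := e :* r :* (u :* w)) refl E (1# + y c) (r c) (W c) ⟩
        E * r c * ((1# + y c) * W c)     ≈⟨ *-congˡ (W-step c) ⟩
        E * r c * (y c * (v c + sum W))  ≈⟨ solve 5 (λ e r y v w → e :* r :* (y :* (v :+ w)) := y :* (e :* r) :* v :+ y :* (e :* r) :* w) refl E (r c) (y c) (v c) (sum W) ⟩
        T c * v c + T c * sum W          ∎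

      E*sum : ∀ (u : Fin m → Carrier) → E * sum (λ c → u c * W c) ≈ sum (λ c → u c * T c * v c) + sum (λ c → u c * T c) * sum W
      E*sum u = begin
        E * sum (λ c → u c * W c)                      ≈⟨ *-distribˡ-sum E (λ c → u c * W c) ⟩
        sum (λ c → E * (u c * W c))                    ≈⟨ sum-cong (λ c → trans (swap E (u c) (W c)) (trans (*-congˡ (E*W c)) (expand (u c) (T c) (v c) (sum W)))) ⟩
        sum (λ c → u c * T c * v c + u c * T c * sum W) ≈⟨ ∑-distrib-+ (λ c → u c * T c * v c) (λ c → u c * T c * sum W) ⟩
        sum (λ c → u c * T c * v c) + sum (λ c → u c * T c * sum W) ≈⟨ +-congˡ (*-distribʳ-sum (sum W) (λ c → u c * T c)) ⟨
        sum (λ c → u c * T c * v c) + sum (λ c → u c * T c) * sum W ∎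
        where
        swap : ∀ p q r → p * (q * r) ≈ q * (p * r)
        swap = solve 3 (λ p q r → p :* (q :* r) := q :* (p :* r)) refl
        expand : ∀ u t v w → u * (t * v + t * w) ≈ u * t * v + u * t * w
        expand = solve 4 (λ u t v w → u :* (t :* v :+ t :* w) := u :* t :* v :+ u :* t :* w) refl

      D*sum : (E - θE) * sum W ≈ sum (λ c → T c * v c)
      D*sum = begin
        (E - θE) * sum W
          ≈⟨ solve 3 (λ e t w → (e :- t) :* w := e :* w :- t :* w) refl E θE (sum W) ⟩
        E * sum W - θE * sum W
          ≈⟨ +-congʳ (*-distribˡ-sum E W) ⟩
        sum (λ c → E * W c) - θE * sum W
          ≈⟨ +-congʳ (sum-cong E*W) ⟩
        sum (λ c → T c * v c + T c * sum W) - θE * sum W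
          ≈⟨ +-congʳ (trans (∑-distrib-+ (λ c → T c * v c) (λ c → T c * sum W)) (+-congˡ (trans (sym (*-distribʳ-sum (sum W) T)) (*-congʳ logarithmic)))) ⟩
        sum (λ c → T c * v c) + θE * sum W - θE * sum W
          ≈⟨ solve 2 (λ p q → p :+ q :- q := p) refl (sum (λ c → T c * v c)) (θE * sum W) ⟩
        sum (λ c → T c * v c) ∎

      D*E*sum : ∀ (u : Fin m → Carrier) → (E - θE) * (E * sum (λ c → u c * W c)) ≈
        (E - θE) * sum (λ c → u c * T c * v c) + sum (λ c → u c * T c) * sum (λ c → T c * v c)
      D*E*sum u = begin
        (E - θE) * (E * sum (λ c → u c * W c))
          ≈⟨ *-congˡ (E*sum u) ⟩
        (E - θE) * (sum (λ c → u c * T c * v c) + sum (λ c → u c * T c) * sum W)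
          ≈⟨ solve 4 (λ d p q w → d :* (p :+ q :* w) := d :* p :+ q :* (d :* w)) refl (E - θE) _ _ (sum W) ⟩
        (E - θE) * sum (λ c → u c * T c * v c) + sum (λ c → u c * T c) * ((E - θE) * sum W)
          ≈⟨ +-congˡ (*-congˡ D*sum) ⟩
        (E - θE) * sum (λ c → u c * T c * v c) + sum (λ c → u c * T c) * sum (λ c → T c * v c) ∎

    -- The summand `1#` is the empty path. Multiplied by D it supplies E - θE, and the nonempty
    -- words supply the missing θE.
    D*path : ∀ (W : Fin m → Carrier) → (∀ c → (1# + y c) * W c ≈ y c * (1# + sum W)) →
      (E - θE) * (1# + sum W) ≈ E
    D*path W W-step = begin
      (E - θE) * (1# + sum W)                ≈⟨ distribˡ _ _ _ ⟩
      (E - θE) * 1# + (E - θE) * sum W       ≈⟨ +-cong (*-identityʳ _) (D*sum (λ _ → 1#) W W-step) ⟩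
      (E - θE) + sum (λ c → T c * 1#)        ≈⟨ +-congˡ (trans (sum-cong (λ c → *-identityʳ (T c))) logarithmic) ⟩
      (E - θE) + θE                          ≈⟨ solve 2 (λ e t → e :- t :+ t := e) refl E θE ⟩
      E                                      ∎

    -- With qᵢ standing for eᵢzⁱ, h c is z² times the second elementary symmetric
    -- function of the variables other than the one of index c.
    module _ (q₁ q₂ q₃ k₃ k₄ : Carrier) where

      h : Fin m → Carrier
      h c = q₂ - y c * q₁ + y c * y c

      module _
        (sum-y   : sum y ≈ q₁)
        (sum-yh₁ : sum (λ c → y c * (q₁ - y c)) ≈ q₂ + q₂)
        (sum-yh₂ : sum (λ c → y c * h c) ≈ k₃)
        (sum-yh₃ : sum (λ c → y c * (q₃ - y c * h c)) ≈ k₄) where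

        yh₁ yh₂ yh₃ : Fin m → Carrier
        yh₁ c = y c * (q₁ - y c)
        yh₂ c = y c * h c
        yh₃ c = y c * (q₃ - y c * h c)

        -- With ê₁ = q₁ - y_c and ê₂ = `h c`, the relations q₁ = ê₁ + y_c and q₂ = ê₂ + y_c ê₁ give
        -- 1 + q₁ + q₂ = (1 + y_c)(1 + ê₁) + ê₂. Multiplying by T_c and using (1 + y_c) T_c = y_c E
        -- yields the claim.
        h*T : ∀ c → h c * T c ≈ (1# + q₁ + q₂) * T c - (yh₁ c + y c) * E
        h*T c = begin
          (q₂ - y c * q₁ + y c * y c) * T c
            ≈⟨ solve 4 (λ q₁ q₂ y t → (q₂ :- y :* q₁ :+ y :* y) :* t := q₂ :* t :+ (y :- q₁) :* (y :* t)) refl q₁ q₂ (y c) (T c) ⟩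
          q₂ * T c + (y c - q₁) * (y c * T c)
            ≈⟨ solve 4 (λ y q₁ z p → p :+ (y :- q₁) :* z := p :- q₁ :* z :+ y :* z) refl (y c) q₁ (y c * T c) (q₂ * T c) ⟩
          q₂ * T c - q₁ * (y c * T c) + y c * (y c * T c)
            ≈⟨ +-cong (+-congˡ (-‿cong (*-congˡ (y*T c)))) (trans (*-congˡ (y*T c)) (solve 3 (λ y e t → y :* (y :* e :- t) := y :* y :* e :- y :* t) refl (y c) E (T c))) ⟩
          q₂ * T c - q₁ * (y c * E - T c) + (y c * y c * E - y c * T c)
            ≈⟨ +-congˡ (+-congˡ (-‿cong (y*T c))) ⟩
          q₂ * T c - q₁ * (y c * E - T c) + (y c * y c * E - (y c * E - T c))
            ≈⟨ solve 5 (λ q₁ q₂ y e t → q₂ :* t :- q₁ :* (y :* e :- t) :+ (y :* y :* e :- (y :* e :- t)) :=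
                 (con (1 , 0) :+ q₁ :+ q₂) :* t :- (y :* (q₁ :- y) :+ y) :* e) refl q₁ q₂ (y c) E (T c) ⟩
          (1# + q₁ + q₂) * T c - (yh₁ c + y c) * E ∎

        sum-hT : sum (λ c → h c * T c) ≈ (1# + q₁ + q₂) * θE - (q₂ + q₂ + q₁) * E
        sum-hT = begin
          sum (λ c → h c * T c)
            ≈⟨ sum-cong h*T ⟩
          sum (λ c → (1# + q₁ + q₂) * T c - (yh₁ c + y c) * E)
            ≈⟨ sum-sub (λ c → (1# + q₁ + q₂) * T c) (λ c → (yh₁ c + y c) * E) ⟩
          sum (λ c → (1# + q₁ + q₂) * T c) - sum (λ c → (yh₁ c + y c) * E)
            ≈⟨ +-cong (trans (sym (*-distribˡ-sum (1# + q₁ + q₂) T)) (*-congˡ logarithmic))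
                 (-‿cong (trans (sym (*-distribʳ-sum E (λ c → yh₁ c + y c))) (*-congʳ (trans (∑-distrib-+ yh₁ y) (+-cong sum-yh₁ sum-y))))) ⟩
          (1# + q₁ + q₂) * θE - (q₂ + q₂ + q₁) * E ∎

        -- The product y_c ê₁ ê₂ is q₁ y_c ê₂ - y_c² ê₂, and ê₃ = q₃ - y_c ê₂ turns the last term
        -- into y_c ê₃ - q₃ y_c. What remains is linear in the known moments.
        sum-yh₁h₂ : sum (λ c → (yh₁ c + y c) * h c) ≈ q₁ * k₃ - q₁ * q₃ + k₄ + k₃
        sum-yh₁h₂ = begin
          sum (λ c → (yh₁ c + y c) * h c)
            ≈⟨ sum-cong (λ c → solve 4 (λ y q₁ q₃ h → (y :* (q₁ :- y) :+ y) :* h :=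
                 (q₁ :* (y :* h) :+ (y :* (q₃ :- y :* h) :+ y :* h)) :- q₃ :* y) refl (y c) q₁ q₃ (h c)) ⟩
          sum (λ c → (q₁ * yh₂ c + (yh₃ c + yh₂ c)) - q₃ * y c)
            ≈⟨ sum-sub (λ c → q₁ * yh₂ c + (yh₃ c + yh₂ c)) (λ c → q₃ * y c) ⟩
          sum (λ c → q₁ * yh₂ c + (yh₃ c + yh₂ c)) - sum (λ c → q₃ * y c)
            ≈⟨ +-cong (trans (∑-distrib-+ (λ c → q₁ * yh₂ c) (λ c → yh₃ c + yh₂ c)) (+-cong
                   (trans (sym (*-distribˡ-sum q₁ yh₂)) (*-congˡ sum-yh₂))
                   (trans (∑-distrib-+ yh₃ yh₂) (+-cong sum-yh₃ sum-yh₂))))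
                 (-‿cong (trans (sym (*-distribˡ-sum q₃ y)) (*-congˡ sum-y))) ⟩
          (q₁ * k₃ + (k₄ + k₃)) - q₃ * q₁
            ≈⟨ solve 4 (λ q₁ q₃ k₃ k₄ → (q₁ :* k₃ :+ (k₄ :+ k₃)) :- q₃ :* q₁ := q₁ :* k₃ :- q₁ :* q₃ :+ k₄ :+ k₃) refl q₁ q₃ k₃ k₄ ⟩
          q₁ * k₃ - q₁ * q₃ + k₄ + k₃ ∎

        sum-hTh : sum (λ c → h c * T c * h c) ≈
          (1# + q₁ + q₂) * sum (λ c → h c * T c) - (q₁ * k₃ - q₁ * q₃ + k₄ + k₃) * E
        sum-hTh = begin
          sum (λ c → h c * T c * h c)
            ≈⟨ sum-cong (λ c → trans (*-congʳ (h*T c))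
                 (solve 5 (λ a t b e h → (a :* t :- b :* e) :* h := a :* (h :* t) :- (b :* h) :* e) refl
                   (1# + q₁ + q₂) (T c) (yh₁ c + y c) E (h c))) ⟩
          sum (λ c → (1# + q₁ + q₂) * (h c * T c) - (yh₁ c + y c) * h c * E)
            ≈⟨ sum-sub (λ c → (1# + q₁ + q₂) * (h c * T c)) (λ c → (yh₁ c + y c) * h c * E) ⟩
          sum (λ c → (1# + q₁ + q₂) * (h c * T c)) - sum (λ c → (yh₁ c + y c) * h c * E)
            ≈⟨ +-cong (sym (*-distribˡ-sum (1# + q₁ + q₂) (λ c → h c * T c))) (-‿cong (trans (sym (*-distribʳ-sum E (λ c → (yh₁ c + y c) * h c))) (*-congʳ sum-yh₁h₂))) ⟩
          (1# + q₁ + q₂) * sum (λ c → h c * T c) - (q₁ * k₃ - q₁ * q₃ + k₄ + k₃) * E ∎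

        module _ (R₃ G₃ G₄ K₅ H₃ g₃ : Carrier)
          (E-split  : E ≈ 1# + q₁ + q₂ + R₃)
          (D-split  : E - θE ≈ 1# - (q₂ + G₃))
          (K₃-split : G₃ + R₃ ≈ k₃ + (k₄ + K₅))
          (G₃-split : G₃ ≈ g₃ + G₄)
          (H₃-split : H₃ + R₃ ≈ G₃)
          (k₃-split : k₃ ≈ q₃ + g₃)
          (W : Fin m → Carrier)
          (W-step : ∀ c → (1# + y c) * W c ≈ y c * ((h c + h c) + sum W)) where

          private
            D   = E - θE
            S₁  = sum (λ c → h c * T c)
            2#  = 1# + 1#
            4*_ : Carrier → Carrier
            4* p = (p + p) + (p + p)

            2*sum : ∀ (a b : Fin m → Carrier) → (∀ c → a c ≈ 2# * b c) → sum a ≈ 2# * sum b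
            2*sum a b eq = trans (sum-cong eq) (sym (*-distribˡ-sum 2# b))

            -- The sum is (1 - q₂)E - (1 + q₁ + q₂)D. Here 1 - q₂ = D + G₃ and 1 + q₁ + q₂ = E - R₃,
            -- so the two products DE cancel.
            S₁-value : S₁ ≈ G₃ * E + D * R₃
            S₁-value = begin
              S₁
                ≈⟨ sum-hT ⟩
              (1# + q₁ + q₂) * θE - (q₂ + q₂ + q₁) * E
                ≈⟨ solve 4 (λ q₁ q₂ e t → (con (1 , 0) :+ q₁ :+ q₂) :* t :- (q₂ :+ q₂ :+ q₁) :* e :=
                     (con (1 , 0) :- q₂) :* e :- (con (1 , 0) :+ q₁ :+ q₂) :* (e :- t)) refl q₁ q₂ E θE ⟩
              (1# - q₂) * E - (1# + q₁ + q₂) * D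
                ≈⟨ +-cong (*-congˡ E-split) (-‿cong (*-congˡ D-split)) ⟩
              (1# - q₂) * (1# + q₁ + q₂ + R₃) - (1# + q₁ + q₂) * (1# - (q₂ + G₃))
                ≈⟨ solve 4 (λ q₁ q₂ r g → (con (1 , 0) :- q₂) :* (con (1 , 0) :+ q₁ :+ q₂ :+ r) :- (con (1 , 0) :+ q₁ :+ q₂) :* (con (1 , 0) :- (q₂ :+ g)) :=
                     g :* (con (1 , 0) :+ q₁ :+ q₂ :+ r) :+ (con (1 , 0) :- (q₂ :+ g)) :* r) refl q₁ q₂ R₃ G₃ ⟩
              G₃ * (1# + q₁ + q₂ + R₃) + (1# - (q₂ + G₃)) * R₃
                ≈⟨ +-cong (*-congˡ E-split) (*-congʳ D-split) ⟨
              G₃ * E + D * R₃ ∎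

            rest : Carrier
            rest = K₅ + G₃ * R₃ + q₁ * G₄ + q₂ * H₃

            -- On the right, D R₃ = R₃ - q₂ R₃ - G₃ R₃. Then G₃ + R₃ - k₃ - k₄ leaves K₅, q₁(G₃ - k₃
            -- + q₃) = q₁(G₃ - g₃) leaves q₁ G₄, and q₂(G₃ - R₃) leaves q₂ H₃.
            rest-value : rest ≈ (1# + q₁ + q₂) * G₃ + D * R₃ - (q₁ * k₃ - q₁ * q₃ + k₄ + k₃) + (G₃ * R₃ + G₃ * R₃)
            rest-value = begin
              K₅ + G₃ * R₃ + q₁ * G₄ + q₂ * H₃
                ≈⟨ solve 10 (λ q₁ q₂ q₃ r g g′ k₅ h g₃ k₄ → k₅ :+ g :* r :+ q₁ :* g′ :+ q₂ :* h :=
                     ((q₃ :+ g₃) :+ (k₄ :+ k₅)) :+ g :* r :+ q₁ :* (g₃ :+ g′) :+ q₂ :* (h :+ r) :- q₂ :* r :- (q₁ :* (q₃ :+ g₃) :- q₁ :* q₃ :+ k₄ :+ (q₃ :+ g₃)))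
                     refl q₁ q₂ q₃ R₃ G₃ G₄ K₅ H₃ g₃ k₄ ⟩
              ((q₃ + g₃) + (k₄ + K₅)) + G₃ * R₃ + q₁ * (g₃ + G₄) + q₂ * (H₃ + R₃) - q₂ * R₃ - (q₁ * (q₃ + g₃) - q₁ * q₃ + k₄ + (q₃ + g₃))
                ≈⟨ +-cong (+-congʳ (+-cong (+-cong (+-congʳ (trans (+-congʳ (sym k₃-split)) (sym K₃-split))) (*-congˡ (sym G₃-split))) (*-congˡ H₃-split)))
                     (-‿cong (+-cong (+-congʳ (+-congʳ (*-congˡ (sym k₃-split)))) (sym k₃-split))) ⟩
              (G₃ + R₃) + G₃ * R₃ + q₁ * G₃ + q₂ * G₃ - q₂ * R₃ - Y
                ≈⟨ solve 5 (λ q₁ q₂ r g y → (g :+ r) :+ g :* r :+ q₁ :* g :+ q₂ :* g :- q₂ :* r :- y :=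
                     (con (1 , 0) :+ q₁ :+ q₂) :* g :+ (con (1 , 0) :- (q₂ :+ g)) :* r :- y :+ (g :* r :+ g :* r)) refl q₁ q₂ R₃ G₃ Y ⟩
              (1# + q₁ + q₂) * G₃ + (1# - (q₂ + G₃)) * R₃ - Y + (G₃ * R₃ + G₃ * R₃)
                ≈⟨ +-congʳ (+-congʳ (+-congˡ (*-congʳ D-split))) ⟨
              (1# + q₁ + q₂) * G₃ + D * R₃ - Y + (G₃ * R₃ + G₃ * R₃) ∎
              where Y = q₁ * k₃ - q₁ * q₃ + k₄ + k₃

          leaf-identity : D * (E * sum (λ c → (h c + h c) * W c)) ≈ 4* (E * E * (G₃ * G₃) + D * E * rest)
          leaf-identity = begin
            D * (E * sum (λ c → (h c + h c) * W c))
              ≈⟨ D*E*sum (λ c → h c + h c) W W-step (λ c → h c + h c) ⟩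
            D * sum (λ c → (h c + h c) * T c * (h c + h c)) + sum (λ c → (h c + h c) * T c) * sum (λ c → T c * (h c + h c))
              ≈⟨ +-cong (*-congˡ (trans (2*sum _ (λ c → h c * T c * (h c + h c)) (λ c → double (h c) (T c) (h c + h c)))
                     (*-congˡ (2*sum _ (λ c → h c * T c * h c) (λ c → double′ (h c * T c) (h c))))))
                   (*-cong (2*sum _ (λ c → h c * T c) (λ c → double″ (h c) (T c))) (2*sum _ (λ c → h c * T c) (λ c → trans (*-comm _ _) (double″ (h c) (T c))))) ⟩
            D * (2# * (2# * S₂)) + 2# * S₁ * (2# * S₁)
              ≈⟨ +-congʳ (*-congˡ (*-congˡ (*-congˡ sum-hTh))) ⟩
            D * (2# * (2# * ((1# + q₁ + q₂) * S₁ - Y * E))) + 2# * S₁ * (2# * S₁)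
              ≈⟨ +-cong (*-congˡ (*-congˡ (*-congˡ (+-congʳ (*-cong Q-value S₁-value))))) (*-cong (*-congˡ S₁-value) (*-congˡ S₁-value)) ⟩
            D * (2# * (2# * ((E - R₃) * (G₃ * E + D * R₃) - Y * E))) + 2# * (G₃ * E + D * R₃) * (2# * (G₃ * E + D * R₃))
              -- The only terms free of E are -D² R₃² from the first product and D² R₃² from the
              -- square. They cancel, so everything except E² G₃² is divisible by D E.
              ≈⟨ solve 5 (λ d e r g y →
                   let two = con (1 , 0) :+ con (1 , 0)
                       p   = e :* e :* (g :* g) :+ d :* e :* ((e :- r) :* g :+ d :* r :- y :+ (g :* r :+ g :* r)) in
                   d :* (two :* (two :* ((e :- r) :* (g :* e :+ d :* r) :- y :* e))) :+ two :* (g :* e :+ d :* r) :* (two :* (g :* e :+ d :* r)) :=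
                   (p :+ p) :+ (p :+ p)) refl D E R₃ G₃ Y ⟩
            4* (E * E * (G₃ * G₃) + D * E * ((E - R₃) * G₃ + D * R₃ - Y + (G₃ * R₃ + G₃ * R₃)))
              ≈⟨ 4*-cong (+-congˡ (*-congˡ (trans (+-congʳ (+-congʳ (+-congʳ (*-congʳ (sym Q-value))))) (sym rest-value)))) ⟩
            4* (E * E * (G₃ * G₃) + D * E * rest) ∎
            where
            Y  = q₁ * k₃ - q₁ * q₃ + k₄ + k₃
            S₂ = sum (λ c → h c * T c * h c)
            Q-value : 1# + q₁ + q₂ ≈ E - R₃
            Q-value = trans (solve 2 (λ p r → p := p :+ r :- r) refl (1# + q₁ + q₂) R₃) (+-congʳ (sym E-split))
            4*-cong : ∀ {p q} → p ≈ q → 4* p ≈ 4* q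
            4*-cong eq = +-cong (+-cong eq eq) (+-cong eq eq)
            double : ∀ p t s → (p + p) * t * s ≈ 2# * (p * t * s)
            double = solve 3 (λ p t s → (p :+ p) :* t :* s := (con (1 , 0) :+ con (1 , 0)) :* (p :* t :* s)) refl
            double′ : ∀ p s → p * (s + s) ≈ 2# * (p * s)
            double′ = solve 2 (λ p s → p :* (s :+ s) := (con (1 , 0) :+ con (1 , 0)) :* (p :* s)) refl
            double″ : ∀ p t → (p + p) * t ≈ 2# * (p * t)
            double″ = solve 2 (λ p t → (p :+ p) :* t := (con (1 , 0) :+ con (1 , 0)) :* (p :* t)) refl

  -- Writing one factor E of `E * E * g` as `D * P` makes the right-hand side a multiple of `D * E`,
  -- which is then cancelled.
  divide : ∀ {D D⁻¹ E E⁻¹ P F g rest} → D * D⁻¹ ≈ 1# → E * E⁻¹ ≈ 1# → D * P ≈ E →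
    D * (E * F) ≈ (E * E * g + D * E * rest + (E * E * g + D * E * rest)) + (E * E * g + D * E * rest + (E * E * g + D * E * rest)) →
    F ≈ (P * g + rest + (P * g + rest)) + (P * g + rest + (P * g + rest))
  divide {D} {D⁻¹} {E} {E⁻¹} {P} {F} {g} {rest} D-inv E-inv DP≈E eq = *-cancel-unit E-inv (*-cancel-unit D-inv (begin
    D * (E * F)
      ≈⟨ eq ⟩
    (E * E * g + D * E * rest + (E * E * g + D * E * rest)) + (E * E * g + D * E * rest + (E * E * g + D * E * rest))
      ≈⟨ +-cong (+-cong one one) (+-cong one one) ⟩
    (D * P * E * g + D * E * rest + (D * P * E * g + D * E * rest)) + (D * P * E * g + D * E * rest + (D * P * E * g + D * E * rest))
      ≈⟨ solve 5 (λ d p e g r → let s = d :* p :* e :* g :+ d :* e :* r ; t = p :* g :+ r in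
           (s :+ s) :+ (s :+ s) := d :* (e :* ((t :+ t) :+ (t :+ t)))) refl D P E g rest ⟩
    D * (E * ((P * g + rest + (P * g + rest)) + (P * g + rest + (P * g + rest)))) ∎))
    where
    one : E * E * g + D * E * rest ≈ D * P * E * g + D * E * rest
    one = +-congʳ (*-congʳ (*-congʳ (sym DP≈E)))

  -- E = D(1 + q₁) + (K + q₁ G), because D = 1 - G and K = G + R₂; the identity results from
  -- dividing by D and multiplying by g.
  expand-path : ∀ {D D⁻¹ E P g q₁ G K R₂} → D * D⁻¹ ≈ 1# → D * P ≈ E → D ≈ 1# - G → E ≈ 1# + q₁ + R₂ → K ≈ G + R₂ →
    P * g ≈ (K + q₁ * G) * (g * D⁻¹) + q₁ * g + g
  expand-path {D} {D⁻¹} {E} {P} {g} {q₁} {G} {K} {R₂} D-inv DP≈E D-split E-split K-split = *-cancel-unit D-inv (begin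
    D * (P * g)
      ≈⟨ *-assoc _ _ _ ⟨
    D * P * g
      ≈⟨ *-congʳ (trans DP≈E E-split) ⟩
    (1# + q₁ + R₂) * g
      ≈⟨ solve 4 (λ q g r k → (con (1 , 0) :+ q :+ r) :* g := ((k :+ r :+ q :* k) :* g :* con (1 , 0) :+ (con (1 , 0) :- k) :* (q :* g :+ g))) refl q₁ g R₂ G ⟩
    (G + R₂ + q₁ * G) * g * 1# + (1# - G) * (q₁ * g + g)
      ≈⟨ +-cong (*-cong (*-congʳ (+-congʳ K-split)) D-inv) (*-congʳ D-split) ⟨
    (K + q₁ * G) * g * (D * D⁻¹) + D * (q₁ * g + g)
      ≈⟨ solve 5 (λ a g d r s → a :* g :* (d :* r) :+ d :* (s :+ g) := d :* (a :* (g :* r) :+ s :+ g)) refl (K + q₁ * G) g D D⁻¹ (q₁ * g) ⟩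
    D * ((K + q₁ * G) * (g * D⁻¹) + q₁ * g + g) ∎)

  -- In the application z is the square of the series variable. A leaf and its twin have degree two,
  -- so each end brings one such factor: one joins the weight of the first letter, the other the
  -- sums `w`.
  sum-shift : ∀ {m} z (a w : Fin m → Carrier) → sum (λ c → z * a c * (z * w c)) ≈ z * (z * sum (λ c → a c * w c))
  sum-shift z a w = begin
    sum (λ c → z * a c * (z * w c))     ≈⟨ sum-cong (λ c → solve 3 (λ z a w → z :* a :* (z :* w) := z :* (z :* (a :* w))) refl z (a c) (w c)) ⟩
    sum (λ c → z * (z * (a c * w c)))   ≈⟨ *-distribˡ-sum z (λ c → z * (a c * w c)) ⟨
    z * sum (λ c → z * (a c * w c))     ≈⟨ *-congˡ (*-distribˡ-sum z (λ c → a c * w c)) ⟨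
    z * (z * sum (λ c → a c * w c))     ∎

  step-shift : ∀ {m} z y (a : Carrier) {b} w (W : Fin m → Carrier) → z * a ≈ b →
    (1# + y) * w ≈ y * (a + sum W) → (1# + y) * (z * w) ≈ y * (b + sum (λ c → z * W c))
  step-shift z y a {b} w W za≈b eq = begin
    (1# + y) * (z * w)                  ≈⟨ solve 3 (λ y z w → y :* (z :* w) := z :* (y :* w)) refl (1# + y) z w ⟩
    z * ((1# + y) * w)                  ≈⟨ *-congˡ eq ⟩
    z * (y * (a + sum W))               ≈⟨ solve 4 (λ z y a s → z :* (y :* (a :+ s)) := y :* (z :* a :+ z :* s)) refl z y a (sum W) ⟩
    y * (z * a + z * sum W)             ≈⟨ *-congˡ (+-cong za≈b (*-distribˡ-sum z W)) ⟩
    y * (b + sum (λ c → z * W c))       ∎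

  expressions-agree : ∀ {D D⁻¹ E P q₁ G K R₂ G₃ R₃ K₃ K₅ a b} → D * D⁻¹ ≈ 1# → D * P ≈ E → D ≈ 1# - G → E ≈ 1# + q₁ + R₂ → K ≈ G + R₂ →
    K₃ ≈ G₃ + R₃ →
    P * (G₃ * G₃) + K₅ + G₃ * R₃ + a + b ≈
    (K + q₁ * G) * ((G₃ * G₃) * D⁻¹) + q₁ * (G₃ * G₃) + (G₃ * K₃ + a + b) + K₅
  expressions-agree {D} {D⁻¹} {E} {P} {q₁} {G} {K} {R₂} {G₃} {R₃} {K₃} {K₅} {a} {b} D-inv DP≈E D-split E-split K-split K₃-split = begin
    P * (G₃ * G₃) + K₅ + G₃ * R₃ + a + b
      ≈⟨ +-congʳ (+-congʳ (+-congʳ (+-congʳ (expand-path D-inv DP≈E D-split E-split K-split)))) ⟩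
    A + B + G₃ * G₃ + K₅ + G₃ * R₃ + a + b
      -- The bare square of G₃ left by `expand-path` joins G₃ R₃ to form G₃ (G₃ + R₃).
      ≈⟨ solve 7 (λ s t g r k a b → s :+ t :+ g :* g :+ k :+ g :* r :+ a :+ b := s :+ t :+ (g :* (g :+ r) :+ a :+ b) :+ k) refl A B G₃ R₃ K₅ a b ⟩
    A + B + (G₃ * (G₃ + R₃) + a + b) + K₅
      ≈⟨ +-congʳ (+-congˡ (+-congʳ (+-congʳ (*-congˡ K₃-split)))) ⟨
    A + B + (G₃ * K₃ + a + b) + K₅ ∎
    where
    A = (K + q₁ * G) * ((G₃ * G₃) * D⁻¹)
    B = q₁ * (G₃ * G₃)

  pathExpression-cong : ∀ {P r q₁ q₂ g g′ g₄ g₄′ k₅ k₅′ h h′} → g ≈ g′ → g₄ ≈ g₄′ → k₅ ≈ k₅′ → h ≈ h′ →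
    P * (g * g) + k₅ + g * r + q₁ * g₄ + q₂ * h ≈ P * (g′ * g′) + k₅′ + g′ * r + q₁ * g₄′ + q₂ * h′
  pathExpression-cong g≈ g₄≈ k₅≈ h≈ =
    +-cong (+-cong (+-cong (+-cong (*-congˡ (*-cong g≈ g≈)) k₅≈) (*-congʳ g≈)) (*-congˡ g₄≈)) (*-congˡ h≈)

  expansion-cong : ∀ {d q₁ q₂ g₂ g₂′ k₂ k₂′ k₃ k₃′ g g′ g₄ g₄′ k₅ k₅′ h h′} →
    g₂ ≈ g₂′ → k₂ ≈ k₂′ → k₃ ≈ k₃′ → g ≈ g′ → g₄ ≈ g₄′ → k₅ ≈ k₅′ → h ≈ h′ →
    (k₂ + q₁ * g₂) * ((g * g) * d) + q₁ * (g * g) + (g * k₃ + q₁ * g₄ + q₂ * h) + k₅ ≈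
    (k₂′ + q₁ * g₂′) * ((g′ * g′) * d) + q₁ * (g′ * g′) + (g′ * k₃′ + q₁ * g₄′ + q₂ * h′) + k₅′
  expansion-cong g₂≈ k₂≈ k₃≈ g≈ g₄≈ k₅≈ h≈ =
    +-cong (+-cong (+-cong (*-cong (+-cong k₂≈ (*-congˡ g₂≈)) (*-congʳ (*-cong g≈ g≈))) (*-congˡ (*-cong g≈ g≈)))
      (+-cong (+-cong (*-cong g≈ k₃≈) (*-congˡ g₄≈)) (*-congˡ h≈))) k₅≈

  geometric : ∀ {g r} → (1# - g) * r ≈ 1# → r ≈ 1# + g * r
  geometric {g} {r} eq = trans (solve 2 (λ g r → r := (con (1 , 0) :- g) :* r :+ g :* r) refl g r) (+-congʳ eq)

-- The transfer identities for power series in z.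

module Chains {c ℓ} (R : CommutativeRing c ℓ) {m} (x : Fin m → CommutativeRing.Carrier R) where
  private
    module R where
      open CommutativeRing R public
      open import Algebra.Properties.Semiring.Mult semiring public
      open import Algebra.Properties.Semiring.Sum semiring public using (sum; sum-cong-≋; sum-replicate-zero)
  open Defs.PowerSeries R.rawRing
  open SeriesRing R using (z^0-*; z^suc-*-suc; z^suc-*-zero)
  open SeriesProperties R
  open FiniteVariables R
  open Transfer (SeriesRing.commutativeRing R) hiding (sum-cong)
  open CommutativeRing (SeriesRing.commutativeRing R) hiding (zero)
  open R using () renaming (_×_ to _·_)
  open import Algebra.Properties.Semiring.Sum semiring using (sum)
  open import Relation.Binary.Reasoning.Setoid R.setoid
  open IntegerCoefficients R using (solve; _:+_; _:*_; _:-_; _:=_)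

  y r : Fin m → Series
  y c = x c z
  r c = 1/[1+ x c z]

  R-sum-cong : ∀ {m} {a b : Fin m → R.Carrier} → (∀ i → a i R.≈ b i) → R.sum a R.≈ R.sum b
  R-sum-cong = R.sum-cong-≋

  z^-sum : ∀ {m} k (p : Fin m → R.Carrier) → R.sum p z^ k ≈ sum (λ c → p c z^ k)
  z^-sum {zero}  k p zero    = z^-0 k 0
    where
    z^-0 : ∀ k n → (R.0# z^ k) n R.≈ R.0#
    z^-0 zero    zero    = R.refl
    z^-0 zero    (suc n) = R.refl
    z^-0 (suc k) zero    = R.refl
    z^-0 (suc k) (suc n) = z^-0 k n
  z^-sum {zero}  zero    p (suc n) = R.refl
  z^-sum {zero}  (suc k) p (suc n) = z^-sum k p n
  z^-sum {suc m} k p n = R.trans (z^-+ k (p zero) (R.sum (p ∘ suc)) n) (R.+-congˡ (z^-sum k (p ∘ suc) n))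

  -- `V n c` is meant as the total weight of the n letters that may follow a letter c, including the
  -- weight at the last letter. Thus `V 0 c` is the weight of c as last letter, and `W c` collects
  -- the words that start with c.
  module _ (V : ℕ → Fin m → R.Carrier)
    (V-step : ∀ n c → V (suc n) c R.+ x c R.* V n c R.≈ R.sum (λ d → x d R.* V n d)) where

    W : Fin m → Series
    W c zero    = R.0#
    W c (suc n) = x c R.* V n c

    sum-W-zero : sum W 0 R.≈ R.0#
    sum-W-zero = R.trans (R.reflexive (sum-coefficient W 0)) (R.sum-replicate-zero m)

    W-step : ∀ c → (1# + y c) * W c ≈ y c * ((V 0 c z^ 0) + sum W)
    W-step c n = R.trans (expand n) (coefficient n)
      where
      expand : ∀ n → ((1# + y c) * W c) n R.≈ W c n R.+ (y c * W c) n
      expand n = R.trans (distribʳ (W c) 1# (y c) n) (R.+-congʳ (*-identityˡ (W c) n))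
      coefficient : ∀ n → W c n R.+ (y c * W c) n R.≈ (y c * ((V 0 c z^ 0) + sum W)) n
      coefficient zero          = R.trans (R.+-congˡ (z^suc-*-zero (x c) 0 (W c)))
        (R.trans (R.+-identityˡ _) (R.sym (z^suc-*-zero (x c) 0 ((V 0 c z^ 0) + sum W))))
      coefficient (suc zero)    = begin
        x c R.* V 0 c R.+ (y c * W c) 1          ≈⟨ R.+-congˡ (z-*-suc (x c) (W c) 0) ⟩
        x c R.* V 0 c R.+ x c R.* R.0#           ≈⟨ R.+-congˡ (R.*-congˡ sum-W-zero) ⟨
        x c R.* V 0 c R.+ x c R.* sum W 0        ≈⟨ R.distribˡ _ _ _ ⟨
        x c R.* (V 0 c R.+ sum W 0)              ≈⟨ z-*-suc (x c) ((V 0 c z^ 0) + sum W) 0 ⟨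
        (y c * ((V 0 c z^ 0) + sum W)) 1         ∎
      coefficient (suc (suc n)) = begin
        x c R.* V (suc n) c R.+ (y c * W c) (suc (suc n))         ≈⟨ R.+-congˡ (z-*-suc (x c) (W c) (suc n)) ⟩
        x c R.* V (suc n) c R.+ x c R.* (x c R.* V n c)           ≈⟨ R.distribˡ _ _ _ ⟨
        x c R.* (V (suc n) c R.+ x c R.* V n c)                   ≈⟨ R.*-congˡ (R.trans (V-step n c) (R.reflexive (≡.sym (sum-coefficient W (suc n))))) ⟩
        x c R.* sum W (suc n)                                     ≈⟨ R.*-congˡ (R.+-identityˡ _) ⟨
        x c R.* (R.0# R.+ sum W (suc n))                          ≈⟨ z-*-suc (x c) ((V 0 c z^ 0) + sum W) (suc n) ⟨
        (y c * ((V 0 c z^ 0) + sum W)) (suc (suc n))              ∎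

  module _ (e : Series) (e≈∏ : e ≈ ∏[1+ x z]) where

    e₀≈1 : e 0 R.≈ R.1#
    e₀≈1 = R.trans (e≈∏ 0) (∏₀ x)
      where
      ∏₀ : ∀ {m} (x : Fin m → R.Carrier) → ∏[1+ x z] 0 R.≈ R.1#
      ∏₀ {zero}  x = R.refl
      ∏₀ {suc m} x = R.trans (R.+-identityʳ _) (R.trans (R.*-cong (R.+-identityʳ _) (∏₀ (x ∘ suc))) (R.*-identityˡ _))

    logarithmic : sum (λ c → y c * (e * r c)) ≈ θ e
    logarithmic = trans (sum-cong (λ c → *-congˡ {y c} (*-congʳ {r c} e≈∏)))
      (trans (sum-logarithmic x) (λ n → R.×-congʳ n (R.sym (e≈∏ n))))

    -- ê c is the generating function of the elementary symmetric functions of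
    -- the variables other than x c.
    ê : Fin m → Series
    ê c = e * r c

    1+y*ê : ∀ c → (1# + y c) * ê c ≈ e
    1+y*ê c n = R.trans (regroup n) (R.trans (*-congˡ {e} (1+z-inverse (x c)) n) (*-identityʳ e n))
      where
      regroup : (1# + y c) * (e * r c) ≈ e * ((1# + y c) * r c)
      regroup = trans (sym (*-assoc (1# + y c) e (r c))) (trans (*-congʳ {r c} (*-comm (1# + y c) e)) (*-assoc e (1# + y c) (r c)))

    ê-zero : ∀ c → ê c 0 R.≈ R.1#
    ê-zero c = R.trans (R.+-identityʳ _) (R.trans (R.*-identityʳ _) e₀≈1)

    -- A squarefree monomial either avoids x_c or is x_c times one that does. The argument `p` lets
    -- a closed form of the preceding coefficient be inserted.
    ê-suc : ∀ c n {p} → ê c n R.≈ p → ê c (suc n) R.≈ e (suc n) R.- x c R.* p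
    ê-suc c n {p} eq = begin
      ê c (suc n)                                       ≈⟨ solve 2 (λ a b → a := a :+ b :- b) R.refl (ê c (suc n)) (x c R.* p) ⟩
      ê c (suc n) R.+ x c R.* p R.- x c R.* p           ≈⟨ R.+-congʳ (R.+-congˡ (R.*-congˡ (R.sym eq))) ⟩
      ê c (suc n) R.+ x c R.* ê c n R.- x c R.* p       ≈⟨ R.+-congʳ (R.+-cong (*-identityˡ (ê c) (suc n)) (z-*-suc (x c) (ê c) n)) ⟨
      (1# * ê c) (suc n) R.+ (y c * ê c) (suc n) R.- x c R.* p ≈⟨ R.+-congʳ (R.trans (R.sym (distribʳ (ê c) 1# (y c) (suc n))) (1+y*ê c (suc n))) ⟩
      e (suc n) R.- x c R.* p                           ∎

    -- This is the coefficient of z^{n+1} in the logarithmic derivative: each squarefree monomial of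
    -- degree n + 1 arises once for each of its n + 1 variables.
    power-moment : ∀ n (p : Fin m → R.Carrier) → (∀ c → ê c n R.≈ p c) →
      R.sum (λ c → x c R.* p c) R.≈ suc n · e (suc n)
    power-moment n p eq = begin
      R.sum (λ c → x c R.* p c)                  ≈⟨ R-sum-cong (λ c → R.*-congˡ (R.sym (eq c))) ⟩
      R.sum (λ c → x c R.* ê c n)                ≈⟨ R-sum-cong (λ c → z-*-suc (x c) (ê c) n) ⟨
      R.sum (λ c → (y c * ê c) (suc n))          ≡⟨ sum-coefficient (λ c → y c * ê c) (suc n) ⟨
      sum (λ c → y c * ê c) (suc n)              ≈⟨ logarithmic (suc n) ⟩
      suc n · e (suc n)                          ∎

    moment : ∀ n (p : Fin m → R.Carrier) → (∀ c → ê c n R.≈ p c) →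
      sum (λ c → (x c R.* p c) z^ suc n) ≈ (suc n · e (suc n)) z^ suc n
    moment n p eq = trans (sym (z^-sum (suc n) (λ c → x c R.* p c))) (z^-cong (suc n) (power-moment n p eq))

    q₁ q₂ q₃ k₃ k₄ : Series
    q₁ = e 1 z^ 1
    q₂ = e 2 z^ 2
    q₃ = e 3 z^ 3
    k₃ = (3 · e 3) z^ 3
    k₄ = (4 · e 4) z^ 4

    ê₁ ê₂ ê₃ : Fin m → R.Carrier
    ê₁ c = e 1 R.- x c
    ê₂ c = e 2 R.- x c R.* e 1 R.+ x c R.* x c
    ê₃ c = e 3 R.- x c R.* ê₂ c

    ê₁-coefficient : ∀ c → ê c 1 R.≈ ê₁ c
    ê₁-coefficient c = R.trans (ê-suc c 0 (ê-zero c)) (R.+-congˡ (R.-‿cong (R.*-identityʳ _)))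

    ê₂-coefficient : ∀ c → ê c 2 R.≈ ê₂ c
    ê₂-coefficient c = R.trans (ê-suc c 1 (ê₁-coefficient c))
      (solve 3 (λ p q x → q :- x :* (p :- x) := q :- x :* p :+ x :* x) R.refl (e 1) (e 2) (x c))

    ê₃-coefficient : ∀ c → ê c 3 R.≈ ê₃ c
    ê₃-coefficient c = ê-suc c 2 (ê₂-coefficient c)

    sum-x : R.sum x R.≈ e 1
    sum-x = R.trans (R-sum-cong (λ c → R.sym (R.*-identityʳ (x c))))
      (R.trans (power-moment 0 (λ _ → R.1#) ê-zero) (R.×-homo-1 (e 1)))

    sum-xê₁ : R.sum (λ c → x c R.* ê₁ c) R.≈ e 2 R.+ e 2
    sum-xê₁ = R.trans (power-moment 1 ê₁ ê₁-coefficient) (R.+-congˡ (R.×-homo-1 (e 2)))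

    h₂ : Fin m → Series
    h₂ = h y r e (θ e) (λ c → 1+z-inverse (x c)) logarithmic q₁ q₂ q₃ k₃ k₄

    z^-- : ∀ k p q → (p R.- q) z^ k ≈ p z^ k - q z^ k
    z^-- k p q n = R.trans (z^-+ k p (R.- q) n) (R.+-congˡ (z^-neg k q n))

    h₂-monomial : ∀ c → ê₂ c z^ 2 ≈ h₂ c
    h₂-monomial c n = R.trans (z^-+ 2 (e 2 R.- x c R.* e 1) (x c R.* x c) n)
      (R.+-cong (R.trans (z^-- 2 (e 2) (x c R.* e 1) n) (R.+-congˡ (R.-‿cong (R.sym (z^-* 1 1 (x c) (e 1) n)))))
        (R.sym (z^-* 1 1 (x c) (x c) n)))

    sum-y : sum y ≈ q₁
    sum-y = trans (sum-cong (λ c → z^-cong 1 (R.sym (R.*-identityʳ (x c)))))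
      (trans (moment 0 (λ _ → R.1#) ê-zero) (z^-cong 1 (R.×-homo-1 (e 1))))

    sum-yh₁ : sum (λ c → y c * (q₁ - y c)) ≈ q₂ + q₂
    sum-yh₁ = trans (sum-cong λ c → trans (*-congˡ {y c} (sym (z^-- 1 (e 1) (x c)))) (z^-* 1 1 (x c) (ê₁ c)))
      (trans (moment 1 ê₁ ê₁-coefficient) (trans (z^-cong 2 (R.+-congˡ (R.×-homo-1 (e 2)))) (z^-+ 2 (e 2) (e 2))))

    sum-yh₂ : sum (λ c → y c * h₂ c) ≈ k₃
    sum-yh₂ = trans (sum-cong λ c → trans (*-congˡ {y c} (sym (h₂-monomial c))) (z^-* 1 2 (x c) (ê₂ c)))
      (moment 2 ê₂ ê₂-coefficient)

    sum-yh₃ : sum (λ c → y c * (q₃ - y c * h₂ c)) ≈ k₄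
    sum-yh₃ = trans (sum-cong λ c → trans (*-congˡ {y c} (sym (monomial c))) (z^-* 1 3 (x c) (ê₃ c)))
      (moment 3 ê₃ ê₃-coefficient)
      where
      monomial : ∀ c → ê₃ c z^ 3 ≈ q₃ - y c * h₂ c
      monomial c n = R.trans (z^-- 3 (e 3) (x c R.* ê₂ c) n)
        (R.+-congˡ (R.-‿cong (R.trans (R.sym (z^-* 1 2 (x c) (ê₂ c) n)) (*-congˡ {y c} (h₂-monomial c) n))))

    K≥ G≥ : ℕ → Series
    K≥ k = ∑≥ k λ i → i · e i
    G≥ k = ∑≥ k λ i → (i ∸ 1) · e i

    R≥3 H≥3 D : Series
    R≥3 = ∑≥ 3 e
    H≥3 = ∑≥ 3 λ i → (i ∸ 2) · e i
    D   = 1# - G≥ 2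

    R≥2 : Series
    R≥2 = ∑≥ 2 e

    e-split₂ : e ≈ 1# + q₁ + R≥2
    e-split₂ n = begin
      e n                                                  ≈⟨ ∑≥-split 0 e n ⟩
      (e 0 z^ 0) n R.+ ∑≥ 1 e n                            ≈⟨ R.+-cong (z^-cong 0 e₀≈1 n) (∑≥-split 1 e n) ⟩
      1# n R.+ (q₁ n R.+ R≥2 n)                            ≈⟨ R.+-assoc _ _ _ ⟨
      1# n R.+ q₁ n R.+ R≥2 n                              ∎

    e-split₃ : e ≈ 1# + q₁ + q₂ + R≥3
    e-split₃ n = R.trans (e-split₂ n) (R.trans (R.+-congˡ (∑≥-split 2 e n)) (R.sym (R.+-assoc _ _ _)))

    K≥-split : ∀ k → K≥ (suc k) ≈ G≥ (suc k) + ∑≥ (suc k) e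
    K≥-split k n = R.trans (∑≥-cong (suc k) one n) (∑≥-+ (suc k) (λ i → (i ∸ 1) · e i) e n)
      where
      one : ∀ i → suc k ℕ.≤ i → i · e i R.≈ (i ∸ 1) · e i R.+ e i
      one (suc i) _ = R.+-comm _ _

    H≥3-split : H≥3 + R≥3 ≈ G≥ 3
    H≥3-split n = R.trans (R.sym (∑≥-+ 3 (λ i → (i ∸ 2) · e i) e n)) (∑≥-cong 3 one n)
      where
      one : ∀ i → 3 ℕ.≤ i → (i ∸ 2) · e i R.+ e i R.≈ (i ∸ 1) · e i
      one (suc (suc i)) _            = R.+-comm _ _
      one (suc zero)    (ℕ.s≤s ())

    θ-split : θ e ≈ q₁ + K≥ 2
    θ-split n = begin
      n · e n                                   ≈⟨ ∑≥-split 0 (λ i → i · e i) n ⟩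
      (R.0# z^ 0) n R.+ K≥ 1 n                  ≈⟨ R.+-cong (0z^0 n) (∑≥-split 1 (λ i → i · e i) n) ⟩
      R.0# R.+ (((1 · e 1) z^ 1) n R.+ K≥ 2 n)  ≈⟨ R.+-identityˡ _ ⟩
      ((1 · e 1) z^ 1) n R.+ K≥ 2 n             ≈⟨ R.+-congʳ (z^-cong 1 (R.×-homo-1 (e 1)) n) ⟩
      q₁ n R.+ K≥ 2 n                           ∎
      where
      0z^0 : ∀ n → (R.0# z^ 0) n R.≈ R.0#
      0z^0 zero    = R.refl
      0z^0 (suc n) = R.refl

    -- The coefficient of zⁱ is (1 - i) eᵢ, which vanishes for i = 1.
    e-θe≈D : e - θ e ≈ D
    e-θe≈D n = begin
      e n R.- θ e n                                                          ≈⟨ R.+-cong (e-split₂ n) (R.-‿cong (R.trans (θ-split n) (R.+-congˡ (K≥-split 1 n)))) ⟩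
      1# n R.+ q₁ n R.+ R≥2 n R.- (q₁ n R.+ (G≥ 2 n R.+ R≥2 n))              ≈⟨ solve 4 (λ u q r g → u :+ q :+ r :- (q :+ (g :+ r)) := u :- g) R.refl (1# n) (q₁ n) (R≥2 n) (G≥ 2 n) ⟩
      1# n R.- G≥ 2 n                                                        ∎

    G≥2-split : G≥ 2 ≈ q₂ + G≥ 3
    G≥2-split n = R.trans (∑≥-split 2 (λ i → (i ∸ 1) · e i) n) (R.+-congʳ (z^-cong 2 (R.×-homo-1 (e 2)) n))

    g₃ : Series
    g₃ = (2 · e 3) z^ 3

    K≥3-split : G≥ 3 + R≥3 ≈ k₃ + (k₄ + K≥ 5)
    K≥3-split n = R.trans (R.sym (K≥-split 2 n)) (R.trans (∑≥-split 3 (λ i → i · e i) n) (R.+-congˡ (∑≥-split 4 (λ i → i · e i) n)))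

    module _ (P : Series) (V : ℕ → Fin m → R.Carrier)
      (V-zero : ∀ c → V 0 c R.≈ R.1#)
      (V-step : ∀ n c → V (suc n) c R.+ x c R.* V n c R.≈ R.sum (λ d → x d R.* V n d))
      (P-zero : P 0 R.≈ R.1#)
      (P-suc  : ∀ n → P (suc n) R.≈ R.sum (λ c → x c R.* V n c)) where

      D*P : D * P ≈ e
      D*P = trans (*-cong {D} {e - θ e} {P} {1# + sum (W V V-step)} (sym e-θe≈D) P≈1+sum)
        (D*path y r e (θ e) (λ c → 1+z-inverse (x c)) logarithmic (W V V-step)
          (λ c → trans (W-step V V-step c) (*-congˡ {y c} (+-congʳ {sum (W V V-step)} (z^-cong 0 (V-zero c))))))
        where
        P≈1+sum : P ≈ 1# + sum (W V V-step)
        P≈1+sum zero    = R.trans P-zero (R.sym (R.trans (R.+-congˡ (sum-W-zero V V-step)) (R.+-identityʳ _)))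
        P≈1+sum (suc n) = R.trans (P-suc n) (R.trans (R.reflexive (≡.sym (sum-coefficient (W V V-step) (suc n)))) (R.sym (R.+-identityˡ _)))

    pathExpression expansion : Series → Series
    pathExpression P = P * (G≥ 3 * G≥ 3) + K≥ 5 + G≥ 3 * R≥3 + q₁ * G≥ 4 + q₂ * H≥3
    expansion D⁻¹ = (K≥ 2 + q₁ * G≥ 2) * ((G≥ 3 * G≥ 3) * D⁻¹) + q₁ * (G≥ 3 * G≥ 3)
      + (G≥ 3 * K≥ 3 + q₁ * G≥ 4 + q₂ * H≥3) + K≥ 5

    pathExpression≈expansion : ∀ {D⁻¹ P} → D * D⁻¹ ≈ 1# → D * P ≈ e → pathExpression P ≈ expansion D⁻¹
    pathExpression≈expansion {D⁻¹} {P} D-inv DP≈e = expressions-agree {D} {D⁻¹} {e} {P} {q₁} {G≥ 2} {K≥ 2} {R≥2} {G≥ 3} {R≥3} {K≥ 3} {K≥ 5}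
      {q₁ * G≥ 4} {q₂ * H≥3} D-inv DP≈e refl e-split₂ (K≥-split 1) (K≥-split 2)

    module _ (L : Series) (V : ℕ → Fin m → R.Carrier)
      (V-zero : ∀ c → V 0 c R.≈ ê₂ c R.+ ê₂ c)
      (V-step : ∀ n c → V (suc n) c R.+ x c R.* V n c R.≈ R.sum (λ d → x d R.* V n d))
      (L-low  : ∀ n → n ℕ.< 5 → L n R.≈ R.0#)
      (L-high : ∀ n → L (5 ℕ.+ n) R.≈ R.sum (λ c → V 0 c R.* (x c R.* V n c))) where

      private
        z² : Series
        z² = R.1# z^ 2

        v w N : Fin m → Series
        v c = V 0 c z^ 0
        w   = W V V-step
        N c = v c * w c

        z²*-high : ∀ a n → (z² * a) (2 ℕ.+ n) R.≈ a n
        z²*-high a n = R.trans (z^suc-*-suc R.1# 1 a (suc n)) (R.trans (z^suc-*-suc R.1# 0 a n) (*-identityˡ a n))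

        N-zero : sum N 0 R.≈ R.0#
        N-zero = R.trans (R.reflexive (sum-coefficient N 0))
          (R.trans (R-sum-cong (λ c → R.trans (z^0-* (V 0 c) (w c) 0) (R.zeroʳ _))) (R.sum-replicate-zero m))

        N-suc : ∀ n → sum N (suc n) R.≈ R.sum (λ c → V 0 c R.* (x c R.* V n c))
        N-suc n = R.trans (R.reflexive (sum-coefficient N (suc n))) (R-sum-cong (λ c → z^0-* (V 0 c) (w c) (suc n)))

        -- A word of n + 1 letters contributes in degree n + 5, two more at each end.
        L-shifted : L ≈ z² * (z² * sum N)
        L-shifted 0 = R.trans (L-low 0 (ℕ.s≤s ℕ.z≤n)) (R.sym (z^suc-*-zero R.1# 1 (z² * sum N)))
        L-shifted 1 = R.trans (L-low 1 (ℕ.s≤s (ℕ.s≤s ℕ.z≤n)))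
          (R.sym (R.trans (z^suc-*-suc R.1# 1 (z² * sum N) 0) (z^suc-*-zero R.1# 0 (z² * sum N))))
        L-shifted 2 = R.trans (L-low 2 (ℕ.s≤s (ℕ.s≤s (ℕ.s≤s ℕ.z≤n))))
          (R.sym (R.trans (z²*-high (z² * sum N) 0) (z^suc-*-zero R.1# 1 (sum N))))
        L-shifted 3 = R.trans (L-low 3 (ℕ.s≤s (ℕ.s≤s (ℕ.s≤s (ℕ.s≤s ℕ.z≤n)))))
          (R.sym (R.trans (z²*-high (z² * sum N) 1) (R.trans (z^suc-*-suc R.1# 1 (sum N) 0) (z^suc-*-zero R.1# 0 (sum N)))))
        L-shifted 4 = R.trans (L-low 4 (ℕ.s≤s (ℕ.s≤s (ℕ.s≤s (ℕ.s≤s (ℕ.s≤s ℕ.z≤n))))))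
          (R.sym (R.trans (z²*-high (z² * sum N) 2) (R.trans (z²*-high (sum N) 0) N-zero)))
        L-shifted (suc (suc (suc (suc (suc n))))) = R.trans (L-high n)
          (R.sym (R.trans (z²*-high (z² * sum N) (3 ℕ.+ n)) (R.trans (z²*-high (sum N) (suc n)) (N-suc n))))

        z²*v : ∀ c → z² * v c ≈ h₂ c + h₂ c
        z²*v c n = R.trans (z^-* 2 0 R.1# (V 0 c) n) (R.trans (z^-cong 2 (R.trans (R.*-identityˡ _) (V-zero c)) n)
          (R.trans (z^-+ 2 (ê₂ c) (ê₂ c) n) (R.+-cong (h₂-monomial c n) (h₂-monomial c n))))

        L-sum : L ≈ sum (λ c → (h₂ c + h₂ c) * (z² * w c))
        L-sum = trans L-shifted (trans (sym (sum-shift z² v w)) (sum-cong (λ c → *-congʳ {z² * w c} (z²*v c))))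

        rest : Series
        rest = K≥ 5 + G≥ 3 * R≥3 + q₁ * G≥ 4 + q₂ * H≥3

      leaf : ∀ {D⁻¹ P} → D * D⁻¹ ≈ 1# → D * P ≈ e →
        L ≈ (pathExpression P + pathExpression P) + (pathExpression P + pathExpression P)
      leaf {D⁻¹} {P} D-inv DP≈e n = R.trans (L-sum n) (R.trans
        (divide {e - θ e} {D⁻¹} {e} {recip e} {P} {sum (λ c → (h₂ c + h₂ c) * (z² * w c))} {G≥ 3 * G≥ 3} {rest}
          (trans (*-congʳ {D⁻¹} e-θe≈D) D-inv) (Defs.*-recip R.ring e e₀≈1) (trans (*-congʳ {P} e-θe≈D) DP≈e)
          (leaf-identity y r e (θ e) (λ c → 1+z-inverse (x c)) logarithmic q₁ q₂ q₃ k₃ k₄ sum-y sum-yh₁ sum-yh₂ sum-yh₃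
            R≥3 (G≥ 3) (G≥ 4) (K≥ 5) H≥3 g₃ e-split₃ (trans e-θe≈D (+-congˡ {1#} (-‿cong {G≥ 2} {q₂ + G≥ 3} G≥2-split)))
            K≥3-split (∑≥-split 3 (λ i → (i ∸ 1) · e i)) H≥3-split (z^-+ 3 (e 3) (2 · e 3))
            (λ c → z² * w c) (λ c → step-shift z² (y c) (v c) (w c) w (z²*v c) (W-step V V-step c))) n)
        (R.+-cong (R.+-cong regroup regroup) (R.+-cong regroup regroup)))
        where
        regroup : (P * (G≥ 3 * G≥ 3)) n R.+ rest n R.≈ pathExpression P n
        regroup = solve 5 (λ p k r g h → p :+ (k :+ r :+ g :+ h) := p :+ k :+ r :+ g :+ h) R.refl
          ((P * (G≥ 3 * G≥ 3)) n) (K≥ 5 n) ((G≥ 3 * R≥3) n) ((q₁ * G≥ 4) n) ((q₂ * H≥3) n)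

-- Sums over words

module WordSums {c ℓ} (R : CommutativeRing c ℓ) where
  open CommutativeRing R hiding (zero)
  open import Algebra.Properties.Semiring.Sum semiring using (sum; sum-cong-≋; *-distribˡ-sum)
  open import Relation.Binary.Reasoning.Setoid setoid
  open IntegerCoefficients R using (solve; _:+_; _:*_; _:-_; _:=_; con)

  private variable
    P Q A B : Set

  sum-cong : ∀ {m} {a b : Fin m → Carrier} → (∀ i → a i ≈ b i) → sum a ≈ sum b
  sum-cong = sum-cong-≋

  𝟙 : Dec P → Carrier
  𝟙 P? = if does P? then 1# else 0#

  𝟙-true : (P? : Dec P) → P → 𝟙 P? ≈ 1#
  𝟙-true (yes _) p = refl
  𝟙-true (no ¬p) p = contradiction p ¬p

  𝟙-false : (P? : Dec P) → ¬ P → 𝟙 P? ≈ 0#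
  𝟙-false (yes p) ¬p = contradiction p ¬p
  𝟙-false (no _)  ¬p = refl

  𝟙-cong : (P? : Dec P) (Q? : Dec Q) → (P → Q) → (Q → P) → 𝟙 P? ≈ 𝟙 Q?
  𝟙-cong P? (yes q) to from = 𝟙-true P? (from q)
  𝟙-cong P? (no ¬q) to from = 𝟙-false P? (¬q ∘ to)

  𝟙-× : (A? : Dec A) (B? : Dec B) → 𝟙 (A? ×-dec B?) ≈ 𝟙 A? * 𝟙 B?
  𝟙-× (yes _) B? = sym (*-identityˡ _)
  𝟙-× (no _)  B? = sym (zeroˡ _)

  𝟙-∧ : (P? : Dec P) (A? : Dec A) (B? : Dec B) → (P → A × B) → (A × B → P) → 𝟙 P? ≈ 𝟙 A? * 𝟙 B?
  𝟙-∧ P? A? B? to from = trans (𝟙-cong P? (A? ×-dec B?) to from) (𝟙-× A? B?)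

  𝟙-idempotent : (P? : Dec P) → 𝟙 P? * 𝟙 P? ≈ 𝟙 P?
  𝟙-idempotent (yes _) = *-identityˡ _
  𝟙-idempotent (no _)  = zeroˡ _

  ne : ℕ → ℕ → Carrier
  ne i j = 𝟙 (¬? (i ℕ.≟ j))

  ne-suc : ∀ i j → ne (suc i) (suc j) ≈ ne i j
  ne-suc i j = 𝟙-cong (¬? (suc i ℕ.≟ suc j)) (¬? (i ℕ.≟ j)) (λ p eq → p (≡.cong suc eq)) (λ p eq → p (ℕ.suc-injective eq))

  sum-ne : ∀ {m} (c : Fin m) (a : Fin m → Carrier) → sum (λ d → ne (toℕ c) (toℕ d) * a d) + a c ≈ sum a
  sum-ne {suc m} zero    a = begin
    0# * a zero + sum (λ d → 1# * a (suc d)) + a zero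
      ≈⟨ +-congʳ (+-congˡ (sum-cong {m} (λ d → *-identityˡ (a (suc d))))) ⟩
    0# * a zero + sum (a ∘ suc) + a zero
      ≈⟨ solve 2 (λ p s → con (0 , 0) :* p :+ s :+ p := p :+ s) refl (a zero) (sum (a ∘ suc)) ⟩
    a zero + sum (a ∘ suc) ∎
  sum-ne {suc m} (suc c) a = begin
    1# * a zero + sum (λ d → ne (suc (toℕ c)) (suc (toℕ d)) * a (suc d)) + a (suc c)
      ≈⟨ +-assoc _ _ _ ⟩
    1# * a zero + (sum (λ d → ne (suc (toℕ c)) (suc (toℕ d)) * a (suc d)) + a (suc c))
      ≈⟨ +-cong (*-identityˡ _) (trans (+-congʳ (sum-cong {m} (λ d → *-congʳ (ne-suc (toℕ c) (toℕ d))))) (sum-ne c (a ∘ suc))) ⟩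
    a zero + sum (a ∘ suc) ∎

  sum-ne-sub : ∀ {m} (c : Fin m) (a : Fin m → Carrier) → sum (λ d → ne (toℕ c) (toℕ d) * a d) ≈ sum a - a c
  sum-ne-sub c a = trans (solve 2 (λ p q → p := p :+ q :- q) refl _ (a c)) (+-congʳ (sum-ne c a))

  ne-sym : ∀ i j → ne i j ≈ ne j i
  ne-sym i j = 𝟙-cong (¬? (i ℕ.≟ j)) (¬? (j ℕ.≟ i)) (λ p → p ∘ ≡.sym) (λ p → p ∘ ≡.sym)

  module Words (m : ℕ) (ξ : ℕ → Carrier) where

    -- Nested sums over `Fin m` replace the sum over a list of words, so that distributivity and
    -- exchange of summations apply letter by letter.
    wordsum : ∀ n → (Vec ℕ n → Carrier) → Carrier
    wordsum zero    F = F []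
    wordsum (suc n) F = sum {m} λ c → wordsum n λ w → F (toℕ c ∷ w)

    wordsum-cong : ∀ n {F G : Vec ℕ n → Carrier} → (∀ w → F w ≈ G w) → wordsum n F ≈ wordsum n G
    wordsum-cong zero    eq = eq []
    wordsum-cong (suc n) eq = sum-cong {m} λ c → wordsum-cong n λ w → eq (toℕ c ∷ w)

    wordsum-* : ∀ n p (F : Vec ℕ n → Carrier) → wordsum n (λ w → p * F w) ≈ p * wordsum n F
    wordsum-* zero    p F = refl
    wordsum-* (suc n) p F = trans (sum-cong {m} λ c → wordsum-* n p (λ w → F (toℕ c ∷ w)))
      (sym (*-distribˡ-sum {m} p (λ c → wordsum n (λ w → F (toℕ c ∷ w)))))

    x : Fin m → Carrier
    x c = ξ (toℕ c)

    monomial : ∀ {n} → Vec ℕ n → Carrier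
    monomial []      = 1#
    monomial (i ∷ w) = ξ i * monomial w

    weight : ∀ {n} {P : Pred (Vec ℕ n) 0ℓ} → Decidable P → Carrier
    weight {n} P? = wordsum n λ w → 𝟙 (P? w) * monomial w

    weight-[] : ∀ {P : Pred (Vec ℕ 0) 0ℓ} (P? : Decidable P) → P [] → weight P? ≈ 1#
    weight-[] P? p = trans (*-identityʳ _) (𝟙-true (P? []) p)

    weight-∷ : ∀ {n} {P : Pred (Vec ℕ (suc n)) 0ℓ} (P? : Decidable P) →
      weight P? ≈ sum (λ c → x c * weight (λ w → P? (toℕ c ∷ w)))
    weight-∷ {n} P? = sum-cong {m} λ c → trans
      (wordsum-cong n λ w → solve 3 (λ a b d → a :* (b :* d) := b :* (a :* d)) refl (𝟙 (P? (toℕ c ∷ w))) (x c) (monomial w))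
      (wordsum-* n (x c) _)

    weight-∧ : ∀ {n} {P Q : Pred (Vec ℕ n) 0ℓ} (P? : Decidable P) (A? : Dec A) (Q? : Decidable Q) →
      (∀ w → P w → A × Q w) → (∀ w → A × Q w → P w) → weight P? ≈ 𝟙 A? * weight Q?
    weight-∧ {n = n} P? A? Q? to from = trans
      (wordsum-cong n λ w → trans (*-congʳ (𝟙-∧ (P? w) A? (Q? w) (to w) (from w))) (*-assoc _ _ _))
      (wordsum-* n (𝟙 A?) _)

    -- The source of all transfer recursions below: a condition that separates into one on the first
    -- letter and one on the remaining word turns the weight into a single sum.
    weight-∷-∧ : ∀ {n} {P : Pred (Vec ℕ (suc n)) 0ℓ} {A : Pred ℕ 0ℓ} {Q : ℕ → Pred (Vec ℕ n) 0ℓ}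
      (P? : Decidable P) (A? : Decidable A) (Q? : ∀ i → Decidable (Q i)) →
      (∀ i w → P (i ∷ w) → A i × Q i w) → (∀ i w → A i × Q i w → P (i ∷ w)) →
      weight P? ≈ sum (λ c → 𝟙 (A? (toℕ c)) * (x c * weight (Q? (toℕ c))))
    weight-∷-∧ P? A? Q? to from = trans (weight-∷ P?) (sum-cong {m} λ c → trans
      (*-congˡ (weight-∧ (λ w → P? (toℕ c ∷ w)) (A? (toℕ c)) (Q? (toℕ c)) (to (toℕ c)) (from (toℕ c))))
      (solve 3 (λ a b d → a :* (b :* d) := b :* (a :* d)) refl (x c) (𝟙 (A? (toℕ c))) _))

  lt : ℕ → ℕ → Carrier
  lt i j = 𝟙 (i ℕ.<? j)

  lt-suc : ∀ i j → lt (suc i) (suc j) ≈ lt i j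
  lt-suc i j = 𝟙-cong (suc i ℕ.<? suc j) (i ℕ.<? j) ℕ.s<s⁻¹ ℕ.s<s

  open FiniteVariables R using (∏[1+_z]; _z; z-*-suc)

  -- `f k c` plays the role of the increasing words of length k with letters above c. A word either
  -- avoids the smallest letter or begins with it, and in the latter case continues with any
  -- increasing word in the others; this is multiplication by `1# + x zero z`. Keeping `f` abstract
  -- lets the induction drop the first variable.
  increasing-product : ∀ {m} (x : Fin m → Carrier) (f : ℕ → Fin m → Carrier) →
    (∀ c → f 0 c ≈ 1#) →
    (∀ k c → f (suc k) c ≈ sum (λ d → lt (toℕ c) (toℕ d) * (x d * f k d))) →
    ∀ (E : ℕ → Carrier) → E 0 ≈ 1# → (∀ k → E (suc k) ≈ sum (λ c → x c * f k c)) →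
    ∀ n → E n ≈ ∏[1+ x z] n
  increasing-product {zero}  x f f₀ f₊ E E₀ E₊ zero    = E₀
  increasing-product {zero}  x f f₀ f₊ E E₀ E₊ (suc n) = E₊ n
  increasing-product {suc m} x f f₀ f₊ E E₀ E₊ n = trans (split n) (trans (+-cong (E′≈∏ n) (shift n)) (sym (expand n)))
    where
    module S = CommutativeRing (SeriesRing.commutativeRing R)
    open SeriesRing R using (z^suc-*-zero)
    E′ : ℕ → Carrier
    E′ zero    = 1#
    E′ (suc k) = sum (λ c → x (suc c) * f k (suc c))
    ∏′ = ∏[1+ x ∘ suc z]
    E′≈∏ : ∀ n → E′ n ≈ ∏′ n
    E′≈∏ = increasing-product (x ∘ suc) (λ k c → f k (suc c)) (λ c → f₀ (suc c))
      (λ k c → trans (f₊ k (suc c)) (trans (+-cong (zeroˡ _) (sum-cong {m} λ d → *-congʳ (lt-suc (toℕ c) (toℕ d)))) (+-identityˡ _)))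
      E′ refl (λ _ → refl)
    f-zero : ∀ k → f k zero ≈ E′ k
    f-zero zero    = f₀ zero
    f-zero (suc k) = trans (f₊ k zero) (trans (+-cong (zeroˡ _) (sum-cong {m} λ d → *-identityˡ _)) (+-identityˡ _))
    split : ∀ n → E n ≈ E′ n + (x zero z S.* E′) n
    split zero    = trans E₀ (sym (trans (+-congˡ (z^suc-*-zero (x zero) 0 E′)) (+-identityʳ _)))
    split (suc n) = trans (E₊ n) (trans (+-comm _ _) (+-congˡ (trans (*-congˡ (f-zero n)) (sym (z-*-suc (x zero) E′ n)))))
    shift : ∀ n → (x zero z S.* E′) n ≈ (x zero z S.* ∏′) n
    shift = S.*-congˡ {x zero z} E′≈∏
    expand : ∀ n → ((S.1# S.+ x zero z) S.* ∏′) n ≈ ∏′ n + (x zero z S.* ∏′) n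
    expand n = trans (S.distribʳ ∏′ S.1# (x zero z) n) (+-congʳ (S.*-identityˡ ∏′ n))

-- Proper colourings of paths with twinned leaves

path-∷⁻ : ∀ {n a b} {w : Vec ℕ n} → Proper (path (2 ℕ.+ n)) (a ∷ b ∷ w) → a ≢ b × Proper (path (1 ℕ.+ n)) (b ∷ w)
path-∷⁻ p = p zero (suc zero) (inj₁ ≡.refl) , λ u v adj → p (suc u) (suc v) (Sum.map (≡.cong suc) (≡.cong suc) adj)

path-∷⁺ : ∀ {n a b} {w : Vec ℕ n} → a ≢ b × Proper (path (1 ℕ.+ n)) (b ∷ w) → Proper (path (2 ℕ.+ n)) (a ∷ b ∷ w)
path-∷⁺ (a≢b , p) zero          zero          (inj₁ ())
path-∷⁺ (a≢b , p) zero          zero          (inj₂ ())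
path-∷⁺ (a≢b , p) zero          (suc zero)    adj = a≢b
path-∷⁺ (a≢b , p) zero          (suc (suc v)) (inj₁ ())
path-∷⁺ (a≢b , p) zero          (suc (suc v)) (inj₂ ())
path-∷⁺ (a≢b , p) (suc zero)    zero          adj = a≢b ∘ ≡.sym
path-∷⁺ (a≢b , p) (suc (suc u)) zero          (inj₁ ())
path-∷⁺ (a≢b , p) (suc (suc u)) zero          (inj₂ ())
path-∷⁺ (a≢b , p) (suc u)       (suc v)       adj = p u v (Sum.map ℕ.suc-injective ℕ.suc-injective adj)

path-1 : ∀ a → Proper (path 1) (a ∷ [])
path-1 a zero zero (inj₁ ())
path-1 a zero zero (inj₂ ())

module _ {n} (H : SimpleGraph n) (v : Fin n) where
  open SimpleGraph H

  AvoidsClosedNeighbourhood : ℕ → Vec ℕ n → Set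
  AvoidsClosedNeighbourhood a κ = ∀ u → u ≡ v ⊎ u ~ v → a ≢ lookup κ u

  avoids? : ∀ a κ → Dec (AvoidsClosedNeighbourhood a κ)
  avoids? a κ = all? λ u → ((u Fin.≟ v) ⊎-dec (u ~? v)) →-dec ¬? (a ℕ.≟ lookup κ u)

  twin-∷⁻ : ∀ {a κ} → Proper (twin H v) (a ∷ κ) → AvoidsClosedNeighbourhood a κ × Proper H κ
  twin-∷⁻ p = (λ u adj → p zero (suc u) adj) , (λ u u′ adj → p (suc u) (suc u′) adj)

  twin-∷⁺ : ∀ {a κ} → AvoidsClosedNeighbourhood a κ × Proper H κ → Proper (twin H v) (a ∷ κ)
  twin-∷⁺ (f , p) zero    (suc u)  adj = f u adj
  twin-∷⁺ (f , p) (suc u) zero     adj = f u adj ∘ ≡.sym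
  twin-∷⁺ (f , p) (suc u) (suc u′) adj = p u u′ adj

AvoidsFirst AvoidsLast : ∀ n → ℕ → Vec ℕ (suc n) → Set
AvoidsFirst n = AvoidsClosedNeighbourhood (path (suc n)) zero
AvoidsLast  n = AvoidsClosedNeighbourhood (path (suc n)) (fromℕ n)

avoidsFirst⁻ : ∀ {n s a c} {w : Vec ℕ n} → AvoidsFirst (suc n) s (a ∷ c ∷ w) → s ≢ a × s ≢ c
avoidsFirst⁻ f = f zero (inj₁ ≡.refl) , f (suc zero) (inj₂ (inj₂ ≡.refl))

avoidsFirst⁺ : ∀ {n s a c} {w : Vec ℕ n} → s ≢ a × s ≢ c → AvoidsFirst (suc n) s (a ∷ c ∷ w)
avoidsFirst⁺ (s≢a , s≢c) zero          _                = s≢a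
avoidsFirst⁺ (s≢a , s≢c) (suc zero)    _                = s≢c
avoidsFirst⁺ (s≢a , s≢c) (suc (suc u)) (inj₁ ())
avoidsFirst⁺ (s≢a , s≢c) (suc (suc u)) (inj₂ (inj₁ ()))
avoidsFirst⁺ (s≢a , s≢c) (suc (suc u)) (inj₂ (inj₂ ()))

avoidsLast-[]⁻ : ∀ {t c b} → AvoidsLast 1 t (c ∷ b ∷ []) → t ≢ b × t ≢ c
avoidsLast-[]⁻ f = f (suc zero) (inj₁ ≡.refl) , f zero (inj₂ (inj₁ ≡.refl))

avoidsLast-[]⁺ : ∀ {t c b} → t ≢ b × t ≢ c → AvoidsLast 1 t (c ∷ b ∷ [])
avoidsLast-[]⁺ (t≢b , t≢c) zero       _ = t≢c
avoidsLast-[]⁺ (t≢b , t≢c) (suc zero) _ = t≢b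

avoidsLast-∷⁻ : ∀ {n t a} {w : Vec ℕ (2 ℕ.+ n)} → AvoidsLast (2 ℕ.+ n) t (a ∷ w) → AvoidsLast (1 ℕ.+ n) t w
avoidsLast-∷⁻ f u adj = f (suc u) (Sum.map (≡.cong suc) (Sum.map (≡.cong suc) (≡.cong suc)) adj)

-- The path coloured by `w` has at least two vertices, so a vertex put in front of it is not
-- adjacent to the last one.
avoidsLast-∷⁺ : ∀ {n t a} {w : Vec ℕ (2 ℕ.+ n)} → AvoidsLast (1 ℕ.+ n) t w → AvoidsLast (2 ℕ.+ n) t (a ∷ w)
avoidsLast-∷⁺ f zero    (inj₁ ())
avoidsLast-∷⁺ f zero    (inj₂ (inj₁ ()))
avoidsLast-∷⁺ f zero    (inj₂ (inj₂ ()))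
avoidsLast-∷⁺ f (suc u) adj = f u (Sum.map Fin.suc-injective (Sum.map ℕ.suc-injective ℕ.suc-injective) adj)

Triangle : ℕ → ℕ → ℕ → Set
Triangle t b c = (t ≢ b × t ≢ c) × b ≢ c

triangle? : ∀ t b c → Dec (Triangle t b c)
triangle? t b c = (¬? (t ℕ.≟ b) ×-dec ¬? (t ℕ.≟ c)) ×-dec ¬? (b ℕ.≟ c)

-- A proper colouring of a path together with a colour t of a twin of its last vertex.
EndTwinned : ∀ n → ℕ → Vec ℕ (suc n) → Set
EndTwinned n t w = AvoidsLast n t w × Proper (path (suc n)) w

endTwinned? : ∀ n t w → Dec (EndTwinned n t w)
endTwinned? n t w = avoids? (path (suc n)) (fromℕ n) t w ×-dec proper? (path (suc n)) w

endTwinned-[]⁻ : ∀ {t c b} → EndTwinned 1 t (c ∷ b ∷ []) → Triangle t b c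
endTwinned-[]⁻ (f , p) = avoidsLast-[]⁻ f , proj₁ (path-∷⁻ p) ∘ ≡.sym

endTwinned-[]⁺ : ∀ {t c b} → Triangle t b c → EndTwinned 1 t (c ∷ b ∷ [])
endTwinned-[]⁺ (f , b≢c) = avoidsLast-[]⁺ f , path-∷⁺ (b≢c ∘ ≡.sym , path-1 _)

endTwinned-∷⁻ : ∀ {n t c d} {w : Vec ℕ (1 ℕ.+ n)} →
  EndTwinned (2 ℕ.+ n) t (c ∷ d ∷ w) → c ≢ d × EndTwinned (1 ℕ.+ n) t (d ∷ w)
endTwinned-∷⁻ {c = c} (f , p) = let (c≢d , q) = path-∷⁻ p in c≢d , avoidsLast-∷⁻ {a = c} f , q

endTwinned-∷⁺ : ∀ {n t c d} {w : Vec ℕ (1 ℕ.+ n)} →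
  c ≢ d × EndTwinned (1 ℕ.+ n) t (d ∷ w) → EndTwinned (2 ℕ.+ n) t (c ∷ d ∷ w)
endTwinned-∷⁺ (c≢d , f , p) = avoidsLast-∷⁺ f , path-∷⁺ (c≢d , p)

-- The colours are listed as the twin `t` of the last vertex, the twin `s` of the first, the first
-- leaf `a`, its neighbour `c`, and the rest. As the path has at least three vertices, the closed
-- neighbourhood of its last vertex lies within `c ∷ w`, so the two conditions share only `c`.
leafTwinned⁻ : ∀ {k t s a c} {w : Vec ℕ (1 ℕ.+ k)} → Proper (leafTwinnedPath (2 ℕ.+ k)) (t ∷ s ∷ a ∷ c ∷ w) →
  Triangle s a c × EndTwinned (1 ℕ.+ k) t (c ∷ w)
leafTwinned⁻ {k} {t} {s} {a} {c} {w} p =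
  let (f , q) = twin-∷⁻ (twin (path (3 ℕ.+ k)) zero) (suc (fromℕ (2 ℕ.+ k))) p
      (g , r) = twin-∷⁻ (path (3 ℕ.+ k)) zero q
      (a≢c , o) = path-∷⁻ r
  in (avoidsFirst⁻ g , a≢c) , avoidsLast-∷⁻ {a = a} (λ u adj → f (suc u) (Sum.map (≡.cong suc) (λ z → z) adj)) , o

leafTwinned⁺ : ∀ {k t s a c} {w : Vec ℕ (1 ℕ.+ k)} → Triangle s a c × EndTwinned (1 ℕ.+ k) t (c ∷ w) →
  Proper (leafTwinnedPath (2 ℕ.+ k)) (t ∷ s ∷ a ∷ c ∷ w)
leafTwinned⁺ {k} {t} {s} {a} {c} {w} ((s≢ , a≢c) , f , p) =
  twin-∷⁺ (twin (path (3 ℕ.+ k)) zero) (suc (fromℕ (2 ℕ.+ k)))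
    (far , twin-∷⁺ (path (3 ℕ.+ k)) zero (avoidsFirst⁺ s≢ , path-∷⁺ (a≢c , p)))
  where
  far : AvoidsClosedNeighbourhood (twin (path (3 ℕ.+ k)) zero) (suc (fromℕ (2 ℕ.+ k))) t (s ∷ a ∷ c ∷ w)
  -- The twin of the first vertex is adjacent only to the first two vertices of the path, and the
  -- last vertex is neither.
  far zero    (inj₁ ())
  far zero    (inj₂ (inj₁ ()))
  far zero    (inj₂ (inj₂ (inj₁ ())))
  far zero    (inj₂ (inj₂ (inj₂ ())))
  far (suc u) (inj₁ eq)  = avoidsLast-∷⁺ {a = a} f u (inj₁ (Fin.suc-injective eq))
  far (suc u) (inj₂ adj) = avoidsLast-∷⁺ {a = a} f u (inj₂ adj)

-- Generating functions of colourings in finitely many variables.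

module Colourings {c ℓ} (R : CommutativeRing c ℓ) (m : ℕ) (ξ : ℕ → CommutativeRing.Carrier R) where
  open CommutativeRing R hiding (zero)
  open WordSums R
  open Words m ξ
  open import Algebra.Properties.Semiring.Sum semiring using (sum; *-distribˡ-sum; *-distribʳ-sum; ∑-distrib-+; ∑-comm)
  open import Relation.Binary.Reasoning.Setoid setoid
  open IntegerCoefficients R using (solve; _:+_; _:*_; _:-_; :-_; _:=_)
  open FiniteVariables R using (∏[1+_z])

  elementary : ℕ → Carrier
  elementary k = weight {k} (Linked.linked? ℕ._<?_)

  elementary-product : ∀ n → elementary n ≈ ∏[1+ x z] n
  elementary-product = increasing-product x (λ k c → weight {k} λ w → Linked.linked? ℕ._<?_ (toℕ c ∷ w))
    (λ c → weight-[] (λ w → Linked.linked? ℕ._<?_ (toℕ c ∷ w)) Linked.[-])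
    (λ k c → weight-∷-∧ {k} (λ w → Linked.linked? ℕ._<?_ (toℕ c ∷ w)) (toℕ c ℕ.<?_) (λ d w → Linked.linked? ℕ._<?_ (d ∷ w))
      (λ { d w (c<d Linked.∷ l) → c<d , l }) (λ { d w (c<d , l) → c<d Linked.∷ l }))
    elementary (weight-[] (Linked.linked? ℕ._<?_) Linked.[]) (λ k → weight-∷ {k} (Linked.linked? ℕ._<?_))

  -- The sum over letters different from c is the full sum minus its term at c; this puts the
  -- recursion into the form with 1 + y_c.
  chain-step : ∀ (V V′ : Fin m → Carrier) →
    (∀ c → V′ c ≈ sum (λ d → ne (toℕ c) (toℕ d) * (x d * V d))) →
    ∀ c → V′ c + x c * V c ≈ sum (λ d → x d * V d)
  chain-step V V′ eq c = trans (+-congʳ (eq c)) (sum-ne c (λ d → x d * V d))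

  paths : ℕ → Carrier
  paths n = weight (proper? (path n))

  pathsFrom : ℕ → Fin m → Carrier
  pathsFrom n c = weight λ w → proper? (path (suc n)) (toℕ c ∷ w)

  paths-zero : paths 0 ≈ 1#
  paths-zero = weight-[] (proper? (path 0)) (λ ())

  paths-suc : ∀ n → paths (suc n) ≈ sum (λ c → x c * pathsFrom n c)
  paths-suc n = weight-∷ (proper? (path (suc n)))

  pathsFrom-zero : ∀ c → pathsFrom 0 c ≈ 1#
  pathsFrom-zero c = weight-[] (λ w → proper? (path 1) (toℕ c ∷ w)) (path-1 (toℕ c))

  pathsFrom-step : ∀ n c → pathsFrom (suc n) c + x c * pathsFrom n c ≈ sum (λ d → x d * pathsFrom n d)
  pathsFrom-step n = chain-step (pathsFrom n) (pathsFrom (suc n)) λ c →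
    weight-∷-∧ (λ w → proper? (path (2 ℕ.+ n)) (toℕ c ∷ w)) (λ d → ¬? (toℕ c ℕ.≟ d)) (λ d w → proper? (path (suc n)) (d ∷ w))
      (λ d w → path-∷⁻) (λ d w → path-∷⁺)

  tri : Fin m → Fin m → Fin m → Carrier
  tri t b c = 𝟙 (triangle? (toℕ t) (toℕ b) (toℕ c))

  trianglesAt : Fin m → Carrier
  trianglesAt c = sum λ t → x t * sum λ b → tri t b c * x b

  ends : ℕ → Fin m → Fin m → Carrier
  ends k t c = weight {1 ℕ.+ k} λ w → endTwinned? (1 ℕ.+ k) (toℕ t) (toℕ c ∷ w)

  -- The letter c is followed by k interior letters, the last leaf and its twin. The leaf and its
  -- twin act as the weight at the last interior letter, so this is an instance of `V` in `Chains`.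
  pathsToTwin : ℕ → Fin m → Carrier
  pathsToTwin k c = sum λ t → x t * ends k t c

  pathsToTwin-zero : ∀ c → pathsToTwin 0 c ≈ trianglesAt c
  pathsToTwin-zero c = sum-cong {m} λ t → *-congˡ (trans
    (weight-∷-∧ (λ w → endTwinned? 1 (toℕ t) (toℕ c ∷ w)) (λ b → triangle? (toℕ t) b (toℕ c)) (λ _ _ → yes tt)
      (λ { b [] p → endTwinned-[]⁻ p , tt }) (λ { b [] (p , _) → endTwinned-[]⁺ p }))
    (sum-cong {m} λ b → *-congˡ (trans (*-congˡ (weight-[] (λ _ → yes tt) tt)) (*-identityʳ _))))

  sum-swap-* : ∀ (a b : Fin m → Carrier) (f : Fin m → Fin m → Carrier) →
    sum (λ t → a t * sum (λ d → b d * f t d)) ≈ sum (λ d → b d * sum (λ t → a t * f t d))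
  sum-swap-* a b f = begin
    sum (λ t → a t * sum (λ d → b d * f t d))       ≈⟨ sum-cong {m} (λ t → *-distribˡ-sum {m} (a t) (λ d → b d * f t d)) ⟩
    sum (λ t → sum (λ d → a t * (b d * f t d)))     ≈⟨ ∑-comm {m} {m} (λ t d → a t * (b d * f t d)) ⟩
    sum (λ d → sum (λ t → a t * (b d * f t d)))     ≈⟨ sum-cong {m} (λ d → sum-cong {m} (λ t → swap (a t) (b d) (f t d))) ⟩
    sum (λ d → sum (λ t → b d * (a t * f t d)))     ≈⟨ sum-cong {m} (λ d → *-distribˡ-sum {m} (b d) (λ t → a t * f t d)) ⟨
    sum (λ d → b d * sum (λ t → a t * f t d))       ∎
    where
    swap : ∀ p q r → p * (q * r) ≈ q * (p * r)
    swap = solve 3 (λ p q r → p :* (q :* r) := q :* (p :* r)) refl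

  pathsToTwin-step : ∀ k c → pathsToTwin (suc k) c + x c * pathsToTwin k c ≈ sum (λ d → x d * pathsToTwin k d)
  pathsToTwin-step k = chain-step (pathsToTwin k) (pathsToTwin (suc k)) λ c → begin
    sum (λ t → x t * ends (suc k) t c)
      ≈⟨ sum-cong {m} (λ t → *-congˡ (trans (weight-∷-∧ (λ w → endTwinned? (2 ℕ.+ k) (toℕ t) (toℕ c ∷ w)) (λ d → ¬? (toℕ c ℕ.≟ d))
           (λ d w → endTwinned? (1 ℕ.+ k) (toℕ t) (d ∷ w)) (λ d w → endTwinned-∷⁻) (λ d w → endTwinned-∷⁺))
           (sum-cong {m} λ d → sym (*-assoc _ _ _)))) ⟩
    sum (λ t → x t * sum (λ d → ne (toℕ c) (toℕ d) * x d * ends k t d))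
      ≈⟨ sum-swap-* x (λ d → ne (toℕ c) (toℕ d) * x d) (ends k) ⟩
    sum (λ d → ne (toℕ c) (toℕ d) * x d * pathsToTwin k d)
      ≈⟨ sum-cong {m} (λ d → *-assoc _ _ _) ⟩
    sum (λ d → ne (toℕ c) (toℕ d) * (x d * pathsToTwin k d)) ∎

  leafTwinned : ℕ → Carrier
  leafTwinned k = weight (proper? (leafTwinnedPath (2 ℕ.+ k)))

  -- Once the colour c of the vertex next to the first leaf is fixed, the first triangle and the
  -- remaining path are independent, so the sum over all other colours factors.
  leafTwinned-sum : ∀ k → leafTwinned k ≈ sum (λ c → pathsToTwin 0 c * (x c * pathsToTwin k c))
  leafTwinned-sum k = begin
    leafTwinned k
      ≈⟨ trans (weight-∷ (proper? L)) (sum-cong {m} λ t → *-congˡ (trans (weight-∷ (λ w → proper? L (toℕ t ∷ w)))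
           (sum-cong {m} λ s → *-congˡ (trans (weight-∷ (λ w → proper? L (toℕ t ∷ toℕ s ∷ w)))
           (sum-cong {m} λ a → *-congˡ (trans (weight-∷-∧ (λ w → proper? L (toℕ t ∷ toℕ s ∷ toℕ a ∷ w))
             (λ c → triangle? (toℕ s) (toℕ a) c) (λ c w → endTwinned? (1 ℕ.+ k) (toℕ t) (c ∷ w))
             (λ c w → leafTwinned⁻) (λ c w → leafTwinned⁺))
             (sum-cong {m} λ c → trans (sym (*-assoc _ _ _)) (trans (*-congʳ (*-comm _ _)) (*-assoc _ _ _))))))))) ⟩
    sum (λ t → x t * sum (λ s → x s * sum (λ a → x a * sum (λ c → x c * (tri s a c * ends k t c)))))
      ≈⟨ sum-cong {m} (λ t → *-congˡ (sum-cong {m} (λ s → *-congˡ (sum-swap-* x x (λ a c → tri s a c * ends k t c))))) ⟩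
    sum (λ t → x t * sum (λ s → x s * sum (λ c → x c * sum (λ a → x a * (tri s a c * ends k t c)))))
      ≈⟨ sum-cong {m} (λ t → *-congˡ (sum-swap-* x x (λ s c → sum (λ a → x a * (tri s a c * ends k t c))))) ⟩
    sum (λ t → x t * sum (λ c → x c * sum (λ s → x s * sum (λ a → x a * (tri s a c * ends k t c)))))
      ≈⟨ sum-swap-* x x (λ t c → sum (λ s → x s * sum (λ a → x a * (tri s a c * ends k t c)))) ⟩
    sum (λ c → x c * sum (λ t → x t * sum (λ s → x s * sum (λ a → x a * (tri s a c * ends k t c)))))
      ≈⟨ sum-cong {m} (λ c → trans (*-congˡ (factor c)) (trans (solve 3 (λ p q r → p :* (q :* r) := q :* (p :* r)) refl _ _ _)
           (*-congʳ (sym (pathsToTwin-zero c))))) ⟩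
    sum (λ c → pathsToTwin 0 c * (x c * pathsToTwin k c)) ∎
    where
    L = leafTwinnedPath (2 ℕ.+ k)
    factor : ∀ c → sum (λ t → x t * sum (λ s → x s * sum (λ a → x a * (tri s a c * ends k t c)))) ≈ trianglesAt c * pathsToTwin k c
    factor c = begin
      sum (λ t → x t * sum (λ s → x s * sum (λ a → x a * (tri s a c * ends k t c))))
        ≈⟨ sum-cong {m} (λ t → *-congˡ (sum-cong {m} (λ s → *-congˡ (trans
             (sum-cong {m} λ a → solve 3 (λ p q r → p :* (q :* r) := q :* p :* r) refl (x a) (tri s a c) (ends k t c))
             (sym (*-distribʳ-sum {m} (ends k t c) (λ a → tri s a c * x a))))))) ⟩
      sum (λ t → x t * sum (λ s → x s * (sum (λ a → tri s a c * x a) * ends k t c)))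
        ≈⟨ sum-cong {m} (λ t → *-congˡ (trans (sum-cong {m} λ s → sym (*-assoc _ _ _))
             (sym (*-distribʳ-sum {m} (ends k t c) (λ s → x s * sum (λ a → tri s a c * x a)))))) ⟩
      sum (λ t → x t * (trianglesAt c * ends k t c))
        ≈⟨ sum-cong {m} (λ t → solve 3 (λ p q r → p :* (q :* r) := q :* (p :* r)) refl (x t) (trianglesAt c) (ends k t c)) ⟩
      sum (λ t → trianglesAt c * (x t * ends k t c))
        ≈⟨ *-distribˡ-sum {m} (trianglesAt c) (λ t → x t * ends k t c) ⟨
      trianglesAt c * pathsToTwin k c ∎

  -- Ordered pairs of distinct colours other than c count each monomial of ê₂(c) twice. Inclusion
  -- and exclusion over the coincidences expresses this through e₁, e₂ and x_c.
  trianglesAt-value : ∀ e₁ e₂ → sum x ≈ e₁ → sum (λ t → x t * (e₁ - x t)) ≈ e₂ + e₂ →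
    ∀ c → let ê₂ = e₂ - x c * e₁ + x c * x c in trianglesAt c ≈ ê₂ + ê₂
  trianglesAt-value e₁ e₂ sum-x sum-x² c = begin
    sum (λ t → x t * sum (λ b → tri t b c * x b))
      ≈⟨ sum-cong {m} (λ t → *-congˡ (inner t)) ⟩
    -- The inner `ν t` prevents x_t from being subtracted twice when t = c; it is absorbed by the
    -- outer one because an indicator is idempotent.
    sum (λ t → x t * (ν t * (e₁ - x c - ν t * x t)))
      ≈⟨ sum-cong {m} (λ t → trans (solve 4 (λ x n e d → x :* (n :* (e :- d :- n :* x)) := n :* x :* (e :- d) :- n :* n :* (x :* x)) refl (x t) (ν t) e₁ (x c))
           (trans (+-congˡ (-‿cong (*-congʳ (𝟙-idempotent (¬? (toℕ t ℕ.≟ toℕ c))))))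
           (trans (solve 4 (λ x n e d → n :* x :* (e :- d) :- n :* (x :* x) := n :* (x :* (e :- x) :+ :- d :* x)) refl (x t) (ν t) e₁ (x c))
           (*-congʳ (ne-sym (toℕ t) (toℕ c)))))) ⟩
    sum (λ t → ne (toℕ c) (toℕ t) * (x t * (e₁ - x t) + - x c * x t))
      ≈⟨ sum-ne-sub c (λ t → x t * (e₁ - x t) + - x c * x t) ⟩
    sum (λ t → x t * (e₁ - x t) + - x c * x t) - (x c * (e₁ - x c) + - x c * x c)
      ≈⟨ +-congʳ (trans (∑-distrib-+ {m} (λ t → x t * (e₁ - x t)) (λ t → - x c * x t))
           (+-cong sum-x² (trans (sym (*-distribˡ-sum {m} (- x c) x)) (*-congˡ sum-x)))) ⟩
    (e₂ + e₂ + - x c * e₁) - (x c * (e₁ - x c) + - x c * x c)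
      ≈⟨ solve 3 (λ p q d → (q :+ q :+ :- d :* p) :- (d :* (p :- d) :+ :- d :* d) :=
           (q :- d :* p :+ d :* d) :+ (q :- d :* p :+ d :* d)) refl e₁ e₂ (x c) ⟩
    (e₂ - x c * e₁ + x c * x c) + (e₂ - x c * e₁ + x c * x c) ∎
    where
    ν : Fin m → Carrier
    ν t = ne (toℕ t) (toℕ c)
    inner : ∀ t → sum (λ b → tri t b c * x b) ≈ ν t * (e₁ - x c - ν t * x t)
    inner t = begin
      sum (λ b → tri t b c * x b)
        ≈⟨ sum-cong {m} (λ b → trans (*-congʳ (trans (𝟙-× (¬? (toℕ t ℕ.≟ toℕ b) ×-dec ¬? (toℕ t ℕ.≟ toℕ c)) (¬? (toℕ b ℕ.≟ toℕ c)))
             (*-congʳ (𝟙-× (¬? (toℕ t ℕ.≟ toℕ b)) (¬? (toℕ t ℕ.≟ toℕ c))))))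
             (solve 4 (λ p q r s → p :* q :* r :* s := q :* (p :* (r :* s))) refl (ne (toℕ t) (toℕ b)) (ν t) (ν b) (x b))) ⟩
      sum (λ b → ν t * (ne (toℕ t) (toℕ b) * (ν b * x b)))
        ≈⟨ *-distribˡ-sum {m} (ν t) (λ b → ne (toℕ t) (toℕ b) * (ν b * x b)) ⟨
      ν t * sum (λ b → ne (toℕ t) (toℕ b) * (ν b * x b))
        ≈⟨ *-congˡ (sum-ne-sub t (λ b → ν b * x b)) ⟩
      ν t * (sum (λ b → ν b * x b) - ν t * x t)
        ≈⟨ *-congˡ (+-congʳ (trans (sum-cong {m} λ b → *-congʳ (ne-sym (toℕ b) (toℕ c))) (trans (sum-ne-sub c x) (+-congʳ sum-x)))) ⟩
      ν t * (e₁ - x c - ν t * x t) ∎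

-- Elementary expansions

module Positivity (F : CommutativeRing 0ℓ 0ℓ) (_•_ : ℚ → CommutativeRing.Carrier F → CommutativeRing.Carrier F)
  (•-cong : ∀ c {f g} → CommutativeRing._≈_ F f g → CommutativeRing._≈_ F (c • f) (c • g))
  (•-* : ∀ c f g → CommutativeRing._≈_ F (CommutativeRing._*_ F (c • f) g) (c • CommutativeRing._*_ F f g))
  (•-assoc : ∀ c d f → CommutativeRing._≈_ F ((c ℚ.* d) • f) (c • (d • f)))
  (•-distrib : ∀ c d f → CommutativeRing._≈_ F ((c ℚ.+ d) • f) (CommutativeRing._+_ F (c • f) (d • f)))
  (•-identity : ∀ f → CommutativeRing._≈_ F (1ℚ • f) f)
  (e : ℕ → CommutativeRing.Carrier F) where
  private module FR = CommutativeRing F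
  open Defs.PowerSeries FR.rawRing using (Series; _z^_; ∑≥)
  private module S = RawRing (Defs.PowerSeries.rawRing FR.rawRing)
  open import Algebra.Properties.Semiring.Mult FR.semiring using () renaming (_×_ to _·_)
  open import Relation.Binary.Reasoning.Setoid FR.setoid
  open import Algebra.Properties.CommutativeSemigroup FR.*-commutativeSemigroup using (x∙yz≈y∙xz)
  open import Algebra.Properties.CommutativeSemigroup FR.+-commutativeSemigroup using () renaming (x∙yz≈y∙xz to x+yz≈y+xz)

  •-*-• : ∀ c d f g → (c • f) FR.* (d • g) FR.≈ (c ℚ.* d) • (f FR.* g)
  •-*-• c d f g = begin
    (c • f) FR.* (d • g)      ≈⟨ •-* c f (d • g) ⟩
    c • (f FR.* (d • g))      ≈⟨ •-cong c (FR.trans (FR.*-comm f (d • g)) (FR.trans (•-* d g f) (•-cong d (FR.*-comm g f)))) ⟩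
    c • (d • (f FR.* g))      ≈⟨ FR.sym (•-assoc c d (f FR.* g)) ⟩
    (c ℚ.* d) • (f FR.* g)    ∎

  e[_] : List ℕ → FR.Carrier
  e[_] = foldr (λ i f → e i FR.* f) FR.1#

  Term : Set
  Term = List ℕ × ℚ

  combination : List Term → FR.Carrier
  combination = foldr (λ (λs , c) g → c • e[ λs ] FR.+ g) FR.0#

  e[]-++ : ∀ λs μs → e[ λs ++ μs ] FR.≈ e[ λs ] FR.* e[ μs ]
  e[]-++ []       μs = FR.sym (FR.*-identityˡ e[ μs ])
  e[]-++ (i ∷ λs) μs = FR.trans (FR.*-congˡ {e i} (e[]-++ λs μs)) (FR.sym (FR.*-assoc (e i) e[ λs ] e[ μs ]))

  e[]-↭ : ∀ {λs μs} → λs Perm.↭ μs → e[ λs ] FR.≈ e[ μs ]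
  e[]-↭ Perm.refl         = FR.refl
  e[]-↭ (Perm.prep i p)   = FR.*-congˡ {e i} (e[]-↭ p)
  e[]-↭ (Perm.swap {_} {μs} i j p) = FR.trans (FR.*-congˡ {e i} (FR.*-congˡ {e j} (e[]-↭ p))) (x∙yz≈y∙xz (e i) (e j) e[ μs ])
  e[]-↭ (Perm.trans p q)  = FR.trans (e[]-↭ p) (e[]-↭ q)

  combination-++ : ∀ s t → combination (s ++ t) FR.≈ combination s FR.+ combination t
  combination-++ []             t = FR.sym (FR.+-identityˡ (combination t))
  combination-++ ((λs , c) ∷ s) t = FR.trans (FR.+-congˡ {c • e[ λs ]} (combination-++ s t))
    (FR.sym (FR.+-assoc (c • e[ λs ]) (combination s) (combination t)))

  -- The concatenated index is in general unsorted; `Positive` tolerates this, and sorting is left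
  -- to `normalise`.
  multiplyTerm : Term → List Term → List Term
  multiplyTerm (λs , c) = map λ (μs , d) → λs ++ μs , c ℚ.* d

  multiplyTerm-correct : ∀ λs c t → combination (multiplyTerm (λs , c) t) FR.≈ (c • e[ λs ]) FR.* combination t
  multiplyTerm-correct λs c []             = FR.sym (FR.zeroʳ (c • e[ λs ]))
  multiplyTerm-correct λs c ((μs , d) ∷ t) = begin
    (c ℚ.* d) • e[ λs ++ μs ] FR.+ combination (multiplyTerm (λs , c) t)
      ≈⟨ FR.+-cong (FR.trans (•-cong (c ℚ.* d) (e[]-++ λs μs)) (FR.sym (•-*-• c d e[ λs ] e[ μs ]))) (multiplyTerm-correct λs c t) ⟩
    (c • e[ λs ]) FR.* (d • e[ μs ]) FR.+ (c • e[ λs ]) FR.* combination t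
      ≈⟨ FR.distribˡ (c • e[ λs ]) (d • e[ μs ]) (combination t) ⟨
    (c • e[ λs ]) FR.* (d • e[ μs ] FR.+ combination t) ∎

  multiply : List Term → List Term → List Term
  multiply []      t = []
  multiply (a ∷ s) t = multiplyTerm a t ++ multiply s t

  multiply-correct : ∀ s t → combination (multiply s t) FR.≈ combination s FR.* combination t
  multiply-correct []             t = FR.sym (FR.zeroˡ (combination t))
  multiply-correct ((λs , c) ∷ s) t = begin
    combination (multiplyTerm (λs , c) t ++ multiply s t)
      ≈⟨ combination-++ (multiplyTerm (λs , c) t) (multiply s t) ⟩
    combination (multiplyTerm (λs , c) t) FR.+ combination (multiply s t)
      ≈⟨ FR.+-cong (multiplyTerm-correct λs c t) (multiply-correct s t) ⟩
    (c • e[ λs ]) FR.* combination t FR.+ combination s FR.* combination t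
      ≈⟨ FR.distribʳ (combination t) (c • e[ λs ]) (combination s) ⟨
    (c • e[ λs ] FR.+ combination s) FR.* combination t ∎

  PositiveTerm : Term → Set
  PositiveTerm (λs , c) = All (0 ℕ.<_) λs × 0ℚ ℚ.≤ c

  multiply-positive : ∀ {s t} → All PositiveTerm s → All PositiveTerm t → All PositiveTerm (multiply s t)
  multiply-positive []              ts = []
  multiply-positive ((p , 0≤c) ∷ s) ts = ++⁺ (map⁺ (All.map (λ (q , 0≤d) → ++⁺ p q , *-nonneg 0≤c 0≤d) ts)) (multiply-positive s ts)
    where
    *-nonneg : ∀ {c d} → 0ℚ ℚ.≤ c → 0ℚ ℚ.≤ d → 0ℚ ℚ.≤ c ℚ.* d
    *-nonneg {c} {d} 0≤c 0≤d = ℚ.nonNegative⁻¹ (c ℚ.* d) {{ℚ.nonNeg*nonNeg⇒nonNeg c {{ℚ.nonNegative 0≤c}} d {{ℚ.nonNegative 0≤d}}}}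

  -- Unlike in EPositive, the terms need be neither sorted nor distinct.
  Positive : FR.Carrier → Set
  Positive f = Σ (List Term) λ t → All PositiveTerm t × f FR.≈ combination t

  positive-resp : ∀ {f g} → f FR.≈ g → Positive g → Positive f
  positive-resp f≈g (t , p , eq) = t , p , FR.trans f≈g eq

  positive-0 : Positive FR.0#
  positive-0 = [] , [] , FR.refl

  positive-1 : Positive FR.1#
  positive-1 = ([] , 1ℚ) ∷ [] , ([] , ℚ.nonNegative⁻¹ 1ℚ) ∷ [] ,
    FR.sym (FR.trans (FR.+-identityʳ _) (•-identity FR.1#))

  positive-e : ∀ i → Positive (e (suc i))
  positive-e i = (suc i ∷ [] , 1ℚ) ∷ [] , (ℕ.z<s ∷ [] , ℚ.nonNegative⁻¹ 1ℚ) ∷ [] ,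
    FR.sym (FR.trans (FR.+-identityʳ _) (FR.trans (•-identity _) (FR.*-identityʳ _)))

  positive-+ : ∀ {f g} → Positive f → Positive g → Positive (f FR.+ g)
  positive-+ (s , p , eq) (t , q , eq′) = s ++ t , ++⁺ p q , FR.trans (FR.+-cong eq eq′) (FR.sym (combination-++ s t))

  positive-* : ∀ {f g} → Positive f → Positive g → Positive (f FR.* g)
  positive-* {f} {g} (s , p , eq) (t , q , eq′) = multiply s t , multiply-positive p q ,
    FR.trans (FR.*-cong {f} {combination s} {g} {combination t} eq eq′) (FR.sym (multiply-correct s t))

  positive-· : ∀ n {f} → Positive f → Positive (n · f)
  positive-· zero    p = positive-0
  positive-· (suc n) p = positive-+ p (positive-· n p)

  insert : Term → List Term → List Term
  insert a []            = a ∷ []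
  insert (λs , c) ((μs , d) ∷ t) with ≡-dec ℕ._≟_ λs μs
  ... | yes _ = (μs , c ℚ.+ d) ∷ t
  ... | no  _ = (μs , d) ∷ insert (λs , c) t

  insert-correct : ∀ λs c t → combination (insert (λs , c) t) FR.≈ c • e[ λs ] FR.+ combination t
  insert-correct λs c []             = FR.refl
  insert-correct λs c ((μs , d) ∷ t) with ≡-dec ℕ._≟_ λs μs
  ... | yes ≡.refl = FR.trans (FR.+-congʳ (•-distrib c d e[ μs ])) (FR.+-assoc _ _ _)
  ... | no  _      = FR.trans (FR.+-congˡ {d • e[ μs ]} (insert-correct λs c t)) (x+yz≈y+xz (d • e[ μs ]) (c • e[ λs ]) (combination t))

  insert-All : ∀ {P : List ℕ → Set} λs c t → P λs → All (P ∘ proj₁) t → All (P ∘ proj₁) (insert (λs , c) t)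
  insert-All λs c []             p []       = p ∷ []
  insert-All λs c ((μs , d) ∷ t) p (q ∷ qs) with ≡-dec ℕ._≟_ λs μs
  ... | yes _ = q ∷ qs
  ... | no  _ = q ∷ insert-All λs c t p qs

  insert-nonneg : ∀ λs c t → 0ℚ ℚ.≤ c → All (λ (_ , d) → 0ℚ ℚ.≤ d) t → All (λ (_ , d) → 0ℚ ℚ.≤ d) (insert (λs , c) t)
  insert-nonneg λs c []             p []       = p ∷ []
  insert-nonneg λs c ((μs , d) ∷ t) p (q ∷ qs) with ≡-dec ℕ._≟_ λs μs
  ... | yes _ = ℚ.+-mono-≤ p q ∷ qs
  ... | no  _ = q ∷ insert-nonneg λs c t p qs

  insert-fresh : ∀ {νs} λs c t → νs ≢ λs → All (νs ≢_) (map proj₁ t) → All (νs ≢_) (map proj₁ (insert (λs , c) t))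
  insert-fresh λs c []             p []       = p ∷ []
  insert-fresh λs c ((μs , d) ∷ t) p (q ∷ qs) with ≡-dec ℕ._≟_ λs μs
  ... | yes _ = q ∷ qs
  ... | no  _ = q ∷ insert-fresh λs c t p qs

  insert-unique : ∀ λs c t → Unique (map proj₁ t) → Unique (map proj₁ (insert (λs , c) t))
  insert-unique λs c []             []       = [] ∷ []
  insert-unique λs c ((μs , d) ∷ t) (q ∷ qs) with ≡-dec ℕ._≟_ λs μs
  ... | yes _     = q ∷ qs
  ... | no  λs≢μs = insert-fresh λs c t (λs≢μs ∘ ≡.sym) q ∷ insert-unique λs c t qs

  Normal : List Term → Set
  Normal t = All (IsPartition ∘ proj₁) t × Unique (map proj₁ t) × All (λ (_ , c) → 0ℚ ℚ.≤ c) t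

  -- Sorting an index does not change its product of elementary functions, and `insert` merges equal
  -- indices by adding nonnegative coefficients. The sort uses the reversed order, since partitions
  -- are weakly decreasing.
  normalise : ∀ {t} → All PositiveTerm t → Σ (List Term) λ s → Normal s × combination t FR.≈ combination s
  normalise []                               = [] , ([] , [] , []) , FR.refl
  normalise {(λs , c) ∷ t} ((0<λs , 0≤c) ∷ p) with normalise p
  ... | s , (partitions , distinct , 0≤) , eq = insert (μs , c) s ,
    ( insert-All {IsPartition} μs c s (sort-↗ λs , All-resp-↭ (Perm.↭-sym (sort-↭ λs)) 0<λs) partitions
    , insert-unique μs c s distinct
    , insert-nonneg μs c s 0≤c 0≤) , (begin
    c • e[ λs ] FR.+ combination t   ≈⟨ FR.+-cong (•-cong c (e[]-↭ (Perm.↭-sym (sort-↭ λs)))) eq ⟩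
    c • e[ μs ] FR.+ combination s   ≈⟨ insert-correct μs c s ⟨
    combination (insert (μs , c) s)  ∎)
    where μs = sort λs

  PositiveSeries : Series → Set
  PositiveSeries a = ∀ n → Positive (a n)

  positive-z^ : ∀ {p} k → Positive p → PositiveSeries (p z^ k)
  positive-z^ k p n with n ≡ᵇ k
  ... | true  = p
  ... | false = positive-0

  positive-∑≥ : ∀ k {a} → (∀ i → Positive (a (suc i))) → PositiveSeries (∑≥ (suc k) a)
  positive-∑≥ k p zero    = positive-0
  positive-∑≥ k p (suc n) with suc k ≤ᵇ suc n
  ... | true  = p n
  ... | false = positive-0

  -- Positivity of `b` is demanded only up to n, which lets the lemma be used on a series whose
  -- later coefficients are still to be treated.
  positive-convolution : ∀ n {a b} → PositiveSeries a → (∀ i → i ℕ.≤ n → Positive (b i)) → Positive ((a S.* b) n)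
  positive-convolution zero    p q = positive-+ (positive-* (p 0) (q 0 ℕ.z≤n)) positive-0
  positive-convolution (suc n) p q = positive-+ (positive-* (p 0) (q (suc n) ℕ.≤-refl))
    (positive-convolution n (p ∘ suc) (λ i i≤n → q i (ℕ.m≤n⇒m≤1+n i≤n)))

  -- 1/(1 - g) = 1 + g/(1 - g), and g has no constant term.
  positive-geometric : ∀ {g r} → PositiveSeries g → g 0 FR.≈ FR.0# → r S.≈ S.1# S.+ g S.* r → PositiveSeries r
  positive-geometric {g} {r} g-positive g₀≈0 r-eq n = upTo n n ℕ.≤-refl
    where
    constant : ∀ n → Positive ((g S.* r) n) → Positive (r n)
    constant n p = positive-resp (r-eq n) (positive-+ (positive-z^ 0 positive-1 n) p)
    g₀* : ∀ f → g 0 FR.* f FR.≈ FR.0#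
    g₀* f = FR.trans (FR.*-congʳ {f} {g 0} {FR.0#} g₀≈0) (FR.zeroˡ f)
    upTo : ∀ n k → k ℕ.≤ n → Positive (r k)
    upTo n       zero    _         = constant 0 (positive-+ (positive-resp (g₀* (r 0)) positive-0) positive-0)
    upTo (suc n) (suc k) (ℕ.s≤s k≤n) = constant (suc k) (positive-+ (positive-resp (g₀* (r (suc k))) positive-0)
      (positive-convolution k (g-positive ∘ suc) (λ i i≤k → upTo n i (ℕ.≤-trans i≤k k≤n))))

-- From finitely many variables back to symmetric functions.

open import Defs

private module FR = CommutativeRing FPS-commutativeRing

•-cong : ∀ c {f g} → f FR.≈ g → c • f FR.≈ c • g
•-cong c eq α = ≡.cong (c ℚ.*_) (eq α)

•-* : ∀ c f g → (c • f) FR.* g FR.≈ c • (f FR.* g)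
•-* c f g α = scale (splits α)
  where
  scale : ∀ l → sumℚ (map (λ (β , γ) → c ℚ.* coeff f β ℚ.* coeff g γ) l) ≡ c ℚ.* sumℚ (map (λ (β , γ) → coeff f β ℚ.* coeff g γ) l)
  scale []            = ≡.sym (ℚ.*-zeroʳ c)
  scale ((β , γ) ∷ l) = ≡.trans (≡.cong₂ ℚ._+_ (ℚ.*-assoc c (coeff f β) (coeff g γ)) (scale l)) (≡.sym (ℚ.*-distribˡ-+ c _ _))


open Positivity FPS-commutativeRing _•_ (λ c {f} {g} → •-cong c {f} {g}) •-*
  (λ c d f α → ℚ.*-assoc c d (coeff f α)) (λ c d f α → ℚ.*-distribʳ-+ (coeff f α) c d) (λ f α → ℚ.*-identityˡ (coeff f α)) e

epositive-resp : ∀ {f g} → f FR.≈ g → EPositive g → EPositive f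
epositive-resp f≈g (E , 0≤) = record
  { Defs.ElementaryExpansion E hiding (expansion)
  ; expansion = λ α → ≡.trans (f≈g α) (Defs.ElementaryExpansion.expansion E α) } , 0≤

positive⇒epositive : ∀ {f} → Positive f → EPositive f
positive⇒epositive (t , p , eq) with normalise p
... | s , (partitions , distinct , 0≤) , eq′ = record
  { terms = s ; partitions = partitions ; distinct = distinct ; expansion = λ α → ≡.trans (eq α) (eq′ α) } , 0≤

H≥3 pathExpression expansion : Series
H≥3 = ∑≥ 3 λ i → (i ∸ 2) •ℕ e i
pathExpression = 𝒳P * (G≥ 3 * G≥ 3) + K≥ 5 + G≥ 3 * ∑≥ 3 e + (e 1 z^ 1) * G≥ 4 + (e 2 z^ 2) * H≥3
expansion = (K + (e 1 z^ 1) * G) * ((G≥ 3 * G≥ 3) * recip D) + (e 1 z^ 1) * (G≥ 3 * G≥ 3)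
  + (G≥ 3 * K≥ 3 + (e 1 z^ 1) * G≥ 4 + (e 2 z^ 2) * H≥3) + K≥ 5

D₀≈1 : ∀ α → coeff (D 0) α ≡ unitCoeff α
D₀≈1 α = ℚ.+-identityʳ (unitCoeff α)

D-recip : D * recip D ≈ 1#
D-recip = *-recip (CommutativeRing.ring FPS-commutativeRing) D D₀≈1

module Truncated (m : ℕ) where
  private module R = CommutativeRing (truncatedRing m)
  open import Algebra.Properties.Semiring.Sum R.semiring using (sum)
  open import Algebra.Properties.Semiring.Mult R.semiring using () renaming (_×_ to _·_)
  open WordSums (truncatedRing m) using (𝟙; module Words)
  open Words m x using (wordsum; monomial; weight) renaming (x to xₘ)
  open Colourings (truncatedRing m) m x
  private module S = CommutativeRing (SeriesRing.commutativeRing (truncatedRing m))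

  words-wordsum : ∀ n {f : Vec ℕ n → ℚ} {F : Vec ℕ n → FPS} α → (∀ w → f w ≡ coeff (F w) α) →
    sumℚ (map f (words n m)) ≡ coeff (wordsum n F) α
  words-wordsum zero    α eq = ≡.trans (ℚ.+-identityʳ _) (eq [])
  words-wordsum (suc n) {f} {F} α eq = go (λ i → i) m
    where
    -- The letters are enumerated by an arbitrary `a`, since removing the first letter of `upTo`
    -- shifts the enumeration.
    go : ∀ a k → sumℚ (map f (cartesianProductWith _∷_ (applyUpTo a k) (words n m))) ≡
                 coeff (sum {k} λ c → wordsum n λ w → F (a (toℕ c) ∷ w)) α
    go a zero    = ≡.refl
    go a (suc k) = ≡.trans (sum-words-suc n m (a 0) f (applyUpTo (a ∘ suc) k))
      (≡.cong₂ ℚ._+_ (words-wordsum n α (λ w → eq (a 0 ∷ w))) (go (a ∘ suc) k))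

  monomial≡∏x : ∀ {n} (w : Vec ℕ n) → monomial w ≡ ∏x w
  monomial≡∏x []      = ≡.refl
  monomial≡∏x (i ∷ w) = ≡.cong (x i FPS-Ring.*_) (monomial≡∏x w)

  -- The coefficient of `wordSum` at α ranges over letters below `length α`, so for lists of length
  -- m the infinite sum is the finite one.
  wordSum≈weight : ∀ {n} {P : Pred (Vec ℕ n) 0ℓ} (P? : Decidable P) → wordSum P? R.≈ weight P?
  wordSum≈weight {n} P? α ≡.refl = ≡.trans
    (sumℚ-filter P? (λ w → coeff (∏x w) α) (words n m))
    (words-wordsum n α pointwise)
    where
    pointwise : ∀ w → (if does (P? w) then coeff (∏x w) α else 0ℚ) ≡ coeff (𝟙 (P? w) R.* monomial w) α
    pointwise w rewrite monomial≡∏x w with does (P? w)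
    ... | true  = ≡.sym (R.*-identityˡ (∏x w) α ≡.refl)
    ... | false = ≡.sym (R.zeroˡ (∏x w) α ≡.refl)

  private module C = Chains (truncatedRing m) xₘ

  e≈∏ : e S.≈ FiniteVariables.∏[1+_z] (truncatedRing m) xₘ
  e≈∏ k = R.trans {e k} {elementary k} {FiniteVariables.∏[1+_z] (truncatedRing m) xₘ k} (wordSum≈weight {k} _) (elementary-product k)

  -- The two multiplications by a natural number come from differently built structures, although
  -- both are repeated addition.
  •ℕ≡· : ∀ n f → n •ℕ f ≡ n · f
  •ℕ≡· zero    f = ≡.refl
  •ℕ≡· (suc n) f = ≡.cong (f R.+_) (•ℕ≡· n f)

  multiples : ∀ k (a : ℕ → ℕ) → ∑≥ k (λ i → a i · e i) S.≈ ∑≥ k (λ i → a i •ℕ e i)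
  multiples k a n α _ with k ≤ᵇ n
  ... | true  = ≡.cong (λ f → coeff f α) (≡.sym (•ℕ≡· (a n) (e n)))
  ... | false = ≡.refl

  D≈ : C.D e e≈∏ S.≈ D
  D≈ = S.+-congˡ {S.1#} {S.- C.G≥ e e≈∏ 2} {S.- G} (S.-‿cong {C.G≥ e e≈∏ 2} {G} (multiples 2 (_∸ 1)))

  D-inverse : C.D e e≈∏ S.* recip D S.≈ S.1#
  D-inverse = S.trans {C.D e e≈∏ S.* recip D} {D S.* recip D} {S.1#} (S.*-congʳ {recip D} {C.D e e≈∏} {D} D≈) (λ n α _ → D-recip n α)

  D*𝒳P : C.D e e≈∏ S.* 𝒳P S.≈ e
  D*𝒳P = C.D*P e e≈∏ 𝒳P pathsFrom pathsFrom-zero pathsFrom-step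
    (R.trans {𝒳P 0} {paths 0} {R.1#} (wordSum≈weight (proper? (path 0))) paths-zero)
    (λ n → R.trans {𝒳P (suc n)} {paths (suc n)} {sum (λ c → xₘ c R.* pathsFrom n c)} (wordSum≈weight (proper? (path (suc n)))) (paths-suc n))

  leafTwinned≈ : leafTwinnedSeries S.≈ let p = C.pathExpression e e≈∏ 𝒳P in (p S.+ p) S.+ (p S.+ p)
  leafTwinned≈ = C.leaf e e≈∏ leafTwinnedSeries pathsToTwin
    (λ c → R.trans {pathsToTwin 0 c} {trianglesAt c} {C.ê₂ e e≈∏ c R.+ C.ê₂ e e≈∏ c} (pathsToTwin-zero c)
      (trianglesAt-value (e 1) (e 2) (C.sum-x e e≈∏) (C.sum-xê₁ e e≈∏) c))
    pathsToTwin-step low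
    (λ k → R.trans {X (leafTwinnedPath (2 ℕ.+ k))} {leafTwinned k} {sum (λ c → pathsToTwin 0 c R.* (xₘ c R.* pathsToTwin k c))}
      (wordSum≈weight (proper? (leafTwinnedPath (2 ℕ.+ k)))) (leafTwinned-sum k))
    {recip D} {𝒳P} D-inverse D*𝒳P
    where
    low : ∀ n → n ℕ.< 5 → leafTwinnedSeries n R.≈ R.0#
    low 0 _ _ _ = ≡.refl
    low 1 _ _ _ = ≡.refl
    low 2 _ _ _ = ≡.refl
    low 3 _ _ _ = ≡.refl
    low 4 _ _ _ = ≡.refl
    low (suc (suc (suc (suc (suc n))))) (ℕ.s≤s (ℕ.s≤s (ℕ.s≤s (ℕ.s≤s (ℕ.s≤s ())))))

  private
    module T = Transfer (SeriesRing.commutativeRing (truncatedRing m))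
    G≈ : ∀ k → C.G≥ e e≈∏ k S.≈ G≥ k
    G≈ k = multiples k (_∸ 1)
    K≈ : ∀ k → C.K≥ e e≈∏ k S.≈ K≥ k
    K≈ k = multiples k (λ i → i)
    H≈ : C.H≥3 e e≈∏ S.≈ H≥3
    H≈ = multiples 3 (_∸ 2)

  pathExpression≈ : C.pathExpression e e≈∏ 𝒳P S.≈ pathExpression
  pathExpression≈ = T.pathExpression-cong {𝒳P} {∑≥ 3 e} {e 1 z^ 1} {e 2 z^ 2}
    {C.G≥ e e≈∏ 3} {G≥ 3} {C.G≥ e e≈∏ 4} {G≥ 4} {C.K≥ e e≈∏ 5} {K≥ 5} {C.H≥3 e e≈∏} {H≥3} (G≈ 3) (G≈ 4) (K≈ 5) H≈

  expansion≈ : C.expansion e e≈∏ (recip D) S.≈ expansion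
  expansion≈ = T.expansion-cong {recip D} {e 1 z^ 1} {e 2 z^ 2} {C.G≥ e e≈∏ 2} {G} {C.K≥ e e≈∏ 2} {K} {C.K≥ e e≈∏ 3} {K≥ 3}
    {C.G≥ e e≈∏ 3} {G≥ 3} {C.G≥ e e≈∏ 4} {G≥ 4} {C.K≥ e e≈∏ 5} {K≥ 5} {C.H≥3 e e≈∏} {H≥3}
    (G≈ 2) (K≈ 2) (K≈ 3) (G≈ 3) (G≈ 4) (K≈ 5) H≈

  pathExpression≈expansion : pathExpression S.≈ expansion
  pathExpression≈expansion n α l = ≡.trans (≡.sym (pathExpression≈ n α l)) (≡.trans
    (C.pathExpression≈expansion e e≈∏ {recip D} {𝒳P} D-inverse D*𝒳P n α l) (expansion≈ n α l))

  leafTwinned≈4pathExpression : leafTwinnedSeries S.≈ (pathExpression S.+ pathExpression) S.+ (pathExpression S.+ pathExpression)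
  leafTwinned≈4pathExpression n α l = ≡.trans (leafTwinned≈ n α l) (≡.cong (λ q → (q ℚ.+ q) ℚ.+ (q ℚ.+ q)) (pathExpression≈ n α l))

-- After regrouping, the sum of four copies of `¼` evaluates to `1ℚ`.
quarter-of-four : ∀ q → ¼ ℚ.* ((q ℚ.+ q) ℚ.+ (q ℚ.+ q)) ≡ q
quarter-of-four q = ≡.trans
  (solve 2 (λ c q → c :* ((q :+ q) :+ (q :+ q)) := ((c :+ c) :+ (c :+ c)) :* q) ≡.refl ¼ q) (ℚ.*-identityˡ q)
  where open IntegerCoefficients ℚ.+-*-commutativeRing

-- Each coefficient α is compared in the truncation with exactly `length α` variables.
series≈pathExpression : ¼ •ᶻ leafTwinnedSeries ≈ pathExpression
series≈pathExpression n α = ≡.trans (≡.cong (¼ ℚ.*_) (Truncated.leafTwinned≈4pathExpression (length α) n α ≡.refl))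
  (quarter-of-four (coeff (pathExpression n) α))

expressions≈ : pathExpression ≈ expansion
expressions≈ n α = Truncated.pathExpression≈expansion (length α) n α ≡.refl

positive-multiples : ∀ k (a : ℕ → ℕ) → PositiveSeries (∑≥ (suc k) λ i → a i •ℕ e i)
positive-multiples k a = positive-∑≥ k {λ i → a i •ℕ e i} (λ i → positive-· (a (suc i)) (positive-e i))

positive-recip-D : PositiveSeries (recip D)
positive-recip-D = positive-geometric {G} {recip D} (positive-multiples 1 (_∸ 1)) (λ _ → ≡.refl)
  (Transfer.geometric (SeriesRing.commutativeRing FPS-commutativeRing) {G} {recip D} D-recip)

infixl 6 _⊕_
_⊕_ : ∀ {a b} → PositiveSeries a → PositiveSeries b → PositiveSeries (a + b)
_⊕_ {a} {b} p q n = positive-+ {a n} {b n} (p n) (q n)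

infixl 7 _⊗_
_⊗_ : ∀ {a b} → PositiveSeries a → PositiveSeries b → PositiveSeries (a * b)
_⊗_ {a} {b} p q n = positive-convolution n {a} {b} p (λ i _ → q i)

positive-expansion : PositiveSeries expansion
positive-expansion =
  _⊕_ {A + B + C} {K≥ 5} (_⊕_ {A + B} {C} (_⊕_ {A} {B}
    (_⊗_ {K + e₁ * G} {G₃² * recip D} (_⊕_ {K} {e₁ * G} K⁺ (_⊗_ {e₁} {G} e₁⁺ G⁺)) (_⊗_ {G₃²} {recip D} G₃²⁺ positive-recip-D))
    (_⊗_ {e₁} {G₃²} e₁⁺ G₃²⁺))
    (_⊕_ {G≥ 3 * K≥ 3 + e₁ * G≥ 4} {e₂ * H≥3} (_⊕_ {G≥ 3 * K≥ 3} {e₁ * G≥ 4}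
      (_⊗_ {G≥ 3} {K≥ 3} G₃⁺ (positive-multiples 2 (λ i → i))) (_⊗_ {e₁} {G≥ 4} e₁⁺ (positive-multiples 3 (_∸ 1))))
      (_⊗_ {e₂} {H≥3} (positive-z^ 2 (positive-e 1)) (positive-multiples 2 (_∸ 2)))))
    (positive-multiples 4 (λ i → i))
  where
  e₁ e₂ G₃² A B C : Series
  e₁  = e 1 z^ 1
  e₂  = e 2 z^ 2
  G₃² = G≥ 3 * G≥ 3
  A   = (K + e₁ * G) * (G₃² * recip D)
  B   = e₁ * G₃²
  C   = G≥ 3 * K≥ 3 + e₁ * G≥ 4 + e₂ * H≥3
  e₁⁺ : PositiveSeries e₁
  e₁⁺ = positive-z^ 1 (positive-e 0)
  K⁺ : PositiveSeries K
  K⁺ = positive-multiples 1 (λ i → i)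
  G⁺ : PositiveSeries G
  G⁺ = positive-multiples 1 (_∸ 1)
  G₃⁺ : PositiveSeries (G≥ 3)
  G₃⁺ = positive-multiples 2 (_∸ 1)
  G₃²⁺ : PositiveSeries G₃²
  G₃²⁺ = _⊗_ {G≥ 3} {G≥ 3} G₃⁺ G₃⁺

theorem3p14 :
  let series = ¼ •ᶻ leafTwinnedSeries
      expansion =
          (K + (e 1 z^ 1) * G) * ((G≥ 3 * G≥ 3) * recip D)
        + (e 1 z^ 1) * (G≥ 3 * G≥ 3)
        + ( G≥ 3 * ∑≥ 3 (λ i → i •ℕ e i)
          + (e 1 z^ 1) * ∑≥ 4 (λ i → (i ∸ 1) •ℕ e i)
          + (e 2 z^ 2) * ∑≥ 3 (λ i → (i ∸ 2) •ℕ e i))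
        + ∑≥ 5 (λ i → i •ℕ e i)
      pathExpression =
          𝒳P * (G≥ 3 * G≥ 3)
        + K≥ 5
        + G≥ 3 * ∑≥ 3 e
        + (e 1 z^ 1) * G≥ 4
        + (e 2 z^ 2) * ∑≥ 3 (λ i → (i ∸ 2) •ℕ e i)
  in (series ≈ expansion × EPositiveSeries expansion)
   × (series ≈ pathExpression × EPositiveSeries pathExpression)
theorem3p14 =
  ((λ n α → ≡.trans (series≈pathExpression n α) (expressions≈ n α)) , epositive-expansion) ,
  -- `𝒳P` is given by colourings, with no positivity in sight; the positivity of the second
  -- expression is therefore taken from the equal first one.
  (series≈pathExpression , λ n → epositive-resp {pathExpression n} {expansion n} (expressions≈ n) (epositive-expansion n))
  where
  epositive-expansion : EPositiveSeries expansion
  epositive-expansion n = positive⇒epositive (positive-expansion n)
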